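{- Let $(W,S)$ be a Coxeter system and $\lambda$ a nearly-maximal labelling of a staircase diagram $\mathcal D$ on its Coxeter–Dynkin graph. Then $$\operatorname{bp}(\Lambda(\mathcal D))=\bigcup_{B\in\max(\mathcal D)}\operatorname{bp}(\lambda(B))\setminus J_R(B),$$ where $\max(\mathcal D)$ is the set of maximal blocks of $\mathcal D$.
   Context: Coxeter–Dynkin graph on $S$ with $s\sim t$ iff $m_{st}\ge3$. For $J\subseteq S$: $W_J$, $W^J$ minimal length left coset representatives, $u_J$ longest element of $W_J$ when finite. $D_L,D_R$ descent sets, $S(w)$ support. BP decomposition of $w$ with respect to $J$: the parabolic decomposition $w=vu$, $v\in W^J,u\in W_J$, when $S(v)\cap J\subseteq D_L(u)$; Grassmannian if $|J|=|S(w)|-1$. For $w\in W$, $\operatorname{bp}(w)=\{s\in S: w$ has a BP decomposition with respect to $S\setminus\{s\}\}$. $w$ is maximal if $w=u_{S(w)}$; a non-maximal $w$ is nearly-maximal if it has a Grassmannian BP decomposition $w=vu$ with $S(u)\subset S(v)$. Staircase diagram: poset $(\mathcal D,\preceq)$ of nonempty subsets (blocks) of $S$ with: (1) each block connected, and if $B$ covers $B'$ then $B\cup B'$ connected; (2) $\mathcal D_s=\{B:s\in B\}$ a chain; (3) if $s\sim t$, $\mathcal D_s\cup\mathcal D_t$ a chain in which $\mathcal D_s,\mathcal D_t$ are saturated; (4) each $B$ is the minimum of some $\mathcal D_s$ and maximum of some $\mathcal D_{s'}$. $J_R(B)=\{s\in B: B\ne\min\mathcal D_s\}$, $J_L(B)=\{s\in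 B: B\ne\max\mathcal D_s\}$. Labelling: $\lambda:\mathcal D\to W$ (with these sets spherical) such that $J_R(B)\subseteq D_R(\lambda(B))$, $J_L(B)\subseteq D_L(\lambda(B))$, $S(\lambda(B)u_{J_R(B)})=S(u_{J_L(B)}\lambda(B))=B$; nearly-maximal if each $\lambda(B)$ is maximal or nearly-maximal. $\Lambda(\mathcal D)=\overline\lambda(B_n)\cdots\overline\lambda(B_1)$ with $\overline\lambda(B)=\lambda(B)u_{J_R(B)}$ for any linear extension $B_1,\dots,B_n$.
   Formalization: Here bp(w) is taken inside the support: s must lie in S(w), with J = S(w)∖{s}. If s ranges over all of S the identity fails (type A2, blocks {1}<{2}, Λ = s2s1: 1 ∈ bp(s2) trivially, but 1 ∉ bp(s2s1)). The generating set S is finite. -}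

module Defs where

open import Data.Nat using (ℕ; zero; suc; _≤_; _<_)
open import Data.Fin using (Fin; toℕ)
open import Data.List using (List; []; _∷_; _++_; length; concat; reverse; tabulate)
open import Data.List.Membership.Propositional using () renaming (_∈_ to _∈L_)
open import Data.List.Relation.Unary.All using (All)
open import Data.Product using (Σ; ∃; ∃-syntax; _×_; _,_)
open import Data.Sum using (_⊎_)
open import Relation.Nullary using (¬_)
open import Relation.Binary.PropositionalEquality using (_≡_; _≢_)
open import Relation.Binary.Structures using (IsPartialOrder)
open import Relation.Binary.Construct.Closure.Equivalence using (EqClosure)
open import Data.Fin.Subset using (Subset) renaming (_∈_ to _∈S_)

-- A Coxeter matrix on the finite generating set S = Fin n.
-- m s t = 0 encodes m_st = ∞.
record CoxeterMatrix (n : ℕ) : Set where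
  field
    m       : Fin n → Fin n → ℕ
    m-diag  : ∀ s → m s s ≡ 1
    m-sym   : ∀ s t → m s t ≡ m t s
    m-off   : ∀ s t → s ≢ t → m s t ≢ 1

SSet : ℕ → Set₁
SSet n = Fin n → Set

module Coxeter {n : ℕ} (M : CoxeterMatrix n) where
  open CoxeterMatrix M

  -- Elements of W are represented by words in S, with W = Word / _≈_.
  Word : Set
  Word = List (Fin n)

  alt : Fin n → Fin n → ℕ → Word
  alt s t zero    = []
  alt s t (suc k) = s ∷ alt t s k

  data Rel₀ : Word → Word → Set where
    involution : ∀ s → Rel₀ (s ∷ s ∷ []) []
    braid      : ∀ s t → m s t ≢ 0 → Rel₀ (alt s t (m s t)) (alt t s (m s t))

  data Step : Word → Word → Set where
    step : ∀ (u v : Word) {a b : Word} → Rel₀ a b → Step (u ++ a ++ v) (u ++ b ++ v)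

  _≈_ : Word → Word → Set
  _≈_ = EqClosure Step

  Adjacent : Fin n → Fin n → Set
  Adjacent s t = (3 ≤ m s t) ⊎ (m s t ≡ 0)

  data PathIn (J : SSet n) : Fin n → Fin n → Set where
    here  : ∀ {s} → J s → PathIn J s s
    there : ∀ {s t u} → J s → Adjacent s t → PathIn J t u → PathIn J s u

  Connected : SSet n → Set
  Connected J = ∀ s t → J s → J t → PathIn J s t

  LenLt : Word → Word → Set
  LenLt a b = ∃[ x ] (x ≈ a × (∀ y → y ≈ b → length x < length y))

  LenLe : Word → Word → Set
  LenLe a b = ∀ y → y ≈ b → ∃[ x ] (x ≈ a × length x ≤ length y)

  Reduced : Word → Set
  Reduced x = ∀ y → y ≈ x → length x ≤ length y

  RightDescent : Word → Fin n → Set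
  RightDescent w s = LenLt (w ++ (s ∷ [])) w

  LeftDescent : Word → Fin n → Set
  LeftDescent w s = LenLt (s ∷ w) w

  Supp : Word → SSet n
  Supp w s = ∃[ x ] (x ≈ w × Reduced x × s ∈L x)

  InParabolic : SSet n → Word → Set
  InParabolic J w = ∃[ x ] (x ≈ w × All J x)

  Spherical : SSet n → Set
  Spherical J = ∃[ L ] (∀ w → InParabolic J w → ∃[ x ] (x ∈L L × x ≈ w))

  IsLongest : SSet n → Word → Set
  IsLongest J w = InParabolic J w × (∀ x → InParabolic J x → LenLe x w)

  MinCosetRep : SSet n → Word → Set
  MinCosetRep J v = ∀ u → InParabolic J u → LenLe v (v ++ u)

  BPDecomp : SSet n → Word → Word → Word → Set
  BPDecomp J w v u =
    ((v ++ u) ≈ w) × MinCosetRep J v × InParabolic J u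
    × (∀ s → J s → Supp v s → LeftDescent u s)

  HasBP : SSet n → Word → Set
  HasBP J w = ∃[ v ] ∃[ u ] BPDecomp J w v u

  SuppMinus : Word → Fin n → SSet n
  SuppMinus w s t = Supp w t × t ≢ s

  bp : Word → SSet n
  bp w s = Supp w s × HasBP (SuppMinus w s) w

  Maximal : Word → Set
  Maximal w = Spherical (Supp w) × IsLongest (Supp w) w

  ProperSubset : SSet n → SSet n → Set
  ProperSubset A B = (∀ t → A t → B t) × ∃[ t ] (B t × ¬ A t)

  NearlyMaximal : Word → Set
  NearlyMaximal w =
    ¬ Maximal w ×
    ∃[ s ] ∃[ v ] ∃[ u ] (Supp w s × BPDecomp (SuppMinus w s) w v u
                          × ProperSubset (Supp u) (Supp v))

  record StaircaseDiagram : Set₁ where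
    field
      k         : ℕ
      block     : Fin k → Subset n
      block-inj : ∀ i j → block i ≡ block j → i ≡ j
      _≼_       : Fin k → Fin k → Set
      ≼-po      : IsPartialOrder _≡_ _≼_
      nonempty  : ∀ i → ∃[ s ] (s ∈S block i)
      connected : ∀ i → Connected (λ s → s ∈S block i)
      cover-connected :
        ∀ i j → (i ≼ j × i ≢ j) → (∀ c → ¬ ((i ≼ c × i ≢ c) × (c ≼ j × c ≢ j))) →
        Connected (λ s → (s ∈S block i) ⊎ (s ∈S block j))
      chain : ∀ s i j → s ∈S block i → s ∈S block j → (i ≼ j) ⊎ (j ≼ i)
      adj-chain : ∀ s t → Adjacent s t → ∀ i j →
        ((s ∈S block i) ⊎ (t ∈S block i)) → ((s ∈S block j) ⊎ (t ∈S block j)) →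
        (i ≼ j) ⊎ (j ≼ i)
      adj-saturated : ∀ s t → Adjacent s t → ∀ i c j →
        s ∈S block i → s ∈S block j → ((s ∈S block c) ⊎ (t ∈S block c)) →
        i ≼ c → c ≼ j → s ∈S block c
      is-min : ∀ i → ∃[ s ] (s ∈S block i × (∀ j → s ∈S block j → i ≼ j))
      is-max : ∀ i → ∃[ s ] (s ∈S block i × (∀ j → s ∈S block j → j ≼ i))

  module _ (D : StaircaseDiagram) where
    open StaircaseDiagram D

    JR : Fin k → SSet n
    JR i s = s ∈S block i × ¬ (∀ j → s ∈S block j → i ≼ j)

    JL : Fin k → SSet n
    JL i s = s ∈S block i × ¬ (∀ j → s ∈S block j → j ≼ i)

    IsMaxBlock : Fin k → Set
    IsMaxBlock i = ∀ j → i ≼ j → j ≡ i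

    -- linear extension B_1 = σ 0, …, B_k = σ (k-1)
    LinearExtension : (Fin k → Fin k) → Set
    LinearExtension σ = (∀ a b → σ a ≡ σ b → a ≡ b) × (∀ a b → σ a ≼ σ b → toℕ a ≤ toℕ b)

    -- a labelling, together with chosen longest elements u_{J_R(B)}, u_{J_L(B)}
    record Labelling : Set where
      field
        lab     : Fin k → Word
        uR      : Fin k → Word
        uL      : Fin k → Word
        sphR    : ∀ i → Spherical (JR i)
        sphL    : ∀ i → Spherical (JL i)
        uR-long : ∀ i → IsLongest (JR i) (uR i)
        uL-long : ∀ i → IsLongest (JL i) (uL i)
        descR   : ∀ i s → JR i s → RightDescent (lab i) s
        descL   : ∀ i s → JL i s → LeftDescent (lab i) s
        suppR   : ∀ i s → (Supp (lab i ++ uR i) s → s ∈S block i) × (s ∈S block i → Supp (lab i ++ uR i) s)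
        suppL   : ∀ i s → (Supp (uL i ++ lab i) s → s ∈S block i) × (s ∈S block i → Supp (uL i ++ lab i) s)

      NearlyMaximalLabelling : Set
      NearlyMaximalLabelling = ∀ i → Maximal (lab i) ⊎ NearlyMaximal (lab i)

      λbar : Fin k → Word
      λbar i = lab i ++ uR i

      Λ : (Fin k → Fin k) → Word
      Λ σ = concat (reverse (tabulate (λ a → λbar (σ a))))

{-# OPTIONS --safe #-}
-- Read from right to left, the letters of a reduced word of w that are reached from s by successive adjacency form
-- the support of the minimal representative v of w modulo the parabolic subgroup omitting s.  If w = v u is a BP
-- decomposition, every letter of v even reaches all of S(v), because S(v) ∖ s consists of left descents of u.
--
-- Let w = Λ(D), let s ∈ bp(w), and let C be the lowest block containing s.  Near-maximality says that inside λ(B) every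
-- letter reaches the whole block B.  Hence S(v) contains C and, if C were not maximal, also a block B covering C;
-- but a letter with lowest block B cannot reach a letter with highest block C.  So C is maximal and s ∉ J_R(C).
-- For a maximal block C all blocks incomparable to C commute with it, which gives a reduced factorisation
-- w = λ(C) w″ where w″ has no left descent in C; BP decompositions of w and of λ(C) at s ∉ J_R(C) then
-- determine each other.
--
-- The necessary Coxeter theory is obtained from the presentation: exchange comes from counting reflections modulo 2,
-- and s t has order exactly m s t because of the numbers game, played with integer-valued functions in
-- place of real numbers.
module Submission where

open import Defs
open import Data.Bool.Base using (Bool; true; false; not; _xor_)
import Data.Bool.Properties as Bool
open import Data.Empty using (⊥; ⊥-elim)
open import Data.Fin using (Fin; toℕ; combine; remQuot; punchOut)
import Data.Fin.Properties as Fin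
open import Data.Fin.Subset using () renaming (_∈_ to _∈S_)
open import Data.Fin.Subset.Properties using (_∈?_)
open import Data.List
  using (List; []; _∷_; _++_; length; concat; reverse; tabulate; map; applyUpTo; applyDownFrom)
import Data.List.Properties as List
open import Data.List.Membership.Propositional using (find) renaming (_∈_ to _∈L_)
open import Data.List.Membership.Propositional.Properties using (∈-++⁺ˡ; ∈-++⁺ʳ; ∈-++⁻; ∈-∃++; ∈-tabulate⁺)
open import Data.List.Relation.Binary.Pointwise using (Pointwise; []; _∷_)
open import Data.List.Relation.Binary.Subset.Propositional using (_⊆_)
open import Data.List.Relation.Binary.Subset.Propositional.Properties using (∷⁺ʳ)
open import Data.List.Relation.Unary.All using (All; []; _∷_)
import Data.List.Relation.Unary.All as All
import Data.List.Relation.Unary.All.Properties as AllP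
open import Data.List.Relation.Unary.AllPairs using (AllPairs; []; _∷_)
import Data.List.Relation.Unary.AllPairs as AllPairs
import Data.List.Relation.Unary.AllPairs.Properties as AllPairsP
open import Data.List.Relation.Unary.Any using (Any; here; there)
import Data.List.Relation.Unary.Any as Any
import Data.List.Relation.Unary.Any.Properties as AnyP
open import Data.Nat using (ℕ; zero; suc; _+_; _*_; _∸_; _≤_; _<_; z≤n; s≤s; _≤?_; _<?_)
import Data.Nat.Properties as ℕ
open import Data.Product using (Σ; ∃-syntax; _×_; _,_; proj₁; proj₂)
open import Data.Sum using (_⊎_; inj₁; inj₂)
import Data.Sum as Sum
open import Function using (_∘_; id; case_of_)
open import Relation.Binary.Construct.Closure.ReflexiveTransitive using (ε; _◅_; _◅◅_)
open import Relation.Binary.Construct.Closure.Symmetric using (SymClosure; fwd; bwd)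
import Relation.Binary.Construct.Closure.Equivalence as EqC
open import Relation.Binary.Definitions using (tri<; tri≈; tri>)
open import Relation.Binary.PropositionalEquality
open import Relation.Binary.Structures using (IsPartialOrder)
open import Relation.Nullary using (¬_; Dec; yes; no; contradiction; ¬¬-excluded-middle)
open import Relation.Nullary.Decidable using (decidable-stable; _×-dec_)
open import Relation.Nullary.Negation using (¬¬-map)

-- The set of letters reached from `s` is useful only if it does not depend on the reduced word, so
-- everything hinges on Matsumoto's theorem. That theorem, and the decision of descents, rest on one
-- fact: if `s` and `t` are both left descents of an element, the whole alternating word of length
-- `m s t` is a prefix of it. This would fail if `s t` had a smaller order, which the relations
-- alone do not exclude, so some representation must separate the powers of `s t`. The usual one
-- needs the numbers 2 cos (π / m). Here an operator replaces them, the sum of the two unit shifts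
-- of a function; oddness and antiperiodicity of the function supply the identities that the cosine
-- would supply. Every pair of generators gets a coordinate of its own, because different orders
-- require different periods. Supports and descents quantify over all equivalent words. Until
-- descents are decided, equality of elements can be discussed only under double negations; deciding
-- descents yields reduced words, lengths and supports as computable data and removes the negations.

isOdd : ℕ → Bool
isOdd zero = false
isOdd (suc k) = not (isOdd k)

-- Words modulo the Coxeter relations: group laws, parity, dihedral identities.

module WordGroup {n : ℕ} (M : CoxeterMatrix n) where
  open CoxeterMatrix M
  open Coxeter M renaming (_≈_ to infix 4 _≈_)

  ≈-refl : ∀ {x} → x ≈ x
  ≈-refl = ε

  ≈-sym : ∀ {x y} → x ≈ y → y ≈ x
  ≈-sym = EqC.symmetric Step

  ≈-trans : ∀ {x y z} → x ≈ y → y ≈ z → x ≈ z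
  ≈-trans = _◅◅_

  ≡⇒≈ : ∀ {x y} → x ≡ y → x ≈ y
  ≡⇒≈ refl = ε

  module ≈-Reasoning where
    open import Relation.Binary.Reasoning.Setoid (EqC.setoid Step) public

  rel⇒≈ : ∀ {a b} → Rel₀ a b → a ≈ b
  rel⇒≈ {a} {b} r = subst₂ _≈_ (List.++-identityʳ a) (List.++-identityʳ b) (fwd (step [] [] r) ◅ ε)

  ++-congˡ : ∀ p {x y} → x ≈ y → p ++ x ≈ p ++ y
  ++-congˡ p = EqC.gmap (p ++_) λ { (step u v {a} {b} r) →
    subst₂ Step (List.++-assoc p u (a ++ v)) (List.++-assoc p u (b ++ v)) (step (p ++ u) v r) }

  ++-congʳ : ∀ q {x y} → x ≈ y → x ++ q ≈ y ++ q
  ++-congʳ q = EqC.gmap (_++ q) λ { (step u v {a} {b} r) →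
    subst₂ Step (reassoc u a v) (reassoc u b v) (step u (v ++ q) r) }
    where
    reassoc : ∀ u a v → u ++ a ++ v ++ q ≡ (u ++ a ++ v) ++ q
    reassoc u a v = trans (cong (u ++_) (sym (List.++-assoc a v q))) (sym (List.++-assoc u (a ++ v) q))

  ++-cong : ∀ {x x′ y y′} → x ≈ x′ → y ≈ y′ → x ++ y ≈ x′ ++ y′
  ++-cong {x′ = x′} {y} p q = ≈-trans (++-congʳ y p) (++-congˡ x′ q)

  ∷-cong : ∀ s {x y} → x ≈ y → s ∷ x ≈ s ∷ y
  ∷-cong s = ++-congˡ (s ∷ [])

  ss≈[] : ∀ s → s ∷ s ∷ [] ≈ []
  ss≈[] s = rel⇒≈ (involution s)

  ss-cancel : ∀ s x → s ∷ s ∷ x ≈ x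
  ss-cancel s x = ++-congʳ x (ss≈[] s)

  ∷-cancel : ∀ s {x y} → s ∷ x ≈ s ∷ y → x ≈ y
  ∷-cancel s {x} {y} p = ≈-trans (≈-sym (ss-cancel s x)) (≈-trans (∷-cong s p) (ss-cancel s y))

  ∷-transpose : ∀ s {x y} → s ∷ x ≈ y → x ≈ s ∷ y
  ∷-transpose s {x} p = ≈-trans (≈-sym (ss-cancel s x)) (∷-cong s p)

  ++-cancelˡ : ∀ p {x y} → p ++ x ≈ p ++ y → x ≈ y
  ++-cancelˡ [] e = e
  ++-cancelˡ (s ∷ p) e = ++-cancelˡ p (∷-cancel s e)

  reverse-∷ : ∀ s (x : Word) → reverse (s ∷ x) ≡ reverse x ++ s ∷ []
  reverse-∷ s x = List.unfold-reverse s x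

  reverse-inverseˡ : ∀ x → reverse x ++ x ≈ []
  reverse-inverseˡ [] = ε
  reverse-inverseˡ (s ∷ x) = begin
    reverse (s ∷ x) ++ s ∷ x        ≡⟨ cong (_++ s ∷ x) (reverse-∷ s x) ⟩
    (reverse x ++ s ∷ []) ++ s ∷ x  ≡⟨ List.++-assoc (reverse x) (s ∷ []) (s ∷ x) ⟩
    reverse x ++ s ∷ s ∷ x          ≈⟨ ++-congˡ (reverse x) (ss-cancel s x) ⟩
    reverse x ++ x                  ≈⟨ reverse-inverseˡ x ⟩
    []                              ∎
    where open ≈-Reasoning

  reverse-inverseʳ : ∀ x → x ++ reverse x ≈ []
  reverse-inverseʳ x =
    subst (λ y → y ++ reverse x ≈ []) (List.reverse-involutive x) (reverse-inverseˡ (reverse x))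

  reverse-cancelˡ : ∀ x y → reverse x ++ x ++ y ≈ y
  reverse-cancelˡ x y =
    ≈-trans (≡⇒≈ (sym (List.++-assoc (reverse x) x y))) (++-congʳ y (reverse-inverseˡ x))

  reverse-cancelʳ : ∀ x y → x ++ reverse x ++ y ≈ y
  reverse-cancelʳ x y =
    ≈-trans (≡⇒≈ (sym (List.++-assoc x (reverse x) y))) (++-congʳ y (reverse-inverseʳ x))

  ++-transposeˡ : ∀ p {x y} → p ++ x ≈ y → x ≈ reverse p ++ y
  ++-transposeˡ p {x} e = ≈-trans (≈-sym (reverse-cancelˡ p x)) (++-congˡ (reverse p) e)

  reverse-cong : ∀ {x y} → x ≈ y → reverse x ≈ reverse y
  reverse-cong {x} {y} e = begin
    reverse x                    ≡⟨ List.++-identityʳ (reverse x) ⟨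
    reverse x ++ []              ≈⟨ ++-congˡ (reverse x) (reverse-inverseʳ y) ⟨
    reverse x ++ y ++ reverse y  ≈⟨ ++-congˡ (reverse x) (++-congʳ (reverse y) e) ⟨
    reverse x ++ x ++ reverse y  ≈⟨ reverse-cancelˡ x (reverse y) ⟩
    reverse y                    ∎
    where open ≈-Reasoning

  isOdd-comm : ∀ j k → isOdd (j + k) ≡ isOdd (k + j)
  isOdd-comm j k = cong isOdd (ℕ.+-comm j k)

  isOdd-+-cong : ∀ i {j k} → isOdd j ≡ isOdd k → isOdd (i + j) ≡ isOdd (i + k)
  isOdd-+-cong zero e = e
  isOdd-+-cong (suc i) e = cong not (isOdd-+-cong i e)

  alt-length : ∀ s t k → length (alt s t k) ≡ k
  alt-length s t zero = refl
  alt-length s t (suc k) = cong suc (alt-length t s k)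

  rel-odd : ∀ {a b} → Rel₀ a b → isOdd (length a) ≡ isOdd (length b)
  rel-odd (involution s) = refl
  rel-odd (braid s t _) = cong isOdd (trans (alt-length s t (m s t)) (sym (alt-length t s (m s t))))

  step-odd : ∀ {x y} → Step x y → isOdd (length x) ≡ isOdd (length y)
  step-odd (step u v {a} {b} r) = begin
    isOdd (length (u ++ a ++ v))            ≡⟨ expand a ⟩
    isOdd (length u + (length a + length v)) ≡⟨ isOdd-+-cong (length u) (begin
      isOdd (length a + length v)  ≡⟨ isOdd-comm (length a) (length v) ⟩
      isOdd (length v + length a)  ≡⟨ isOdd-+-cong (length v) (rel-odd r) ⟩
      isOdd (length v + length b)  ≡⟨ isOdd-comm (length v) (length b) ⟩
      isOdd (length b + length v)  ∎) ⟩
    isOdd (length u + (length b + length v)) ≡⟨ expand b ⟨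
    isOdd (length (u ++ b ++ v))            ∎
    where
    open ≡-Reasoning
    expand : ∀ c → isOdd (length (u ++ c ++ v)) ≡ isOdd (length u + (length c + length v))
    expand c = cong isOdd (trans (List.length-++ u) (cong (length u +_) (List.length-++ c)))

  ≈-odd : ∀ {x y} → x ≈ y → isOdd (length x) ≡ isOdd (length y)
  ≈-odd ε = refl
  ≈-odd (fwd p ◅ ps) = trans (step-odd p) (≈-odd ps)
  ≈-odd (bwd p ◅ ps) = trans (sym (step-odd p)) (≈-odd ps)

  ≈-length≢suc : ∀ {x y} → x ≈ y → length x ≢ suc (length y)
  ≈-length≢suc {x} {y} e eq = Bool.not-¬ refl (trans (sym (≈-odd e)) (cong isOdd eq))

  alt-braid : ∀ s t → m s t ≢ 0 → alt s t (m s t) ≈ alt t s (m s t)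
  alt-braid s t m≢0 = rel⇒≈ (braid s t m≢0)

  -- The braid relation rewrites the last `m s t` letters; the `d` letters in front then cancel one
  -- at a time.
  alt-braid-shift : ∀ s t → m s t ≢ 0 → ∀ d i j → i ≡ d + m s t → d + j ≡ m s t → alt s t i ≈ alt t s j
  alt-braid-shift s t m≢0 zero i j refl refl = alt-braid s t m≢0
  alt-braid-shift s t m≢0 (suc d) (suc i) j refl eq = begin
    s ∷ alt t s (d + m s t)     ≡⟨ cong (λ k → s ∷ alt t s (d + k)) (m-sym s t) ⟩
    s ∷ alt t s (d + m t s)     ≈⟨ ∷-cong s (alt-braid-shift t s (subst (_≢ 0) (m-sym s t) m≢0) d _ (suc j) refl
                                     (trans (ℕ.+-suc d j) (trans eq (m-sym s t)))) ⟩
    s ∷ s ∷ alt t s j           ≈⟨ ss-cancel s _ ⟩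
    alt t s j                   ∎
    where open ≈-Reasoning

  -- Applied to odd lengths, this pairs the reflections of the two sides of a braid relation in
  -- opposite orders.
  alt-complement : ∀ s t → m s t ≢ 0 → ∀ i j → i + j ≡ m s t + m s t → alt s t i ≈ alt t s j
  alt-complement s t m≢0 i j eq with ℕ.≤-total (m s t) i
  ... | inj₁ m≤i = alt-braid-shift s t m≢0 (i ∸ m s t) i j (sym (ℕ.m∸n+n≡m m≤i))
                     (ℕ.+-cancelʳ-≡ (m s t) _ _ (begin
                       i ∸ m s t + j + m s t    ≡⟨ ℕ.+-assoc (i ∸ m s t) j (m s t) ⟩
                       i ∸ m s t + (j + m s t)  ≡⟨ cong (i ∸ m s t +_) (ℕ.+-comm j (m s t)) ⟩
                       i ∸ m s t + (m s t + j)  ≡⟨ ℕ.+-assoc (i ∸ m s t) (m s t) j ⟨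
                       i ∸ m s t + m s t + j    ≡⟨ cong (_+ j) (ℕ.m∸n+n≡m m≤i) ⟩
                       i + j                    ≡⟨ eq ⟩
                       m s t + m s t            ∎))
    where open ≡-Reasoning
  ... | inj₂ i≤m = ≈-sym (alt-braid-shift t s (subst (_≢ 0) (m-sym s t) m≢0) (m t s ∸ i) j i
                     (ℕ.+-cancelˡ-≡ i _ _ (begin
                       i + j                    ≡⟨ eq ⟩
                       m s t + m s t            ≡⟨ cong₂ _+_ (m-sym s t) (m-sym s t) ⟩
                       m t s + m t s            ≡⟨ cong (_+ m t s) (ℕ.m+[n∸m]≡n i≤m′) ⟨
                       i + (m t s ∸ i) + m t s  ≡⟨ ℕ.+-assoc i (m t s ∸ i) (m t s) ⟩
                       i + (m t s ∸ i + m t s)  ∎))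
                     (ℕ.m∸n+n≡m i≤m′))
    where
    open ≡-Reasoning
    i≤m′ : i ≤ m t s
    i≤m′ = subst (i ≤_) (m-sym s t) i≤m

-- Alternate firing of two vertices, as a recurrence on integer-valued functions.

module FiringSequence where
  open import Data.Integer using (ℤ; +_; -[1+_]; 0ℤ; 1ℤ; _⊖_) renaming (_+_ to _+ℤ_; _-_ to _-ℤ_; _*_ to _*ℤ_; -_ to -ℤ_)
  import Data.Integer.Properties as ℤ
  open import Data.Integer.Tactic.RingSolver using (solve-∀)

  Odd : (ℤ → ℤ) → Set
  Odd f = ∀ y → f (-ℤ y) ≡ -ℤ f y

  Antiperiodic : ℕ → (ℤ → ℤ) → Set
  Antiperiodic m f = ∀ y → f (y +ℤ + m) ≡ -ℤ f y

  x≡-x⇒x≡0 : ∀ x → x ≡ -ℤ x → x ≡ 0ℤ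
  x≡-x⇒x≡0 (+ zero) _ = refl

  odd-zero : ∀ {f} → Odd f → f 0ℤ ≡ 0ℤ
  odd-zero {f} o = x≡-x⇒x≡0 (f 0ℤ) (o 0ℤ)

  odd-vanishing : ∀ {f} → Odd f → (∀ k → f (+ k) ≡ 0ℤ) → ∀ y → f y ≡ 0ℤ
  odd-vanishing o v (+ k) = v k
  odd-vanishing o v -[1+ k ] = trans (o (+ suc k)) (cong -ℤ_ (v (suc k)))

  -- The hypothesis gives `f` the period 2, and oddness kills the values at 0 and 1. Hence an odd
  -- function is determined by its symmetric differences.
  odd-difference-vanishing : ∀ {f} → Odd f → (∀ y → f (y +ℤ 1ℤ) ≡ f (y -ℤ 1ℤ)) → ∀ y → f y ≡ 0ℤ
  odd-difference-vanishing {f} o d = odd-vanishing o (λ k → proj₁ (go k))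
    where
    go : ∀ k → f (+ k) ≡ 0ℤ × f (+ suc k) ≡ 0ℤ
    go zero = odd-zero o , x≡-x⇒x≡0 (f 1ℤ) (trans (d 0ℤ) (o 1ℤ))
    go (suc k) = proj₂ (go k) , trans (cong (f ∘ +_) (sym (ℕ.+-comm (suc k) 1))) (trans (d (+ suc k)) (proj₁ (go k)))

  -- Plays the part of multiplication by 2 cos (π / m).
  neighbours : (ℤ → ℤ) → ℤ → ℤ
  neighbours f y = f (y +ℤ 1ℤ) +ℤ f (y -ℤ 1ℤ)

  -- On odd functions the two equations force linear growth, which antiperiodicity forbids.
  coupled-vanishing : ∀ {f g} m → m ≢ 0 → Odd f → Odd g → Antiperiodic m f → Antiperiodic m g →
    (∀ y → neighbours f y ≡ g y +ℤ g y) → (∀ y → neighbours g y ≡ f y +ℤ f y) →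
    ∀ y → f y ≡ 0ℤ
  coupled-vanishing {f} {g} m m≢0 of og af ag ef eg = odd-vanishing of f-zero
    where
    slope : ℕ → ℤ
    slope zero = g 1ℤ
    slope (suc zero) = f 1ℤ
    slope (suc (suc k)) = slope k

    next : ∀ {h h′ : ℤ → ℤ} → (∀ y → neighbours h y ≡ h′ y +ℤ h′ y) → ∀ k →
      h (+ suc (suc k)) ≡ h′ (+ suc k) +ℤ h′ (+ suc k) -ℤ h (+ k)
    next {h} {h′} e k = trans (rearrange (h (+ suc (suc k))) (h (+ k))) (cong (_-ℤ h (+ k)) (trans (cong₂ _+ℤ_ (cong (h ∘ +_) (sym (ℕ.+-comm (suc k) 1))) refl) (e (+ suc k))))
      where
      rearrange : ∀ a b → a ≡ a +ℤ b -ℤ b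
      rearrange = solve-∀

    linear : ∀ k → (f (+ k) ≡ + k *ℤ slope k × g (+ k) ≡ + k *ℤ slope (suc k)) ×
                   (f (+ suc k) ≡ + suc k *ℤ slope (suc k) × g (+ suc k) ≡ + suc k *ℤ slope k)
    linear zero = (odd-zero of , odd-zero og) , (sym (ℤ.*-identityˡ (f 1ℤ)) , sym (ℤ.*-identityˡ (g 1ℤ)))
    linear (suc k) with linear k
    ... | (fk , gk) , (fk′ , gk′) = (fk′ , gk′) ,
      ( trans (next {f} {g} ef k) (trans (cong₂ _-ℤ_ (cong₂ _+ℤ_ gk′ gk′) fk) (regroup (+ k) (slope k)))
      , trans (next {g} {f} eg k) (trans (cong₂ _-ℤ_ (cong₂ _+ℤ_ fk′ fk′) gk) (regroup (+ k) (slope (suc k)))) )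
      where
      regroup : ∀ a b → (1ℤ +ℤ a) *ℤ b +ℤ (1ℤ +ℤ a) *ℤ b -ℤ a *ℤ b ≡ (1ℤ +ℤ (1ℤ +ℤ a)) *ℤ b
      regroup = solve-∀

    cancel-m : ∀ {x} → + m *ℤ x ≡ 0ℤ → x ≡ 0ℤ
    cancel-m {x} e with ℤ.i*j≡0⇒i≡0∨j≡0 (+ m) e
    ... | inj₁ m≡0 = contradiction (ℤ.+-injective m≡0) m≢0
    ... | inj₂ x≡0 = x≡0

    at-m : ∀ {h} → Odd h → Antiperiodic m h → h (+ m) ≡ 0ℤ
    at-m {h} o a = trans (cong h (sym (ℤ.+-identityˡ (+ m)))) (trans (a 0ℤ) (cong -ℤ_ (odd-zero o)))

    descend : ∀ k → slope k ≡ 0ℤ → slope (suc k) ≡ 0ℤ → slope 0 ≡ 0ℤ × slope 1 ≡ 0ℤ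
    descend zero e e′ = e , e′
    descend (suc k) e e′ = descend k e′ e

    -- Both functions vanish at 0 and therefore, by antiperiodicity, at `m`. There their values are
    -- `m` times the two slopes.
    slopes : slope 0 ≡ 0ℤ × slope 1 ≡ 0ℤ
    slopes = descend m (cancel-m (trans (sym (proj₁ (proj₁ (linear m)))) (at-m {f} of af)))
                       (cancel-m (trans (sym (proj₂ (proj₁ (linear m)))) (at-m {g} og ag)))

    all-slopes : ∀ k → slope k ≡ 0ℤ
    all-slopes zero = proj₁ slopes
    all-slopes (suc zero) = proj₂ slopes
    all-slopes (suc (suc k)) = all-slopes k

    f-zero : ∀ k → f (+ k) ≡ 0ℤ
    f-zero k = trans (proj₁ (proj₁ (linear k))) (trans (cong (+ k *ℤ_) (all-slopes k)) (ℤ.*-zeroʳ (+ k)))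

  -- Sums of the terms of odd and of even index among z 1, ..., z k. These are the totals fired at
  -- the first and at the second vertex, which is all that a third vertex notices of the play.
  oddSum evenSum : {X : Set} → (ℕ → X → ℤ) → ℕ → X → ℤ
  oddSum z zero x = 0ℤ
  oddSum z (suc k) x = z 1 x +ℤ evenSum (z ∘ suc) k x
  evenSum z zero x = 0ℤ
  evenSum z (suc k) x = oddSum (z ∘ suc) k x

  module _ {X : Set} (P : (X → ℤ) → Set) (P-zero : P (λ _ → 0ℤ))
    (P-+ : ∀ {f g} → P f → P g → P (λ x → f x +ℤ g x)) where

    oddSum-closed : ∀ z → (∀ j → P (z j)) → ∀ k → P (oddSum z k)
    evenSum-closed : ∀ z → (∀ j → P (z j)) → ∀ k → P (evenSum z k)
    oddSum-closed z p zero = P-zero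
    oddSum-closed z p (suc k) = P-+ (p 1) (evenSum-closed (z ∘ suc) (p ∘ suc) k)
    evenSum-closed z p zero = P-zero
    evenSum-closed z p (suc k) = oddSum-closed (z ∘ suc) (p ∘ suc) k

  odd-+ : ∀ {f g} → Odd f → Odd g → Odd (λ y → f y +ℤ g y)
  odd-+ {f} {g} p q y = trans (cong₂ _+ℤ_ (p y) (q y)) (sym (ℤ.neg-distrib-+ (f y) (g y)))

  odd-neg : ∀ {f} → Odd f → Odd (λ y → -ℤ f y)
  odd-neg p y = cong -ℤ_ (p y)

  anti-+ : ∀ {m f g} → Antiperiodic m f → Antiperiodic m g → Antiperiodic m (λ y → f y +ℤ g y)
  anti-+ {f = f} {g} p q y = trans (cong₂ _+ℤ_ (p y) (q y)) (sym (ℤ.neg-distrib-+ (f y) (g y)))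

  anti-neg : ∀ {m f} → Antiperiodic m f → Antiperiodic m (λ y → -ℤ f y)
  anti-neg p y = cong -ℤ_ (p y)

  odd-neighbours : ∀ {f} → Odd f → Odd (neighbours f)
  odd-neighbours {f} o y = begin
    f (-ℤ y +ℤ 1ℤ) +ℤ f (-ℤ y -ℤ 1ℤ)        ≡⟨ cong₂ (λ a b → f a +ℤ f b) (flip₁ y) (flip₂ y) ⟩
    f (-ℤ (y -ℤ 1ℤ)) +ℤ f (-ℤ (y +ℤ 1ℤ))    ≡⟨ cong₂ _+ℤ_ (o (y -ℤ 1ℤ)) (o (y +ℤ 1ℤ)) ⟩
    -ℤ f (y -ℤ 1ℤ) +ℤ -ℤ f (y +ℤ 1ℤ)        ≡⟨ swap (f (y -ℤ 1ℤ)) (f (y +ℤ 1ℤ)) ⟩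
    -ℤ (f (y +ℤ 1ℤ) +ℤ f (y -ℤ 1ℤ))         ∎
    where
    open ≡-Reasoning
    flip₁ : ∀ y → -ℤ y +ℤ 1ℤ ≡ -ℤ (y -ℤ 1ℤ)
    flip₁ = solve-∀
    flip₂ : ∀ y → -ℤ y -ℤ 1ℤ ≡ -ℤ (y +ℤ 1ℤ)
    flip₂ = solve-∀
    swap : ∀ a b → -ℤ a +ℤ -ℤ b ≡ -ℤ (b +ℤ a)
    swap = solve-∀

  anti-neighbours : ∀ {m f} → Antiperiodic m f → Antiperiodic m (neighbours f)
  anti-neighbours {m} {f} p y = begin
    f (y +ℤ + m +ℤ 1ℤ) +ℤ f (y +ℤ + m -ℤ 1ℤ)      ≡⟨ cong₂ (λ a b → f a +ℤ f b) (commute y (+ m) 1ℤ) (commute y (+ m) (-ℤ 1ℤ)) ⟩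
    f (y +ℤ 1ℤ +ℤ + m) +ℤ f (y -ℤ 1ℤ +ℤ + m)      ≡⟨ cong₂ _+ℤ_ (p (y +ℤ 1ℤ)) (p (y -ℤ 1ℤ)) ⟩
    -ℤ f (y +ℤ 1ℤ) +ℤ -ℤ f (y -ℤ 1ℤ)             ≡⟨ ℤ.neg-distrib-+ (f (y +ℤ 1ℤ)) (f (y -ℤ 1ℤ)) ⟨
    -ℤ (f (y +ℤ 1ℤ) +ℤ f (y -ℤ 1ℤ))              ∎
    where
    open ≡-Reasoning
    commute : ∀ a b c → a +ℤ b +ℤ c ≡ a +ℤ c +ℤ b
    commute = solve-∀

  -- The three-term recurrence of the Chebyshev polynomials, with `neighbours` as its variable.
  Recurrence : (ℕ → ℤ → ℤ) → Set
  Recurrence z = ∀ j y → z (suc (suc j)) y ≡ neighbours (z (suc j)) y -ℤ z j y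

  -- Invariants of the partial sums of odd-indexed and even-indexed terms; the boundary terms depend on
  -- the parity of the number of summands.
  boundary₁ boundary₂ : Bool → ℤ → ℤ → ℤ → ℤ → ℤ
  boundary₁ true  z₀ z₁ zₖ zₖ₊₁ = z₀ +ℤ zₖ₊₁
  boundary₁ false z₀ z₁ zₖ zₖ₊₁ = z₀ -ℤ zₖ
  boundary₂ true  z₀ z₁ zₖ zₖ₊₁ = -ℤ z₁ -ℤ zₖ
  boundary₂ false z₀ z₁ zₖ zₖ₊₁ = -ℤ z₁ +ℤ zₖ₊₁

  -- By the recurrence, `neighbours` of a term is the sum of the terms before and after it. In a sum
  -- over one parity every inner term of the other parity is thus counted twice, and only the ends
  -- need a correction.
  sums : ∀ z → Recurrence z → ∀ k y →
    neighbours (oddSum z k) y ≡ evenSum z k y +ℤ evenSum z k y +ℤ boundary₁ (isOdd k) (z 0 y) (z 1 y) (z k y) (z (suc k) y)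
    × neighbours (evenSum z k) y ≡ oddSum z k y +ℤ oddSum z k y +ℤ boundary₂ (isOdd k) (z 0 y) (z 1 y) (z k y) (z (suc k) y)
  sums z rec zero y = trans (sym (ℤ.+-inverseʳ (z 0 y))) (sym (ℤ.+-identityˡ _)) , trans (sym (ℤ.+-inverseˡ (z 1 y))) (sym (ℤ.+-identityˡ _))
  sums z rec (suc k) y = extend (isOdd k) (sums (z ∘ suc) (rec ∘ suc) k y)
    where
    O E : ℤ → ℤ
    O = oddSum (z ∘ suc) k
    E = evenSum (z ∘ suc) k

    expand : neighbours (oddSum z (suc k)) y ≡ z 2 y +ℤ z 0 y +ℤ neighbours E y
    expand = trans (regroup (z 1 (y +ℤ 1ℤ)) (E (y +ℤ 1ℤ)) (z 1 (y -ℤ 1ℤ)) (E (y -ℤ 1ℤ)) (z 0 y)) (cong (λ c → c +ℤ z 0 y +ℤ neighbours E y) (sym (rec 0 y)))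
      where
      regroup : ∀ a b c d e → a +ℤ b +ℤ (c +ℤ d) ≡ a +ℤ c -ℤ e +ℤ e +ℤ (b +ℤ d)
      regroup = solve-∀

    extend : ∀ p →
      neighbours O y ≡ E y +ℤ E y +ℤ boundary₁ p (z 1 y) (z 2 y) (z (suc k) y) (z (suc (suc k)) y)
      × neighbours E y ≡ O y +ℤ O y +ℤ boundary₂ p (z 1 y) (z 2 y) (z (suc k) y) (z (suc (suc k)) y) →
      neighbours (oddSum z (suc k)) y
        ≡ O y +ℤ O y +ℤ boundary₁ (not p) (z 0 y) (z 1 y) (z (suc k) y) (z (suc (suc k)) y)
      × neighbours O y
        ≡ oddSum z (suc k) y +ℤ oddSum z (suc k) y
          +ℤ boundary₂ (not p) (z 0 y) (z 1 y) (z (suc k) y) (z (suc (suc k)) y)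
    extend true (eO , eE) =
      trans expand (trans (cong (z 2 y +ℤ z 0 y +ℤ_) eE) (tidy₁ (z 2 y) (z 0 y) (O y) (z (suc k) y)))
      , trans eO (tidy₂ (z 1 y) (E y) (z (suc (suc k)) y))
      where
      tidy₁ : ∀ a b c d → a +ℤ b +ℤ (c +ℤ c +ℤ (-ℤ a -ℤ d)) ≡ c +ℤ c +ℤ (b -ℤ d)
      tidy₁ = solve-∀
      tidy₂ : ∀ a b c → b +ℤ b +ℤ (a +ℤ c) ≡ a +ℤ b +ℤ (a +ℤ b) +ℤ (-ℤ a +ℤ c)
      tidy₂ = solve-∀
    extend false (eO , eE) =
      trans expand (trans (cong (z 2 y +ℤ z 0 y +ℤ_) eE) (tidy₁ (z 2 y) (z 0 y) (O y) (z (suc (suc k)) y)))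
      , trans eO (tidy₂ (z 1 y) (E y) (z (suc k) y))
      where
      tidy₁ : ∀ a b c d → a +ℤ b +ℤ (c +ℤ c +ℤ (-ℤ a +ℤ d)) ≡ c +ℤ c +ℤ (b +ℤ d)
      tidy₁ = solve-∀
      tidy₂ : ∀ a b c → b +ℤ b +ℤ (a -ℤ c) ≡ a +ℤ b +ℤ (a +ℤ b) +ℤ (-ℤ a -ℤ c)
      tidy₂ = solve-∀

  -- The values fired when two vertices carrying a and b are fired in turn, the first one being z 1.
  record IsFiring (a b : ℤ → ℤ) (z : ℕ → ℤ → ℤ) : Set where
    field
      start₀ : ∀ y → z 0 y ≡ -ℤ b y
      start₁ : ∀ y → z 1 y ≡ a y
      rec    : Recurrence z

  module _ {a b z} (isF : IsFiring a b z) where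
    open IsFiring isF

    closed : (P : (ℤ → ℤ) → Set) → (∀ {f g} → (∀ y → f y ≡ g y) → P f → P g) →
      (∀ {f g} → P f → P g → P (λ y → f y +ℤ g y)) → (∀ {f} → P f → P (λ y → -ℤ f y)) →
      (∀ {f} → P f → P (neighbours f)) → P a → P b → ∀ j → P (z j)
    closed P resp P+ P- PN pa pb j = proj₁ (go j)
      where
      go : ∀ j → P (z j) × P (z (suc j))
      go zero = resp (sym ∘ start₀) (P- pb) , resp (sym ∘ start₁) pa
      go (suc j) with go j
      ... | p , q = q , resp (sym ∘ rec j) (P+ (PN q) (P- p))

    -- Applying f ↦ f (y + 1) − f (y − 1) gives the terms a closed form.
    difference : ∀ j y → z j (y +ℤ 1ℤ) -ℤ z j (y -ℤ 1ℤ) ≡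
      a (y +ℤ + j) -ℤ a (y -ℤ + j) +ℤ (b (y +ℤ + j -ℤ 1ℤ) -ℤ b (y -ℤ + j +ℤ 1ℤ))
    difference j = proj₁ (go j)
      where
      open ≡-Reasoning
      δ : ℤ → ℤ → ℤ
      δ I y = a (y +ℤ I) -ℤ a (y -ℤ I) +ℤ (b (y +ℤ I -ℤ 1ℤ) -ℤ b (y -ℤ I +ℤ 1ℤ))
      δ-cong : ∀ {p q r s p′ q′ r′ s′} → p ≡ p′ → q ≡ q′ → r ≡ r′ → s ≡ s′ →
        a p -ℤ a q +ℤ (b r -ℤ b s) ≡ a p′ -ℤ a q′ +ℤ (b r′ -ℤ b s′)
      δ-cong refl refl refl refl = refl
      δ-rec : ∀ I y → δ (1ℤ +ℤ I) (y +ℤ 1ℤ) +ℤ δ (1ℤ +ℤ I) (y -ℤ 1ℤ) -ℤ δ I y ≡ δ (1ℤ +ℤ (1ℤ +ℤ I)) y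
      δ-rec I y = trans (cong₂ (λ u v → u +ℤ v -ℤ δ I y)
          (δ-cong (e₁ y I) (e₂ y I) (e₃ y I) (e₄ y I))
          (δ-cong (e₅ y I) (e₆ y I) (e₇ y I) (e₈ y I)))
        (cancel (a (y +ℤ (1ℤ +ℤ (1ℤ +ℤ I)))) (a (y -ℤ I)) (b (y +ℤ (1ℤ +ℤ (1ℤ +ℤ I)) -ℤ 1ℤ)) (b (y -ℤ I +ℤ 1ℤ))
          (a (y +ℤ I)) (a (y -ℤ (1ℤ +ℤ (1ℤ +ℤ I)))) (b (y +ℤ I -ℤ 1ℤ)) (b (y -ℤ (1ℤ +ℤ (1ℤ +ℤ I)) +ℤ 1ℤ)))
        where
        e₁ : ∀ y I → y +ℤ 1ℤ +ℤ (1ℤ +ℤ I) ≡ y +ℤ (1ℤ +ℤ (1ℤ +ℤ I))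
        e₁ = solve-∀
        e₂ : ∀ y I → y +ℤ 1ℤ -ℤ (1ℤ +ℤ I) ≡ y -ℤ I
        e₂ = solve-∀
        e₃ : ∀ y I → y +ℤ 1ℤ +ℤ (1ℤ +ℤ I) -ℤ 1ℤ ≡ y +ℤ (1ℤ +ℤ (1ℤ +ℤ I)) -ℤ 1ℤ
        e₃ = solve-∀
        e₄ : ∀ y I → y +ℤ 1ℤ -ℤ (1ℤ +ℤ I) +ℤ 1ℤ ≡ y -ℤ I +ℤ 1ℤ
        e₄ = solve-∀
        e₅ : ∀ y I → y -ℤ 1ℤ +ℤ (1ℤ +ℤ I) ≡ y +ℤ I
        e₅ = solve-∀
        e₆ : ∀ y I → y -ℤ 1ℤ -ℤ (1ℤ +ℤ I) ≡ y -ℤ (1ℤ +ℤ (1ℤ +ℤ I))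
        e₆ = solve-∀
        e₇ : ∀ y I → y -ℤ 1ℤ +ℤ (1ℤ +ℤ I) -ℤ 1ℤ ≡ y +ℤ I -ℤ 1ℤ
        e₇ = solve-∀
        e₈ : ∀ y I → y -ℤ 1ℤ -ℤ (1ℤ +ℤ I) +ℤ 1ℤ ≡ y -ℤ (1ℤ +ℤ (1ℤ +ℤ I)) +ℤ 1ℤ
        e₈ = solve-∀
        cancel : ∀ p q r s t u v w →
          (p -ℤ q +ℤ (r -ℤ s)) +ℤ (t -ℤ u +ℤ (v -ℤ w)) -ℤ (t -ℤ q +ℤ (v -ℤ s)) ≡ p -ℤ u +ℤ (r -ℤ w)
        cancel = solve-∀
      go : ∀ j → (∀ y → z j (y +ℤ 1ℤ) -ℤ z j (y -ℤ 1ℤ) ≡ δ (+ j) y) ×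
                 (∀ y → z (suc j) (y +ℤ 1ℤ) -ℤ z (suc j) (y -ℤ 1ℤ) ≡ δ (+ suc j) y)
      go zero = (λ y → begin
          z 0 (y +ℤ 1ℤ) -ℤ z 0 (y -ℤ 1ℤ)      ≡⟨ cong₂ _-ℤ_ (start₀ _) (start₀ _) ⟩
          -ℤ b (y +ℤ 1ℤ) -ℤ -ℤ b (y -ℤ 1ℤ)    ≡⟨ zero-form (a y) (b (y +ℤ 1ℤ)) (b (y -ℤ 1ℤ)) ⟩
          a y -ℤ a y +ℤ (b (y -ℤ 1ℤ) -ℤ b (y +ℤ 1ℤ))  ≡⟨ δ-cong (f₁ y) (f₁ y) (f₂ y) (f₃ y) ⟩
          δ 0ℤ y ∎)
        , (λ y → begin
          z 1 (y +ℤ 1ℤ) -ℤ z 1 (y -ℤ 1ℤ)      ≡⟨ cong₂ _-ℤ_ (start₁ _) (start₁ _) ⟩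
          a (y +ℤ 1ℤ) -ℤ a (y -ℤ 1ℤ)          ≡⟨ one-form (a (y +ℤ 1ℤ) -ℤ a (y -ℤ 1ℤ)) (b y) ⟩
          a (y +ℤ 1ℤ) -ℤ a (y -ℤ 1ℤ) +ℤ (b y -ℤ b y)  ≡⟨ δ-cong refl refl (f₄ y) (f₅ y) ⟩
          δ 1ℤ y ∎)
        where
        zero-form : ∀ c p q → -ℤ p -ℤ -ℤ q ≡ c -ℤ c +ℤ (q -ℤ p)
        zero-form = solve-∀
        one-form : ∀ p c → p ≡ p +ℤ (c -ℤ c)
        one-form = solve-∀
        f₁ : ∀ y → y ≡ y +ℤ 0ℤ
        f₁ = solve-∀
        f₂ : ∀ y → y -ℤ 1ℤ ≡ y +ℤ 0ℤ -ℤ 1ℤ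
        f₂ = solve-∀
        f₃ : ∀ y → y +ℤ 1ℤ ≡ y -ℤ 0ℤ +ℤ 1ℤ
        f₃ = solve-∀
        f₄ : ∀ y → y ≡ y +ℤ 1ℤ -ℤ 1ℤ
        f₄ = solve-∀
        f₅ : ∀ y → y ≡ y -ℤ 1ℤ +ℤ 1ℤ
        f₅ = solve-∀
      go (suc j) with go j
      ... | p , q = q , λ y → begin
          z (suc (suc j)) (y +ℤ 1ℤ) -ℤ z (suc (suc j)) (y -ℤ 1ℤ)
            ≡⟨ cong₂ _-ℤ_ (rec j (y +ℤ 1ℤ)) (rec j (y -ℤ 1ℤ)) ⟩
          (z (suc j) (y +ℤ 1ℤ +ℤ 1ℤ) +ℤ z (suc j) (y +ℤ 1ℤ -ℤ 1ℤ) -ℤ z j (y +ℤ 1ℤ))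
            -ℤ (z (suc j) (y -ℤ 1ℤ +ℤ 1ℤ) +ℤ z (suc j) (y -ℤ 1ℤ -ℤ 1ℤ) -ℤ z j (y -ℤ 1ℤ))
            ≡⟨ regroup (z (suc j) (y +ℤ 1ℤ +ℤ 1ℤ)) (z (suc j) (y +ℤ 1ℤ -ℤ 1ℤ)) (z j (y +ℤ 1ℤ))
                 (z (suc j) (y -ℤ 1ℤ +ℤ 1ℤ)) (z (suc j) (y -ℤ 1ℤ -ℤ 1ℤ)) (z j (y -ℤ 1ℤ)) ⟩
          -- The last summand compares values at y + 1 - 1 and y - 1 + 1, so it vanishes; it is
          -- added to make the other terms differences.
          (z (suc j) (y +ℤ 1ℤ +ℤ 1ℤ) -ℤ z (suc j) (y +ℤ 1ℤ -ℤ 1ℤ))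
            +ℤ (z (suc j) (y -ℤ 1ℤ +ℤ 1ℤ) -ℤ z (suc j) (y -ℤ 1ℤ -ℤ 1ℤ))
            -ℤ (z j (y +ℤ 1ℤ) -ℤ z j (y -ℤ 1ℤ))
            +ℤ (z (suc j) (y +ℤ 1ℤ -ℤ 1ℤ) -ℤ z (suc j) (y -ℤ 1ℤ +ℤ 1ℤ) +ℤ (z (suc j) (y +ℤ 1ℤ -ℤ 1ℤ) -ℤ z (suc j) (y -ℤ 1ℤ +ℤ 1ℤ)))
            ≡⟨ cong₂ _+ℤ_ (cong₂ _-ℤ_ (cong₂ _+ℤ_ (q (y +ℤ 1ℤ)) (q (y -ℤ 1ℤ))) (p y)) (vanish (same y)) ⟩
          δ (1ℤ +ℤ + j) (y +ℤ 1ℤ) +ℤ δ (1ℤ +ℤ + j) (y -ℤ 1ℤ) -ℤ δ (+ j) y +ℤ 0ℤ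
            ≡⟨ trans (ℤ.+-identityʳ _) (δ-rec (+ j) y) ⟩
          δ (+ suc (suc j)) y ∎
        where
        regroup : ∀ p q r s t u → (p +ℤ q -ℤ r) -ℤ (s +ℤ t -ℤ u) ≡ (p -ℤ q) +ℤ (s -ℤ t) -ℤ (r -ℤ u) +ℤ (q -ℤ s +ℤ (q -ℤ s))
        regroup = solve-∀
        same : ∀ y → z (suc j) (y +ℤ 1ℤ -ℤ 1ℤ) ≡ z (suc j) (y -ℤ 1ℤ +ℤ 1ℤ)
        same y = cong (z (suc j)) (step-back y)
          where
          step-back : ∀ y → y +ℤ 1ℤ -ℤ 1ℤ ≡ y -ℤ 1ℤ +ℤ 1ℤ
          step-back = solve-∀
        vanish : ∀ {u v} → u ≡ v → u -ℤ v +ℤ (u -ℤ v) ≡ 0ℤ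
        vanish {u} refl = zero-sum u
          where
          zero-sum : ∀ u → u -ℤ u +ℤ (u -ℤ u) ≡ 0ℤ
          zero-sum = solve-∀

  anti-shift-back : ∀ {m f} → Antiperiodic m f → ∀ y → f (y -ℤ + m) ≡ -ℤ f y
  anti-shift-back {m} {f} p y = begin
    f (y -ℤ + m)             ≡⟨ ℤ.neg-involutive (f (y -ℤ + m)) ⟨
    -ℤ -ℤ f (y -ℤ + m)       ≡⟨ cong -ℤ_ (p (y -ℤ + m)) ⟨
    -ℤ f (y -ℤ + m +ℤ + m)   ≡⟨ cong (λ c → -ℤ f c) (back y (+ m)) ⟩
    -ℤ f y                   ∎
    where
    open ≡-Reasoning
    back : ∀ a b → a -ℤ b +ℤ b ≡ a
    back = solve-∀

  module _ {a b z} {m} (isF : IsFiring a b z)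
    (oa : Odd a) (ob : Odd b) (aa : Antiperiodic m a) (ab : Antiperiodic m b) where

    private
      odd-z : ∀ j → Odd (z j)
      odd-z = closed isF Odd (λ {f} {g} e o y → trans (sym (e (-ℤ y))) (trans (o y) (cong -ℤ_ (e y))))
        (λ {f} {g} → odd-+ {f} {g}) (λ {f} → odd-neg {f}) (λ {f} → odd-neighbours {f}) oa ob

      anti-z : ∀ j → Antiperiodic m (z j)
      anti-z = closed isF (Antiperiodic m) (λ {f} {g} e o y → trans (sym (e (y +ℤ + m))) (trans (o y) (cong -ℤ_ (e y))))
        (λ {f} {g} → anti-+ {m} {f} {g}) (λ {f} → anti-neg {m} {f}) (λ {f} → anti-neighbours {m} {f}) aa ab

      difference-unique : ∀ {f g} → Odd f → Odd g →
        (∀ y → f (y +ℤ 1ℤ) -ℤ f (y -ℤ 1ℤ) ≡ g (y +ℤ 1ℤ) -ℤ g (y -ℤ 1ℤ)) → ∀ y → f y ≡ g y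
      difference-unique {f} {g} of og e y = ℤ.i-j≡0⇒i≡j (f y) (g y)
        (odd-difference-vanishing {λ y → f y -ℤ g y} (odd-+ {f} {λ y → -ℤ g y} of (odd-neg {g} og))
          (λ y → regroup (f (y +ℤ 1ℤ)) (f (y -ℤ 1ℤ)) (g (y +ℤ 1ℤ)) (g (y -ℤ 1ℤ)) (e y)) y)
        where
        regroup : ∀ p q r s → p -ℤ q ≡ r -ℤ s → p -ℤ r ≡ q -ℤ s
        regroup p q r s h = trans (lhs p q r) (trans (cong (λ c → c +ℤ (q -ℤ r)) h) (rhs q r s))
          where
          lhs : ∀ p q r → p -ℤ r ≡ p -ℤ q +ℤ (q -ℤ r)
          lhs = solve-∀
          rhs : ∀ q r s → r -ℤ s +ℤ (q -ℤ r) ≡ q -ℤ s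
          rhs = solve-∀

    open ≡-Reasoning

    -- Both sides are odd, so comparing their differences suffices. In the closed form
    -- antiperiodicity turns each shift by `m` into a sign, and the terms with `a` cancel.
    firing-end₀ : ∀ y → z m y ≡ b y
    firing-end₀ = difference-unique (odd-z m) ob λ y → begin
      z m (y +ℤ 1ℤ) -ℤ z m (y -ℤ 1ℤ)  ≡⟨ difference isF m y ⟩
      a (y +ℤ + m) -ℤ a (y -ℤ + m) +ℤ (b (y +ℤ + m -ℤ 1ℤ) -ℤ b (y -ℤ + m +ℤ 1ℤ))
        ≡⟨ cong₂ (λ c d → a (y +ℤ + m) -ℤ a (y -ℤ + m) +ℤ (b c -ℤ b d)) (comm y (+ m) (-ℤ 1ℤ)) (comm y (-ℤ + m) 1ℤ) ⟩
      a (y +ℤ + m) -ℤ a (y -ℤ + m) +ℤ (b (y -ℤ 1ℤ +ℤ + m) -ℤ b (y +ℤ 1ℤ -ℤ + m))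
        ≡⟨ cong₂ _+ℤ_ (cong₂ _-ℤ_ (aa y) (anti-shift-back {m} {a} aa y))
                      (cong₂ _-ℤ_ (ab (y -ℤ 1ℤ)) (anti-shift-back {m} {b} ab (y +ℤ 1ℤ))) ⟩
      -ℤ a y -ℤ -ℤ a y +ℤ (-ℤ b (y -ℤ 1ℤ) -ℤ -ℤ b (y +ℤ 1ℤ))  ≡⟨ tidy (a y) (b (y -ℤ 1ℤ)) (b (y +ℤ 1ℤ)) ⟩
      b (y +ℤ 1ℤ) -ℤ b (y -ℤ 1ℤ) ∎
      where
      comm : ∀ p q r → p +ℤ q +ℤ r ≡ p +ℤ r +ℤ q
      comm = solve-∀
      tidy : ∀ p q r → -ℤ p -ℤ -ℤ p +ℤ (-ℤ q -ℤ -ℤ r) ≡ r -ℤ q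
      tidy = solve-∀

    firing-end₁ : ∀ y → z (suc m) y ≡ -ℤ a y
    firing-end₁ = difference-unique {g = λ y → -ℤ a y} (odd-z (suc m)) (odd-neg {a} oa) λ y → begin
      z (suc m) (y +ℤ 1ℤ) -ℤ z (suc m) (y -ℤ 1ℤ)  ≡⟨ difference isF (suc m) y ⟩
      a (y +ℤ + suc m) -ℤ a (y -ℤ + suc m) +ℤ (b (y +ℤ + suc m -ℤ 1ℤ) -ℤ b (y -ℤ + suc m +ℤ 1ℤ))
        ≡⟨ cong₂ (λ c d → a c -ℤ a d +ℤ (b (y +ℤ + suc m -ℤ 1ℤ) -ℤ b (y -ℤ + suc m +ℤ 1ℤ))) (e₁ y (+ m)) (e₂ y (+ m)) ⟩
      a (y +ℤ 1ℤ +ℤ + m) -ℤ a (y -ℤ 1ℤ -ℤ + m) +ℤ (b (y +ℤ + suc m -ℤ 1ℤ) -ℤ b (y -ℤ + suc m +ℤ 1ℤ))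
        ≡⟨ cong₂ (λ c d → a (y +ℤ 1ℤ +ℤ + m) -ℤ a (y -ℤ 1ℤ -ℤ + m) +ℤ (b c -ℤ b d)) (e₃ y (+ m)) (e₄ y (+ m)) ⟩
      a (y +ℤ 1ℤ +ℤ + m) -ℤ a (y -ℤ 1ℤ -ℤ + m) +ℤ (b (y +ℤ + m) -ℤ b (y -ℤ + m))
        ≡⟨ cong₂ _+ℤ_ (cong₂ _-ℤ_ (aa (y +ℤ 1ℤ)) (anti-shift-back {m} {a} aa (y -ℤ 1ℤ)))
                      (cong₂ _-ℤ_ (ab y) (anti-shift-back {m} {b} ab y)) ⟩
      -ℤ a (y +ℤ 1ℤ) -ℤ -ℤ a (y -ℤ 1ℤ) +ℤ (-ℤ b y -ℤ -ℤ b y)  ≡⟨ tidy (a (y +ℤ 1ℤ)) (a (y -ℤ 1ℤ)) (b y) ⟩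
      -ℤ a (y +ℤ 1ℤ) -ℤ -ℤ a (y -ℤ 1ℤ) ∎
      where
      e₁ : ∀ y k → y +ℤ (1ℤ +ℤ k) ≡ y +ℤ 1ℤ +ℤ k
      e₁ = solve-∀
      e₂ : ∀ y k → y -ℤ (1ℤ +ℤ k) ≡ y -ℤ 1ℤ -ℤ k
      e₂ = solve-∀
      e₃ : ∀ y k → y +ℤ (1ℤ +ℤ k) -ℤ 1ℤ ≡ y +ℤ k
      e₃ = solve-∀
      e₄ : ∀ y k → y -ℤ (1ℤ +ℤ k) +ℤ 1ℤ ≡ y -ℤ k
      e₄ = solve-∀
      tidy : ∀ p q r → -ℤ p -ℤ -ℤ q +ℤ (-ℤ r -ℤ -ℤ r) ≡ -ℤ p -ℤ -ℤ q
      tidy = solve-∀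

    firing-boundary₁ : ∀ c y → boundary₁ c (z 0 y) (z 1 y) (z m y) (z (suc m) y) ≡ boundary₁ c (-ℤ b y) (a y) (b y) (-ℤ a y)
    firing-boundary₁ c y rewrite IsFiring.start₀ isF y | IsFiring.start₁ isF y | firing-end₀ y | firing-end₁ y = refl

    firing-boundary₂ : ∀ c y → boundary₂ c (z 0 y) (z 1 y) (z m y) (z (suc m) y) ≡ boundary₂ c (-ℤ b y) (a y) (b y) (-ℤ a y)
    firing-boundary₂ c y rewrite IsFiring.start₀ isF y | IsFiring.start₁ isF y | firing-end₀ y | firing-end₁ y = refl

    odd-oddSum : ∀ k → Odd (oddSum z k)
    odd-oddSum = oddSum-closed Odd (λ _ → refl) (λ {f} {g} → odd-+ {f} {g}) z odd-z

    odd-evenSum : ∀ k → Odd (evenSum z k)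
    odd-evenSum = evenSum-closed Odd (λ _ → refl) (λ {f} {g} → odd-+ {f} {g}) z odd-z

    anti-oddSum : ∀ k → Antiperiodic m (oddSum z k)
    anti-oddSum = oddSum-closed (Antiperiodic m) (λ _ → refl) (λ {f} {g} → anti-+ {m} {f} {g}) z anti-z

    anti-evenSum : ∀ k → Antiperiodic m (evenSum z k)
    anti-evenSum = evenSum-closed (Antiperiodic m) (λ _ → refl) (λ {f} {g} → anti-+ {m} {f} {g}) z anti-z

  module _ {a b z z′} {m} (m≢0 : m ≢ 0) (F : IsFiring a b z) (F′ : IsFiring b a z′)
    (oa : Odd a) (ob : Odd b) (aa : Antiperiodic m a) (ab : Antiperiodic m b) where

    private
      X Y : ℤ → ℤ
      X y = oddSum z m y -ℤ evenSum z′ m y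
      Y y = evenSum z m y -ℤ oddSum z′ m y

      boundaries-agree : ∀ c p q → boundary₁ c (-ℤ q) p q (-ℤ p) ≡ boundary₂ c (-ℤ p) q p (-ℤ q)
      boundaries-agree true p q = refl
      boundaries-agree false p q = refl

      neighbours-- : ∀ f g y → neighbours (λ y → f y -ℤ g y) y ≡ neighbours f y -ℤ neighbours g y
      neighbours-- f g y = regroup (f (y +ℤ 1ℤ)) (g (y +ℤ 1ℤ)) (f (y -ℤ 1ℤ)) (g (y -ℤ 1ℤ))
        where
        regroup : ∀ p q r s → p -ℤ q +ℤ (r -ℤ s) ≡ p +ℤ r -ℤ (q +ℤ s)
        regroup = solve-∀

      tidy : ∀ e c o → e +ℤ e +ℤ c -ℤ (o +ℤ o +ℤ c) ≡ e -ℤ o +ℤ (e -ℤ o)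
      tidy = solve-∀

      eqX : ∀ y → neighbours X y ≡ Y y +ℤ Y y
      eqX y = trans (neighbours-- (oddSum z m) (evenSum z′ m) y)
        (trans (cong₂ _-ℤ_
            (trans (proj₁ (sums z (IsFiring.rec F) m y)) (cong (evenSum z m y +ℤ evenSum z m y +ℤ_)
              (trans (firing-boundary₁ F oa ob aa ab (isOdd m) y) (boundaries-agree (isOdd m) (a y) (b y)))))
            (trans (proj₂ (sums z′ (IsFiring.rec F′) m y)) (cong (oddSum z′ m y +ℤ oddSum z′ m y +ℤ_)
              (firing-boundary₂ F′ ob oa ab aa (isOdd m) y))))
          (tidy (evenSum z m y) _ (oddSum z′ m y)))

      eqY : ∀ y → neighbours Y y ≡ X y +ℤ X y
      eqY y = trans (neighbours-- (evenSum z m) (oddSum z′ m) y)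
        (trans (cong₂ _-ℤ_
            (trans (proj₂ (sums z (IsFiring.rec F) m y)) (cong (oddSum z m y +ℤ oddSum z m y +ℤ_)
              (trans (firing-boundary₂ F oa ob aa ab (isOdd m) y) (sym (boundaries-agree (isOdd m) (b y) (a y))))))
            (trans (proj₁ (sums z′ (IsFiring.rec F′) m y)) (cong (evenSum z′ m y +ℤ evenSum z′ m y +ℤ_)
              (firing-boundary₁ F′ ob oa ab aa (isOdd m) y))))
          (tidy (oddSum z m y) _ (evenSum z′ m y)))

      odd-- : ∀ {f g} → Odd f → Odd g → Odd (λ y → f y -ℤ g y)
      odd-- {f} {g} p q = odd-+ {f} {λ y → -ℤ g y} p (odd-neg {g} q)

      anti-- : ∀ {f g} → Antiperiodic m f → Antiperiodic m g → Antiperiodic m (λ y → f y -ℤ g y)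
      anti-- {f} {g} p q = anti-+ {m} {f} {λ y → -ℤ g y} p (anti-neg {m} {g} q)

      oX : Odd X
      oX = odd-- {oddSum z m} {evenSum z′ m} (odd-oddSum F oa ob aa ab m) (odd-evenSum F′ ob oa ab aa m)
      oY : Odd Y
      oY = odd-- {evenSum z m} {oddSum z′ m} (odd-evenSum F oa ob aa ab m) (odd-oddSum F′ ob oa ab aa m)
      aX : Antiperiodic m X
      aX = anti-- {oddSum z m} {evenSum z′ m} (anti-oddSum F oa ob aa ab m) (anti-evenSum F′ ob oa ab aa m)
      aY : Antiperiodic m Y
      aY = anti-- {evenSum z m} {oddSum z′ m} (anti-evenSum F oa ob aa ab m) (anti-oddSum F′ ob oa ab aa m)

    -- The boundary terms of `sums` are the same for both firing orders. So the differences `X` and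
    -- `Y` of the totals satisfy the homogeneous system of `coupled-vanishing`.
    oddSum≡evenSum : ∀ y → oddSum z m y ≡ evenSum z′ m y
    oddSum≡evenSum y = ℤ.i-j≡0⇒i≡j _ _ (coupled-vanishing {X} {Y} m m≢0 oX oY aX aY eqX eqY y)

    evenSum≡oddSum : ∀ y → evenSum z m y ≡ oddSum z′ m y
    evenSum≡oddSum y = ℤ.i-j≡0⇒i≡j _ _ (coupled-vanishing {Y} {X} m m≢0 oY oX aY aX eqY eqX y)

  module _ {a b z} (isF : IsFiring a b z) (oa : Odd a) (ob : Odd b) where

    -- At 0 the difference of an odd function is twice its value at 1, and the closed form leaves
    -- only a (j) - a (-j) on the other side.
    firing-at-one : (∀ y → b y ≡ 0ℤ) → ∀ j → z j 1ℤ ≡ a (+ j)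
    firing-at-one b≡0 j = ℤ.*-cancelˡ-≡ (+ 2) (z j 1ℤ) (a (+ j)) (begin
      + 2 *ℤ z j 1ℤ                ≡⟨ double (z j 1ℤ) ⟩
      z j 1ℤ -ℤ -ℤ z j 1ℤ          ≡⟨ cong (λ c → z j 1ℤ -ℤ c) (odd-z j 1ℤ) ⟨
      z j (0ℤ +ℤ 1ℤ) -ℤ z j (0ℤ -ℤ 1ℤ)  ≡⟨ difference isF j 0ℤ ⟩
      a (0ℤ +ℤ + j) -ℤ a (0ℤ -ℤ + j) +ℤ (b _ -ℤ b _)
        ≡⟨ cong₂ _+ℤ_ (cong₂ (λ c d → a c -ℤ a d) (ℤ.+-identityˡ (+ j)) (ℤ.+-identityˡ (-ℤ + j))) (cong₂ _-ℤ_ (b≡0 _) (b≡0 _)) ⟩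
      a (+ j) -ℤ a (-ℤ + j) +ℤ 0ℤ  ≡⟨ cong (λ c → a (+ j) -ℤ c +ℤ 0ℤ) (oa (+ j)) ⟩
      a (+ j) -ℤ -ℤ a (+ j) +ℤ 0ℤ  ≡⟨ trans (ℤ.+-identityʳ _) (sym (double (a (+ j)))) ⟩
      + 2 *ℤ a (+ j)               ∎)
      where
      open ≡-Reasoning
      double : ∀ p → + 2 *ℤ p ≡ p -ℤ -ℤ p
      double = solve-∀
      odd-z : ∀ j → Odd (z j)
      odd-z = closed isF Odd (λ {f} {g} e o y → trans (sym (e (-ℤ y))) (trans (o y) (cong -ℤ_ (e y))))
        (λ {f} {g} → odd-+ {f} {g}) (λ {f} → odd-neg {f}) (λ {f} → odd-neighbours {f}) oa ob

-- Odd antiperiodic functions that detect the order of a product.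

module Waves where
  open import Data.Integer using (ℤ; +_; -[1+_]; 0ℤ; 1ℤ; _⊖_) renaming (_+_ to _+ℤ_; _-_ to _-ℤ_; _*_ to _*ℤ_; -_ to -ℤ_)
  import Data.Integer.Properties as ℤ
  open import Data.Integer.Tactic.RingSolver using (solve-∀)
  open import Data.Nat.DivMod using (_/_; m<n⇒m/n≡0; n/n≡1; +-distrib-/-∣ʳ)
  open import Data.Nat.Divisibility using (∣-refl)
  open FiringSequence

  sign : ℕ → ℤ
  sign zero = 1ℤ
  sign (suc k) = -ℤ sign k

  -- (−1)^⌊y/m⌋, with the floor on negative arguments read off from ⌊−(k + 1)/m⌋ = −⌊k/m⌋ − 1.
  floorSign : ℕ → ℤ → ℤ
  floorSign zero y = 1ℤ
  floorSign m@(suc _) (+ k) = sign (k / m)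
  floorSign m@(suc _) -[1+ k ] = -ℤ sign (k / m)

  sign-shift : ∀ k m → sign ((k + suc m) / suc m) ≡ -ℤ sign (k / suc m)
  sign-shift k m = cong sign (begin
    (k + suc m) / suc m           ≡⟨ +-distrib-/-∣ʳ k ∣-refl ⟩
    k / suc m + suc m / suc m     ≡⟨ cong (λ c → k / suc m + c) (n/n≡1 (suc m)) ⟩
    k / suc m + 1                 ≡⟨ ℕ.+-comm (k / suc m) 1 ⟩
    suc (k / suc m)               ∎)
    where open ≡-Reasoning

  floorSign-antiperiodic : ∀ m → m ≢ 0 → Antiperiodic m (floorSign m)
  floorSign-antiperiodic zero m≢0 = contradiction refl m≢0
  floorSign-antiperiodic (suc m) _ (+ k) = sign-shift k m
  floorSign-antiperiodic (suc m) _ -[1+ k ] with suc m ≤? k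
  ... | yes m<k = begin
    floorSign (suc m) (suc m ⊖ suc k)              ≡⟨ cong (floorSign (suc m)) (ℤ.⊖-< (s≤s m<k)) ⟩
    floorSign (suc m) (-ℤ + (suc k ∸ suc m))       ≡⟨ cong (λ c → floorSign (suc m) (-ℤ + c)) (ℕ.+-∸-assoc 1 m<k) ⟩
    -ℤ sign ((k ∸ suc m) / suc m)                  ≡⟨ sign-shift (k ∸ suc m) m ⟨
    sign ((k ∸ suc m + suc m) / suc m)             ≡⟨ cong (λ c → sign (c / suc m)) (ℕ.m∸n+n≡m m<k) ⟩
    sign (k / suc m)                               ≡⟨ ℤ.neg-involutive _ ⟨
    -ℤ -ℤ sign (k / suc m)                         ∎
    where open ≡-Reasoning
  ... | no m≮k = begin
    floorSign (suc m) (suc m ⊖ suc k)              ≡⟨ cong (floorSign (suc m)) (ℤ.⊖-≥ k<m) ⟩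
    sign ((m ∸ k) / suc m)                         ≡⟨ cong sign (m<n⇒m/n≡0 (s≤s (ℕ.m∸n≤m m k))) ⟩
    1ℤ                                             ≡⟨ cong (λ c → -ℤ -ℤ sign c) (m<n⇒m/n≡0 k<m) ⟨
    -ℤ -ℤ sign (k / suc m)                         ∎
    where
    open ≡-Reasoning
    k<m : k < suc m
    k<m = ℕ.≰⇒> m≮k

  -- For m ≥ 2 twice the square wave of half-period m; the order ∞ (encoded as 0) needs no period.
  wave : ℕ → ℤ → ℤ
  wave zero y = y
  wave (suc zero) y = y
  wave m@(suc (suc _)) y = floorSign m y -ℤ floorSign m (-ℤ y)

  wave-odd : ∀ m → Odd (wave m)
  wave-odd zero y = refl
  wave-odd (suc zero) y = refl
  wave-odd m@(suc (suc _)) y = begin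
    floorSign m (-ℤ y) -ℤ floorSign m (-ℤ -ℤ y)  ≡⟨ cong (λ c → floorSign m (-ℤ y) -ℤ floorSign m c) (ℤ.neg-involutive y) ⟩
    floorSign m (-ℤ y) -ℤ floorSign m y          ≡⟨ swap (floorSign m (-ℤ y)) (floorSign m y) ⟩
    -ℤ (floorSign m y -ℤ floorSign m (-ℤ y))     ∎
    where
    open ≡-Reasoning
    swap : ∀ p q → p -ℤ q ≡ -ℤ (q -ℤ p)
    swap = solve-∀

  wave-antiperiodic : ∀ m → m ≢ 0 → m ≢ 1 → Antiperiodic m (wave m)
  wave-antiperiodic zero m≢0 _ = contradiction refl m≢0
  wave-antiperiodic (suc zero) _ m≢1 = contradiction refl m≢1
  wave-antiperiodic m@(suc (suc _)) m≢0 _ y = begin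
    floorSign m (y +ℤ + m) -ℤ floorSign m (-ℤ (y +ℤ + m))
      ≡⟨ cong₂ _-ℤ_ (anti y) (trans (cong (floorSign m) (ℤ.neg-distrib-+ y (+ m)))
                                      (anti-shift-back {m} {floorSign m} anti (-ℤ y))) ⟩
    -ℤ floorSign m y -ℤ -ℤ floorSign m (-ℤ y)  ≡⟨ ℤ.neg-distrib-+ (floorSign m y) (-ℤ floorSign m (-ℤ y)) ⟨
    -ℤ (floorSign m y -ℤ floorSign m (-ℤ y))   ∎
    where
    open ≡-Reasoning
    anti = floorSign-antiperiodic m m≢0

  wave-inside : ∀ m j → j < suc m → wave (suc (suc m)) (+ suc j) ≡ + 2
  wave-inside m j j<m = cong₂ (λ p q → sign p -ℤ -ℤ sign q)
    (m<n⇒m/n≡0 {suc j} {suc (suc m)} (s≤s j<m)) (m<n⇒m/n≡0 {j} {suc (suc m)} (ℕ.m<n⇒m<1+n j<m))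

  wave-one : ∀ m → wave m 1ℤ ≢ 0ℤ
  wave-one zero ()
  wave-one (suc zero) ()
  wave-one (suc (suc m)) e with trans (sym e) (wave-inside m 0 (s≤s z≤n))
  ... | ()

  -- Strictly between 0 and 2m the wave vanishes only at m, and right after m it has the value -wave
  -- m 1. For infinite order it is the identity function, which has no positive zero.
  wave-nondegenerate : ∀ m d → m ≢ 1 → (m ≡ 0 ⊎ suc d < m) →
    wave m (+ (suc d + suc d)) ≡ 0ℤ → wave m (+ suc (suc d + suc d)) ≢ wave m 1ℤ
  wave-nondegenerate zero d _ _ () _
  wave-nondegenerate (suc zero) d m≢1 _ _ _ = m≢1 refl
  wave-nondegenerate (suc (suc m)) d _ (inj₂ d<m) e e′ with ℕ.<-cmp (suc d + suc d) (suc (suc m))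
  ... | tri< 2d<m _ _ = case trans (sym e) (wave-inside m (d + suc d) (ℕ.≤-pred 2d<m)) of λ ()
  ... | tri≈ _ 2d≡m _ = case trans (sym e″) (trans e′ one) of λ ()
    where
    one : wave (suc (suc m)) 1ℤ ≡ + 2
    one = wave-inside m 0 (s≤s z≤n)
    e″ : wave (suc (suc m)) (+ suc (suc d + suc d)) ≡ -ℤ + 2
    e″ = trans (cong (λ c → wave (suc (suc m)) (+ suc c)) 2d≡m)
           (trans (wave-antiperiodic (suc (suc m)) (λ ()) (λ ()) 1ℤ) (cong -ℤ_ one))
  ... | tri> _ _ m<2d = case trans (sym (trans (cong (λ c → wave (suc (suc m)) (+ c)) (sym eq)) (trans (wave-antiperiodic (suc (suc m)) (λ ()) (λ ()) (+ suc r))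
                                (cong -ℤ_ (wave-inside m r r<m))))) e of λ ()
    where
    r : ℕ
    r = suc d + suc d ∸ suc (suc (suc m))
    eq : suc r + suc (suc m) ≡ suc d + suc d
    eq = trans (sym (ℕ.+-suc r (suc (suc m)))) (ℕ.m∸n+n≡m m<2d)
    r<m : r < suc m
    r<m = ℕ.≤-pred (ℕ.+-cancelʳ-< (suc (suc m)) (suc r) (suc (suc m)) (subst (_< suc (suc m) + suc (suc m)) (sym eq) (ℕ.+-mono-< d<m d<m)))

-- The numbers game as a representation, and the exact order of `s t`.

module NumbersGame {n : ℕ} (M : CoxeterMatrix n) where
  open import Data.Integer using (ℤ; +_; -[1+_]; 0ℤ; 1ℤ; _⊖_) renaming (_+_ to _+ℤ_; _-_ to _-ℤ_; _*_ to _*ℤ_; -_ to -ℤ_)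
  import Data.Integer.Properties as ℤ
  open import Data.Integer.Tactic.RingSolver using (solve-∀)
  open import Data.Vec using (Vec; []; _∷_; updateAt; lookup; replicate; _[_]≔_)
  import Data.Vec.Properties as Vec
  open CoxeterMatrix M
  open Coxeter M renaming (_≈_ to infix 4 _≈_)
  open FiringSequence
  open Waves

  -- The coordinate is that of the increasingly ordered pair, so that both ends of an edge shift the
  -- same coordinate.
  edge : Fin n → Fin n → Fin (n * n)
  edge s t with toℕ s ≤? toℕ t
  ... | yes _ = combine s t
  ... | no _ = combine t s

  edge-sym : ∀ s t → edge s t ≡ edge t s
  edge-sym s t with toℕ s ≤? toℕ t | toℕ t ≤? toℕ s
  ... | yes p | yes q rewrite Fin.toℕ-injective (ℕ.≤-antisym p q) = refl
  ... | yes p | no q = refl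
  ... | no p | yes q = refl
  ... | no p | no q = ⊥-elim (p (ℕ.<⇒≤ (ℕ.≰⇒> q)))

  period : Fin (n * n) → ℕ
  period e = m (proj₁ (remQuot {n} n e)) (proj₂ (remQuot {n} n e))

  period-edge : ∀ s t → period (edge s t) ≡ m s t
  period-edge s t with toℕ s ≤? toℕ t
  ... | yes _ = cong (λ q → m (proj₁ q) (proj₂ q)) (Fin.remQuot-combine s t)
  ... | no _ = trans (cong (λ q → m (proj₁ q) (proj₂ q)) (Fin.remQuot-combine t s)) (m-sym t s)

  Position : Set
  Position = Vec ℤ (n * n)

  -- The coefficient module: functions on Position that are odd in every coordinate e and antiperiodic in it
  -- with half-period the order attached to e.  On it, shifting coordinate e both ways acts as 2 cos (π / order).
  Value : Set
  Value = Position → ℤ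

  slice : Value → Position → Fin (n * n) → ℤ → ℤ
  slice f p e y = f (p [ e ]≔ y)

  shiftSum : Fin (n * n) → Value → Value
  shiftSum e f p = f (updateAt p e (_+ℤ 1ℤ)) +ℤ f (updateAt p e (λ y → y -ℤ 1ℤ))

  -- Antiperiodicity is asked for neither in half-period 0, which encodes infinite order, nor in
  -- half-period 1, which occurs only on the diagonal.
  record Admissible (f : Value) : Set where
    field
      odd  : ∀ e p → f (updateAt p e (-ℤ_)) ≡ -ℤ f p
      anti : ∀ e → period e ≢ 0 → period e ≢ 1 → ∀ p → f (updateAt p e (_+ℤ + period e)) ≡ -ℤ f p
  open Admissible

  admissible-neg : ∀ {f} → Admissible f → Admissible (λ p → -ℤ f p)
  admissible-neg A .odd e p = cong -ℤ_ (A .odd e p)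
  admissible-neg A .anti e h h′ p = cong -ℤ_ (A .anti e h h′ p)

  admissible-+ : ∀ {f g} → Admissible f → Admissible g → Admissible (λ p → f p +ℤ g p)
  admissible-+ {f} {g} A B .odd e p = trans (cong₂ _+ℤ_ (A .odd e p) (B .odd e p)) (sym (ℤ.neg-distrib-+ (f p) (g p)))
  admissible-+ {f} {g} A B .anti e h h′ p =
    trans (cong₂ _+ℤ_ (A .anti e h h′ p) (B .anti e h h′ p)) (sym (ℤ.neg-distrib-+ (f p) (g p)))

  -- The two shifts commute with updates of other coordinates and with translations of their own;
  -- negating their own coordinate exchanges the two summands.
  admissible-shiftSum : ∀ e {f} → Admissible f → Admissible (shiftSum e f)
  admissible-shiftSum e {f} A = record
    { odd = λ e′ → negates e′ (A .odd e′) (inj₁ refl)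
    ; anti = λ e′ h h′ → negates e′ (A .anti e′ h h′) (inj₂ (+ period e′ , refl)) }
    where
    open ≡-Reasoning
    negates : ∀ e′ {g : ℤ → ℤ} → (∀ p → f (updateAt p e′ g) ≡ -ℤ f p) →
      (g ≡ (-ℤ_) ⊎ ∃[ c ] (g ≡ (_+ℤ c))) → ∀ p → shiftSum e f (updateAt p e′ g) ≡ -ℤ shiftSum e f p
    negates e′ {g} inv form p with e Fin.≟ e′
    ... | no e≢e′ = trans (cong₂ _+ℤ_ (away (_+ℤ 1ℤ)) (away (λ y → y -ℤ 1ℤ)))
                     (sym (ℤ.neg-distrib-+ (f (updateAt p e (_+ℤ 1ℤ))) (f (updateAt p e (λ y → y -ℤ 1ℤ)))))
      where
      away : ∀ h → f (updateAt (updateAt p e′ g) e h) ≡ -ℤ f (updateAt p e h)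
      away h = trans (cong f (Vec.updateAt-commutes e e′ e≢e′ p)) (inv (updateAt p e h))
    ... | yes refl with form
    ... | inj₁ refl = trans (cong₂ _+ℤ_ (within (_+ℤ 1ℤ) (λ y → y -ℤ 1ℤ) flip₁) (within (λ y → y -ℤ 1ℤ) (_+ℤ 1ℤ) flip₂))
                        (swap (f (updateAt p e (λ y → y -ℤ 1ℤ))) (f (updateAt p e (_+ℤ 1ℤ))))
      where
      within : ∀ h h′ → (∀ y → h (-ℤ y) ≡ -ℤ h′ y) → f (updateAt (updateAt p e (-ℤ_)) e h) ≡ -ℤ f (updateAt p e h′)
      within h h′ comm = trans (cong f (trans (Vec.updateAt-updateAt-local e p (comm (lookup p e)))
                                       (sym (Vec.updateAt-updateAt e p)))) (inv (updateAt p e h′))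
      flip₁ : ∀ y → -ℤ y +ℤ 1ℤ ≡ -ℤ (y -ℤ 1ℤ)
      flip₁ = solve-∀
      flip₂ : ∀ y → -ℤ y -ℤ 1ℤ ≡ -ℤ (y +ℤ 1ℤ)
      flip₂ = solve-∀
      swap : ∀ a b → -ℤ a +ℤ -ℤ b ≡ -ℤ (b +ℤ a)
      swap = solve-∀
    ... | inj₂ (c , refl) = trans (cong₂ _+ℤ_ (within 1ℤ) (within (-ℤ 1ℤ))) (sym (ℤ.neg-distrib-+ (f (updateAt p e (_+ℤ 1ℤ))) (f (updateAt p e (λ y → y -ℤ 1ℤ)))))
      where
      within : ∀ k → f (updateAt (updateAt p e (_+ℤ c)) e (_+ℤ k)) ≡ -ℤ f (updateAt p e (_+ℤ k))
      within k = trans (cong f (trans (Vec.updateAt-updateAt-local e p (comm (lookup p e) c k))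
                                       (sym (Vec.updateAt-updateAt e p)))) (inv (updateAt p e (_+ℤ k)))
        where
        comm : ∀ a b c → a +ℤ b +ℤ c ≡ a +ℤ c +ℤ b
        comm = solve-∀

  slice-odd : ∀ {f} → Admissible f → ∀ p e → Odd (slice f p e)
  slice-odd {f} A p e y = trans (cong f (sym (Vec.updateAt-updateAt e p))) (A .odd e (p [ e ]≔ y))

  slice-anti : ∀ {f} → Admissible f → ∀ p e → period e ≢ 0 → period e ≢ 1 → Antiperiodic (period e) (slice f p e)
  slice-anti {f} A p e h h′ y = trans (cong f (sym (Vec.updateAt-updateAt e p))) (A .anti e h h′ (p [ e ]≔ y))

  slice-shiftSum : ∀ f p e y → slice (shiftSum e f) p e y ≡ neighbours (slice f p e) y
  slice-shiftSum f p e y = cong₂ (λ a b → f a +ℤ f b) (Vec.updateAt-updateAt e p) (Vec.updateAt-updateAt e p)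

  slice-lookup : ∀ f p e → slice f p e (lookup p e) ≡ f p
  slice-lookup f p e = cong f (Vec.[]≔-lookup p e)

  State : Set
  State = Fin n → Value

  infix 4 _≐_
  _≐_ : State → State → Set
  v ≐ w = ∀ r p → v r p ≡ w r p

  -- A move of Mozes' numbers game with `shiftSum` as edge weight. Vertices that commute need no
  -- separate case: for half-period 2 the two shifts of an admissible value cancel, as 2 cos (π / 2)
  -- is zero.
  fire : Fin n → State → State
  fire s v r with r Fin.≟ s
  ... | yes _ = λ p → -ℤ v s p
  ... | no _ = λ p → v r p +ℤ shiftSum (edge r s) (v s) p

  fire-self : ∀ s v p → fire s v s p ≡ -ℤ v s p
  fire-self s v p with s Fin.≟ s
  ... | yes _ = refl
  ... | no s≢s = contradiction refl s≢s

  fire-other : ∀ {r s} → r ≢ s → ∀ v p → fire s v r p ≡ v r p +ℤ shiftSum (edge r s) (v s) p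
  fire-other {r} {s} r≢s v p with r Fin.≟ s
  ... | yes r≡s = contradiction r≡s r≢s
  ... | no _ = refl

  shiftSum-cong : ∀ e {f g : Value} → (∀ p → f p ≡ g p) → ∀ p → shiftSum e f p ≡ shiftSum e g p
  shiftSum-cong e h p = cong₂ _+ℤ_ (h _) (h _)

  fire-cong : ∀ s {v w} → v ≐ w → fire s v ≐ fire s w
  fire-cong s h r p with r Fin.≟ s
  ... | yes _ = cong -ℤ_ (h s p)
  ... | no _ = cong₂ _+ℤ_ (h r p) (shiftSum-cong (edge r s) (h s) p)

  play : Word → State → State
  play [] v = v
  play (s ∷ x) v = play x (fire s v)

  play-++ : ∀ x y v → play (x ++ y) v ≡ play y (play x v)
  play-++ [] y v = refl
  play-++ (s ∷ x) y v = play-++ x y (fire s v)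

  play-cong : ∀ x {v w} → v ≐ w → play x v ≐ play x w
  play-cong [] h = h
  play-cong (s ∷ x) h = play-cong x (fire-cong s h)

  AdmissibleState : State → Set
  AdmissibleState v = ∀ r → Admissible (v r)

  fire-admissible : ∀ s {v} → AdmissibleState v → AdmissibleState (fire s v)
  fire-admissible s A r with r Fin.≟ s
  ... | yes _ = admissible-neg (A s)
  ... | no _ = admissible-+ (A r) (admissible-shiftSum (edge r s) (A s))

  play-admissible : ∀ x {v} → AdmissibleState v → AdmissibleState (play x v)
  play-admissible [] A = A
  play-admissible (s ∷ x) A = play-admissible x (fire-admissible s A)

  fire-involutive : ∀ s v → fire s (fire s v) ≐ v
  fire-involutive s v r p with r Fin.≟ s
  ... | yes refl = trans (cong -ℤ_ (fire-self s v p)) (ℤ.neg-involutive (v s p))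
  ... | no r≢s = trans (cong₂ _+ℤ_ (fire-other r≢s v p) (shiftSum-cong (edge r s) (fire-self s v) p))
                   (cancel (v r p) (v s (updateAt p (edge r s) (_+ℤ 1ℤ))) (v s (updateAt p (edge r s) (λ y → y -ℤ 1ℤ))))
    where
    cancel : ∀ a b c → a +ℤ (b +ℤ c) +ℤ (-ℤ b +ℤ -ℤ c) ≡ a
    cancel = solve-∀

  -- The term of index 0 is not fired. It is the value that makes the recurrence yield the second
  -- firing, g plus the shift sum of f.
  firingSequence : Fin (n * n) → Value → Value → ℕ → Value
  firingSequence e f g zero p = -ℤ g p
  firingSequence e f g (suc zero) p = f p
  firingSequence e f g (suc (suc j)) p =
    shiftSum e (firingSequence e f g (suc j)) p -ℤ firingSequence e f g j p

  -- After k firings the vertex fired last carries -z k and the other one z (k + 1); the Boolean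
  -- tells whether k is odd, in which case the first vertex was fired last.
  firstEnd secondEnd : Bool → ℤ → ℤ → ℤ
  firstEnd true zₖ zₖ₊₁ = -ℤ zₖ
  firstEnd false zₖ zₖ₊₁ = zₖ₊₁
  secondEnd c = firstEnd (not c)

  module _ (z : ℕ → Value) where

    record Fires (s t : Fin n) (v : State) : Set where
      field
        start₀ : ∀ p → z 0 p ≡ -ℤ v t p
        start₁ : ∀ p → z 1 p ≡ v s p
        rec    : ∀ j p → z (suc (suc j)) p ≡ shiftSum (edge s t) (z (suc j)) p -ℤ z j p

  fires-firingSequence : ∀ s t v → Fires (firingSequence (edge s t) (v s) (v t)) s t v
  fires-firingSequence s t v = record { start₀ = λ _ → refl ; start₁ = λ _ → refl ; rec = λ _ _ → refl }

  fires-next : ∀ {z s t v} → s ≢ t → Fires z s t v → Fires (z ∘ suc) t s (fire s v)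
  fires-next {z} {s} {t} {v} s≢t F = record
    { start₀ = λ p → trans (start₁ p) (sym (trans (cong -ℤ_ (fire-self s v p)) (ℤ.neg-involutive (v s p))))
    ; start₁ = λ p → begin
        z 2 p                                   ≡⟨ rec 0 p ⟩
        shiftSum (edge s t) (z 1) p -ℤ z 0 p    ≡⟨ cong₂ _-ℤ_ (shiftSum-cong (edge s t) start₁ p) (start₀ p) ⟩
        shiftSum (edge s t) (v s) p -ℤ -ℤ v t p ≡⟨ cong (λ e → shiftSum e (v s) p -ℤ -ℤ v t p) (edge-sym s t) ⟩
        shiftSum (edge t s) (v s) p -ℤ -ℤ v t p ≡⟨ tidy (shiftSum (edge t s) (v s) p) (v t p) ⟩
        v t p +ℤ shiftSum (edge t s) (v s) p    ≡⟨ fire-other (≢-sym s≢t) v p ⟨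
        fire s v t p                            ∎
    ; rec = λ j p → trans (rec (suc j) p) (cong (λ e → shiftSum e (z (suc (suc j))) p -ℤ z (suc j) p) (edge-sym s t)) }
    where
    open Fires F
    open ≡-Reasoning
    tidy : ∀ a b → a -ℤ -ℤ b ≡ b +ℤ a
    tidy = solve-∀

  play-alt : ∀ k {z s t v} → s ≢ t → Fires z s t v → ∀ p →
    play (alt s t k) v s p ≡ firstEnd (isOdd k) (z k p) (z (suc k) p)
    × play (alt s t k) v t p ≡ secondEnd (isOdd k) (z k p) (z (suc k) p)
  play-alt zero {z} {s} {t} {v} s≢t F p =
    sym (start₁ p) , sym (trans (cong -ℤ_ (start₀ p)) (ℤ.neg-involutive (v t p)))
    where open Fires F
  play-alt (suc k) {z} {s} {t} {v} s≢t F p with play-alt k (≢-sym s≢t) (fires-next s≢t F) p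
  ... | h , h′ = h′ , trans h (cong (λ c → firstEnd c (z (suc k) p) (z (suc (suc k)) p)) (sym (Bool.not-involutive (isOdd k))))

  play-alt-other : ∀ k {z s t v r} → s ≢ t → Fires z s t v → r ≢ s → r ≢ t → ∀ p →
    play (alt s t k) v r p ≡ v r p +ℤ (shiftSum (edge r s) (oddSum z k) p +ℤ shiftSum (edge r t) (evenSum z k) p)
  play-alt-other zero {v = v} {r} s≢t F r≢s r≢t p = sym (ℤ.+-identityʳ (v r p))
  play-alt-other (suc k) {z} {s} {t} {v} {r} s≢t F r≢s r≢t p = begin
    play (alt t s k) (fire s v) r p
      ≡⟨ play-alt-other k (≢-sym s≢t) (fires-next s≢t F) r≢t r≢s p ⟩
    fire s v r p +ℤ (O +ℤ E)
      ≡⟨ cong (_+ℤ (O +ℤ E)) (trans (fire-other r≢s v p)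
           (cong (v r p +ℤ_) (sym (shiftSum-cong (edge r s) start₁ p)))) ⟩
    v r p +ℤ (z 1 p₊ +ℤ z 1 p₋) +ℤ (O +ℤ (e p₊ +ℤ e p₋))
      ≡⟨ tidy (v r p) (z 1 p₊) (z 1 p₋) O (e p₊) (e p₋) ⟩
    v r p +ℤ ((z 1 p₊ +ℤ e p₊ +ℤ (z 1 p₋ +ℤ e p₋)) +ℤ O) ∎
    where
    open Fires F
    open ≡-Reasoning
    e : Value
    e = evenSum (z ∘ suc) k
    O E : ℤ
    O = shiftSum (edge r t) (oddSum (z ∘ suc) k) p
    E = shiftSum (edge r s) e p
    p₊ p₋ : Position
    p₊ = updateAt p (edge r s) (_+ℤ 1ℤ)
    p₋ = updateAt p (edge r s) (λ y → y -ℤ 1ℤ)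
    tidy : ∀ a b c d e f → a +ℤ (b +ℤ c) +ℤ (d +ℤ (e +ℤ f)) ≡ a +ℤ ((b +ℤ e +ℤ (c +ℤ f)) +ℤ d)
    tidy = solve-∀

  slice-sums : ∀ k z p e y →
    slice (oddSum z k) p e y ≡ oddSum (λ j → slice (z j) p e) k y
    × slice (evenSum z k) p e y ≡ evenSum (λ j → slice (z j) p e) k y
  slice-sums zero z p e y = refl , refl
  slice-sums (suc k) z p e y with slice-sums k (z ∘ suc) p e y
  ... | h , h′ = cong (z 1 (p [ e ]≔ y) +ℤ_) h′ , h

  slice-isFiring : ∀ {z s t v} → Fires z s t v → ∀ p →
    IsFiring (slice (v s) p (edge s t)) (slice (v t) p (edge s t)) (λ j → slice (z j) p (edge s t))
  slice-isFiring {z} {s} {t} F p = record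
    { start₀ = λ y → Fires.start₀ F _
    ; start₁ = λ y → Fires.start₁ F _
    ; rec = λ j y → trans (Fires.rec F j _)
        (cong (_-ℤ slice (z j) p (edge s t) y) (slice-shiftSum (z (suc j)) p (edge s t) y)) }

  module _ {s t} (s≢t : s ≢ t) (m≢0 : m s t ≢ 0) {v} (A : AdmissibleState v) where

    private
      e = edge s t
      k = m s t
      z = firingSequence e (v s) (v t)
      z′ = firingSequence e (v t) (v s)

      F : Fires z s t v
      F = fires-firingSequence s t v

      F′ : Fires z′ t s v
      F′ = subst (λ e′ → Fires (firingSequence e′ (v t) (v s)) t s v) (edge-sym t s) (fires-firingSequence t s v)

      module _ (p : Position) where

        o : ∀ r → Odd (slice (v r) p e)
        o r = slice-odd (A r) p e

        a : ∀ r → Antiperiodic k (slice (v r) p e)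
        a r = subst (λ c → Antiperiodic c (slice (v r) p e)) (period-edge s t)
          (slice-anti (A r) p e (λ h → m≢0 (trans (sym (period-edge s t)) h))
                                (λ h → m-off s t s≢t (trans (sym (period-edge s t)) h)))

        S : IsFiring (slice (v s) p e) (slice (v t) p e) (λ j → slice (z j) p e)
        S = slice-isFiring F p

        S′ : IsFiring (slice (v t) p e) (slice (v s) p e) (λ j → slice (z′ j) p e)
        S′ = subst (λ e′ → IsFiring (slice (v t) p e′) (slice (v s) p e′) (λ j → slice (z′ j) p e′))
               (edge-sym t s) (slice-isFiring F′ p)

        at : ∀ f → f p ≡ slice f p e (lookup p e)
        at f = sym (slice-lookup f p e)

        z-end₀ : z k p ≡ v t p
        z-end₀ = trans (at (z k)) (trans (firing-end₀ S (o s) (o t) (a s) (a t) (lookup p e)) (sym (at (v t))))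

        z-end₁ : z (suc k) p ≡ -ℤ v s p
        z-end₁ = trans (at (z (suc k))) (trans (firing-end₁ S (o s) (o t) (a s) (a t) (lookup p e)) (cong -ℤ_ (sym (at (v s)))))

        z′-end₀ : z′ k p ≡ v s p
        z′-end₀ = trans (at (z′ k)) (trans (firing-end₀ S′ (o t) (o s) (a t) (a s) (lookup p e)) (sym (at (v s))))

        z′-end₁ : z′ (suc k) p ≡ -ℤ v t p
        z′-end₁ = trans (at (z′ (suc k))) (trans (firing-end₁ S′ (o t) (o s) (a t) (a s) (lookup p e)) (cong -ℤ_ (sym (at (v t)))))

        sums₁ : oddSum z k p ≡ evenSum z′ k p
        sums₁ = trans (at (oddSum z k)) (trans (proj₁ (slice-sums k z p e (lookup p e)))
          (trans (oddSum≡evenSum m≢0 S S′ (o s) (o t) (a s) (a t) (lookup p e))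
          (trans (sym (proj₂ (slice-sums k z′ p e (lookup p e)))) (sym (at (evenSum z′ k))))))

        sums₂ : evenSum z k p ≡ oddSum z′ k p
        sums₂ = trans (at (evenSum z k)) (trans (proj₂ (slice-sums k z p e (lookup p e)))
          (trans (evenSum≡oddSum m≢0 S S′ (o s) (o t) (a s) (a t) (lookup p e))
          (trans (sym (proj₁ (slice-sums k z′ p e (lookup p e)))) (sym (at (oddSum z′ k))))))

      ends-agree : ∀ c a b → firstEnd c b (-ℤ a) ≡ secondEnd c a (-ℤ b)
      ends-agree true a b = refl
      ends-agree false a b = refl

      ends-agree′ : ∀ c a b → secondEnd c b (-ℤ a) ≡ firstEnd c a (-ℤ b)
      ends-agree′ true a b = refl
      ends-agree′ false a b = refl

    -- At `s` and `t` the ends of the two firing sequences are compared; any other vertex receives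
    -- equal totals from both orders.
    play-braid : play (alt s t k) v ≐ play (alt t s k) v
    play-braid r p with r Fin.≟ s | r Fin.≟ t
    ... | yes refl | _ = trans (proj₁ (play-alt k s≢t F p))
          (trans (cong₂ (firstEnd (isOdd k)) (z-end₀ p) (z-end₁ p))
          (trans (ends-agree (isOdd k) (v s p) (v t p))
          (trans (sym (cong₂ (secondEnd (isOdd k)) (z′-end₀ p) (z′-end₁ p)))
          (sym (proj₂ (play-alt k (≢-sym s≢t) F′ p))))))
    ... | no _ | yes refl = trans (proj₂ (play-alt k s≢t F p))
          (trans (cong₂ (secondEnd (isOdd k)) (z-end₀ p) (z-end₁ p))
          (trans (ends-agree′ (isOdd k) (v s p) (v t p))
          (trans (sym (cong₂ (firstEnd (isOdd k)) (z′-end₀ p) (z′-end₁ p)))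
          (sym (proj₁ (play-alt k (≢-sym s≢t) F′ p))))))
    ... | no r≢s | no r≢t = trans (play-alt-other k s≢t F r≢s r≢t p)
          (trans (cong (v r p +ℤ_) (trans (cong₂ _+ℤ_ (shiftSum-cong (edge r s) sums₁ p) (shiftSum-cong (edge r t) sums₂ p))
                                         (ℤ.+-comm _ (shiftSum (edge r t) (oddSum z′ k) p))))
          (sym (play-alt-other k (≢-sym s≢t) F′ r≢t r≢s p)))

  play-rel : ∀ {a b} → Rel₀ a b → ∀ {v} → AdmissibleState v → play a v ≐ play b v
  play-rel (involution s) {v} A = fire-involutive s v
  play-rel (braid s t m≢0) A with s Fin.≟ t
  ... | yes refl = λ _ _ → refl
  ... | no s≢t = play-braid s≢t m≢0 A

  play-step : ∀ {x y} → Step x y → ∀ {v} → AdmissibleState v → play x v ≐ play y v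
  play-step (step u w {a} {b} rel) {v} A r p = begin
    play (u ++ a ++ w) v r p           ≡⟨ cong (λ c → c r p) (split a) ⟩
    play w (play a (play u v)) r p     ≡⟨ play-cong w (play-rel rel (play-admissible u A)) r p ⟩
    play w (play b (play u v)) r p     ≡⟨ cong (λ c → c r p) (split b) ⟨
    play (u ++ b ++ w) v r p           ∎
    where
    open ≡-Reasoning
    split : ∀ c → play (u ++ c ++ w) v ≡ play w (play c (play u v))
    split c = trans (play-++ u (c ++ w) v) (play-++ c w (play u v))

  play-≈ : ∀ {x y} → x ≈ y → ∀ {v} → AdmissibleState v → play x v ≐ play y v
  play-≈ ε A r p = refl
  play-≈ (fwd h ◅ hs) A r p = trans (play-step h A r p) (play-≈ hs A r p)
  play-≈ (bwd h ◅ hs) A r p = trans (sym (play-step h A r p)) (play-≈ hs A r p)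

  -- Admissibility constrains all coordinates at once, hence a product. It is nonzero where all
  -- coordinates are 1, so along each coordinate line through that point it is a nonzero multiple of
  -- a single wave.
  waveProduct : ∀ {k} → (Fin k → ℕ) → Vec ℤ k → ℤ
  waveProduct per [] = 1ℤ
  waveProduct per (y ∷ p) = wave (per Fin.zero) y *ℤ waveProduct (per ∘ Fin.suc) p

  waveProduct-negates : ∀ {k} (per : Fin k → ℕ) e (g : ℤ → ℤ) → (∀ y → wave (per e) (g y) ≡ -ℤ wave (per e) y) →
    ∀ p → waveProduct per (updateAt p e g) ≡ -ℤ waveProduct per p
  waveProduct-negates per Fin.zero g h (y ∷ p) =
    trans (cong (_*ℤ waveProduct (per ∘ Fin.suc) p) (h y)) (sym (ℤ.neg-distribˡ-* (wave (per Fin.zero) y) _))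
  waveProduct-negates per (Fin.suc e) g h (y ∷ p) =
    trans (cong (wave (per Fin.zero) y *ℤ_) (waveProduct-negates (per ∘ Fin.suc) e g h p))
      (sym (ℤ.neg-distribʳ-* (wave (per Fin.zero) y) _))

  waveProduct-ones : ∀ {k} (per : Fin k → ℕ) → waveProduct per (replicate k 1ℤ) ≢ 0ℤ
  waveProduct-ones {zero} per ()
  waveProduct-ones {suc k} per h with ℤ.i*j≡0⇒i≡0∨j≡0 (wave (per Fin.zero) 1ℤ) h
  ... | inj₁ h′ = wave-one (per Fin.zero) h′
  ... | inj₂ h′ = waveProduct-ones (per ∘ Fin.suc) h′

  waveProduct-slice : ∀ {k} (per : Fin k → ℕ) e → ∃[ c ] (c ≢ 0ℤ ×
    ∀ y → waveProduct per (replicate k 1ℤ [ e ]≔ y) ≡ wave (per e) y *ℤ c)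
  waveProduct-slice per Fin.zero = _ , waveProduct-ones (per ∘ Fin.suc) , λ y → refl
  waveProduct-slice {suc k} per (Fin.suc e) with waveProduct-slice (per ∘ Fin.suc) e
  ... | c , c≢0 , h = wave (per Fin.zero) 1ℤ *ℤ c
    , (λ h′ → Sum.[ wave-one (per Fin.zero) , c≢0 ] (ℤ.i*j≡0⇒i≡0∨j≡0 (wave (per Fin.zero) 1ℤ) h′))
    , λ y → trans (cong (wave (per Fin.zero) 1ℤ *ℤ_) (h y)) (regroup (wave (per Fin.zero) 1ℤ) (wave (per (Fin.suc e)) y) c)
    where
    regroup : ∀ a b c → a *ℤ (b *ℤ c) ≡ b *ℤ (a *ℤ c)
    regroup = solve-∀

  admissible-waveProduct : Admissible (waveProduct period)
  admissible-waveProduct .odd e p = waveProduct-negates period e (-ℤ_) (wave-odd (period e)) p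
  admissible-waveProduct .anti e h h′ p = waveProduct-negates period e (_+ℤ + period e) (wave-antiperiodic (period e) h h′) p

  initial : Fin n → State
  initial s r with r Fin.≟ s
  ... | yes _ = waveProduct period
  ... | no _ = λ _ → 0ℤ

  initial-admissible : ∀ s → AdmissibleState (initial s)
  initial-admissible s r with r Fin.≟ s
  ... | yes _ = admissible-waveProduct
  ... | no _ = record { odd = λ _ _ → refl ; anti = λ _ _ _ _ → refl }

  initial-self : ∀ s p → initial s s p ≡ waveProduct period p
  initial-self s p with s Fin.≟ s
  ... | yes _ = refl
  ... | no s≢s = contradiction refl s≢s

  initial-other : ∀ {r s} → r ≢ s → ∀ p → initial s r p ≡ 0ℤ
  initial-other {r} {s} r≢s p with r Fin.≟ s
  ... | yes r≡s = contradiction r≡s r≢s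
  ... | no _ = refl

  isOdd-double : ∀ d → isOdd (d + d) ≡ false
  isOdd-double zero = refl
  isOdd-double (suc d) rewrite ℕ.+-suc d d = trans (Bool.not-involutive (isOdd (d + d))) (isOdd-double d)

  -- Put the wave product at `s` and zero elsewhere. After k = 2 (d + 1) firings the vertices `t`
  -- and `s` carry, up to sign and a common nonzero factor, the wave at k and at k + 1. If the word
  -- were trivial these would be 0 and the wave at 1, which `wave-nondegenerate` excludes.
  alt-even-nontrivial : ∀ {s t} → s ≢ t → ∀ d → (m s t ≡ 0 ⊎ suc d < m s t) → ¬ (alt s t (suc d + suc d) ≈ [])
  alt-even-nontrivial {s} {t} s≢t d bound h with waveProduct-slice period (edge s t)
  ... | c , c≢0 , W = wave-nondegenerate (m s t) d (m-off s t s≢t) bound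
      (cancel-c (trans (sym (at-one k)) (trans (sym (ℤ.neg-involutive (z k p))) (cong -ℤ_ second-end))) )
      (cancel-difference (trans (sym (at-one (suc k))) (trans first-end (W′ 1ℤ))))
    where
    k : ℕ
    k = suc d + suc d
    e = edge s t
    v : State
    v = initial s
    z : ℕ → Value
    z = firingSequence e (v s) (v t)
    p : Position
    p = replicate (n * n) 1ℤ [ e ]≔ 1ℤ
    A : AdmissibleState v
    A = initial-admissible s
    ends : play (alt s t k) v s p ≡ firstEnd (isOdd k) (z k p) (z (suc k) p)
         × play (alt s t k) v t p ≡ secondEnd (isOdd k) (z k p) (z (suc k) p)
    ends = play-alt k s≢t (fires-firingSequence s t v) p
    W′ : ∀ y → waveProduct period (replicate (n * n) 1ℤ [ e ]≔ y) ≡ wave (m s t) y *ℤ c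
    W′ y = trans (W y) (cong (λ q → wave q y *ℤ c) (period-edge s t))
    at-one : ∀ j → z j p ≡ wave (m s t) (+ j) *ℤ c
    at-one j = trans (firing-at-one (slice-isFiring (fires-firingSequence s t v) (replicate (n * n) 1ℤ))
                 (slice-odd (A s) _ e) (slice-odd (A t) _ e) (λ y → initial-other (≢-sym s≢t) _) j)
                 (trans (initial-self s _) (W′ (+ j)))
    first-end : z (suc k) p ≡ waveProduct period p
    first-end = trans (sym (trans (proj₁ ends) (cong (λ q → firstEnd q (z k p) (z (suc k) p)) (isOdd-double (suc d)))))
      (trans (play-≈ h A s p) (initial-self s p))
    second-end : -ℤ z k p ≡ 0ℤ
    second-end = trans (sym (trans (proj₂ ends) (cong (λ q → secondEnd q (z k p) (z (suc k) p)) (isOdd-double (suc d)))))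
      (trans (play-≈ h A t p) (initial-other (≢-sym s≢t) p))
    cancel-c : ∀ {x} → x *ℤ c ≡ 0ℤ → x ≡ 0ℤ
    cancel-c {x} h′ with ℤ.i*j≡0⇒i≡0∨j≡0 x h′
    ... | inj₁ x≡0 = x≡0
    ... | inj₂ c≡0 = contradiction c≡0 c≢0
    cancel-difference : ∀ {x y} → x *ℤ c ≡ y *ℤ c → x ≡ y
    cancel-difference {x} {y} h′ = ℤ.i-j≡0⇒i≡j x y (cancel-c (trans (distrib x y c) (ℤ.i≡j⇒i-j≡0 h′)))
      where
      distrib : ∀ a b c → (a -ℤ b) *ℤ c ≡ a *ℤ c -ℤ b *ℤ c
      distrib = solve-∀

-- Reflections of a word, the exchange condition, reduced alternating words.

-- The reflections w s w⁻¹ attached to the prefixes of a word, counted modulo 2, depend only on the element it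
-- represents.  Comparing elements is not yet known to be decidable at this point, hence the double negations.
module Reflections {n : ℕ} (M : CoxeterMatrix n) where
  open CoxeterMatrix M
  open Coxeter M renaming (_≈_ to infix 4 _≈_)
  open WordGroup M

  conj : Fin n → Word → Word
  conj s r = s ∷ r ++ s ∷ []

  conj-cong : ∀ s {r r′} → r ≈ r′ → conj s r ≈ conj s r′
  conj-cong s e = ∷-cong s (++-congʳ (s ∷ []) e)

  conj-involutive : ∀ s r → conj s (conj s r) ≈ r
  conj-involutive s r = begin
    s ∷ s ∷ (r ++ s ∷ []) ++ s ∷ []  ≈⟨ ss-cancel s _ ⟩
    (r ++ s ∷ []) ++ s ∷ []          ≡⟨ List.++-assoc r (s ∷ []) (s ∷ []) ⟩
    r ++ s ∷ s ∷ []                  ≈⟨ ++-congˡ r (ss≈[] s) ⟩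
    r ++ []                          ≡⟨ List.++-identityʳ r ⟩
    r                                ∎
    where open ≈-Reasoning

  conj-adjoint : ∀ s {r q} → conj s r ≈ q → r ≈ conj s q
  conj-adjoint s {r} e = ≈-trans (≈-sym (conj-involutive s r)) (conj-cong s e)

  conj-injective : ∀ s {r q} → conj s r ≈ conj s q → r ≈ q
  conj-injective s {q = q} e = ≈-trans (conj-adjoint s e) (conj-involutive s q)

  conjugate : Word → Word → Word
  conjugate [] r = r
  conjugate (s ∷ x) r = conj s (conjugate x r)

  conjugate-≈ : ∀ x r → conjugate x r ≈ x ++ r ++ reverse x
  conjugate-≈ [] r = ≡⇒≈ (sym (List.++-identityʳ r))
  conjugate-≈ (s ∷ x) r = begin
    s ∷ conjugate x r ++ s ∷ []             ≈⟨ conj-cong s (conjugate-≈ x r) ⟩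
    s ∷ (x ++ r ++ reverse x) ++ s ∷ []     ≡⟨ cong (s ∷_) (List.++-assoc x (r ++ reverse x) (s ∷ [])) ⟩
    s ∷ x ++ (r ++ reverse x) ++ s ∷ []     ≡⟨ cong (λ w → s ∷ x ++ w) (List.++-assoc r (reverse x) (s ∷ [])) ⟩
    s ∷ x ++ r ++ reverse x ++ s ∷ []       ≡⟨ cong (λ w → s ∷ x ++ r ++ w) (reverse-∷ s x) ⟨
    s ∷ x ++ r ++ reverse (s ∷ x)           ∎
    where open ≈-Reasoning

  conjugate-cong : ∀ {x y} → x ≈ y → ∀ r → conjugate x r ≈ conjugate y r
  conjugate-cong {x} {y} e r =
    ≈-trans (conjugate-≈ x r) (≈-trans (++-cong e (++-congˡ r (reverse-cong e))) (≈-sym (conjugate-≈ y r)))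

  reflections : Word → List Word
  reflections [] = []
  reflections (s ∷ x) = (s ∷ []) ∷ map (conj s) (reflections x)

  reflections-length : ∀ x → length (reflections x) ≡ length x
  reflections-length [] = refl
  reflections-length (s ∷ x) = cong suc (trans (List.length-map (conj s) (reflections x)) (reflections-length x))

  reflections-++ : ∀ x y → reflections (x ++ y) ≡ reflections x ++ map (conjugate x) (reflections y)
  reflections-++ [] y = sym (List.map-id (reflections y))
  reflections-++ (s ∷ x) y = cong ((s ∷ []) ∷_) (begin
    map (conj s) (reflections (x ++ y))
      ≡⟨ cong (map (conj s)) (reflections-++ x y) ⟩
    map (conj s) (reflections x ++ map (conjugate x) (reflections y))
      ≡⟨ List.map-++ (conj s) (reflections x) _ ⟩
    map (conj s) (reflections x) ++ map (conj s) (map (conjugate x) (reflections y))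
      ≡⟨ cong (map (conj s) (reflections x) ++_) (List.map-∘ (reflections y)) ⟨
    map (conj s) (reflections x) ++ map (conjugate (s ∷ x)) (reflections y) ∎)
    where open ≡-Reasoning

  data Parity (r : Word) : List Word → Bool → Set where
    none : Parity r [] false
    hit  : ∀ {a l b} → r ≈ a → Parity r l b → Parity r (a ∷ l) (not b)
    miss : ∀ {a l b} → ¬ r ≈ a → Parity r l b → Parity r (a ∷ l) b

  infix 4 _∼_
  _∼_ : List Word → List Word → Set
  l ∼ l′ = ∀ {r b} → Parity r l b → ¬ ¬ Parity r l′ b

  ∼-trans : ∀ {l l′ l″} → l ∼ l′ → l′ ∼ l″ → l ∼ l″
  ∼-trans p q h k = p h (λ h′ → q h′ k)

  ∼-refl : ∀ {l} → l ∼ l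
  ∼-refl h k = k h

  ∼-pointwise : ∀ {l l′} → Pointwise _≈_ l l′ → l ∼ l′
  ∼-pointwise e h k = k (go e h)
    where
    go : ∀ {l l′ r b} → Pointwise _≈_ l l′ → Parity r l b → Parity r l′ b
    go [] none = none
    go (e ∷ es) (hit p h) = hit (≈-trans p e) (go es h)
    go (e ∷ es) (miss p h) = miss (λ q → p (≈-trans q (≈-sym e))) (go es h)

  pointwise-map : ∀ {f g : Word → Word} → (∀ r → f r ≈ g r) → ∀ l → Pointwise _≈_ (map f l) (map g l)
  pointwise-map e [] = []
  pointwise-map e (r ∷ l) = e r ∷ pointwise-map e l

  parity-++⁺ : ∀ {r l l′ b b′} → Parity r l b → Parity r l′ b′ → Parity r (l ++ l′) (b xor b′)
  parity-++⁺ none h′ = h′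
  parity-++⁺ {b′ = b′} (hit {b = b} p h) h′ = subst (Parity _ _) (Bool.not-distribˡ-xor b b′) (hit p (parity-++⁺ h h′))
  parity-++⁺ (miss p h) h′ = miss p (parity-++⁺ h h′)

  parity-++⁻ : ∀ {r b} l {l′} → Parity r (l ++ l′) b →
    ∃[ c ] ∃[ c′ ] (Parity r l c × Parity r l′ c′ × c xor c′ ≡ b)
  parity-++⁻ [] h = false , _ , none , h , refl
  parity-++⁻ (a ∷ l) (hit p h) with parity-++⁻ l h
  ... | c , c′ , g , g′ , refl = not c , c′ , hit p g , g′ , sym (Bool.not-distribˡ-xor c c′)
  parity-++⁻ (a ∷ l) (miss p h) with parity-++⁻ l h
  ... | c , c′ , g , g′ , e = c , c′ , miss p g , g′ , e

  ∼-++ : ∀ {l₁ l₂ l₁′ l₂′} → l₁ ∼ l₁′ → l₂ ∼ l₂′ → l₁ ++ l₂ ∼ l₁′ ++ l₂′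
  ∼-++ {l₁} e₁ e₂ h k with parity-++⁻ l₁ h
  ... | c , c′ , g , g′ , refl = e₁ g (λ p → e₂ g′ (λ q → k (parity-++⁺ p q)))

  ∼-reverse : ∀ l → l ∼ reverse l
  ∼-reverse l h k = k (go l h)
    where
    go : ∀ {r b} l → Parity r l b → Parity r (reverse l) b
    go [] none = none
    go {r} (a ∷ l) (hit {b = b} p h) rewrite List.unfold-reverse a l =
      subst (Parity r _) (Bool.xor-comm b true) (parity-++⁺ (go l h) (hit p none))
    go {r} {b} (a ∷ l) (miss p h) rewrite List.unfold-reverse a l =
      subst (Parity r _) (Bool.xor-identityʳ b) (parity-++⁺ (go l h) (miss p none))

  ∼-map-conj : ∀ s {l l′} → l ∼ l′ → map (conj s) l ∼ map (conj s) l′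
  ∼-map-conj s {l} {l′} e h k = e (down l h) (k ∘ up l′)
    where
    down : ∀ {r b} l → Parity r (map (conj s) l) b → Parity (conj s r) l b
    down [] none = none
    down (a ∷ l) (hit p h) = hit (≈-sym (conj-adjoint s (≈-sym p))) (down l h)
    down (a ∷ l) (miss p h) = miss (p ∘ conj-adjoint s) (down l h)
    up : ∀ {r b} l → Parity (conj s r) l b → Parity r (map (conj s) l) b
    up [] none = none
    up (a ∷ l) (hit p h) = hit (conj-adjoint s p) (up l h)
    up (a ∷ l) (miss p h) = miss (λ q → p (≈-sym (conj-adjoint s (≈-sym q)))) (up l h)

  ∼-cancel : ∀ {a a′ l l′} → a ≈ a′ → l ∼ l′ → a ∷ a′ ∷ l ∼ l′
  ∼-cancel e i (hit p (hit {b = b} q h)) k = i h (λ h′ → k (subst (Parity _ _) (sym (Bool.not-involutive b)) h′))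
  ∼-cancel e i (hit p (miss q h)) k = q (≈-trans p e)
  ∼-cancel e i (miss p (hit q h)) k = p (≈-trans q (≈-sym e))
  ∼-cancel e i (miss p (miss q h)) k = i h k

  ∼-insert : ∀ {a a′ l l′} → a ≈ a′ → l ∼ l′ → l ∼ a ∷ a′ ∷ l′
  -- In `∼-cancel` the given parity proof says whether `r` equals `a`; here nothing does, so
  -- excluded middle is used under the double negation.
  ∼-insert {a} {a′} e i {r} {b} h k = i h λ h′ → ¬¬-excluded-middle λ
    { (yes p) → k (subst (Parity r _) (Bool.not-involutive b) (hit p (hit (≈-trans p e) h′)))
    ; (no ¬p) → k (miss ¬p (miss (λ q → ¬p (≈-trans q (≈-sym e))) h′)) }

  alt-snoc-even : ∀ s t i → alt s t (i + i) ++ s ∷ [] ≡ alt s t (suc (i + i))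
  alt-snoc-odd : ∀ s t i → alt s t (suc (i + i)) ++ t ∷ [] ≡ alt s t (suc (suc (i + i)))
  alt-snoc-even s t zero = refl
  alt-snoc-even s t (suc i) rewrite ℕ.+-suc i i = cong (s ∷_) (alt-snoc-odd t s i)
  alt-snoc-odd s t i = cong (s ∷_) (alt-snoc-even t s i)

  conj-alt : ∀ s t i → conj s (alt t s (suc (i + i))) ≡ alt s t (suc (suc i + suc i))
  conj-alt s t i rewrite ℕ.+-suc i i = cong (s ∷_) (alt-snoc-odd t s i)

  reflections-alt : ∀ s t k → reflections (alt s t k) ≡ applyUpTo (λ i → alt s t (suc (i + i))) k
  reflections-alt s t zero = refl
  reflections-alt s t (suc k) = cong ((s ∷ []) ∷_) (begin
    map (conj s) (reflections (alt t s k))                       ≡⟨ cong (map (conj s)) (reflections-alt t s k) ⟩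
    map (conj s) (applyUpTo (λ i → alt t s (suc (i + i))) k)     ≡⟨ List.map-applyUpTo _ (conj s) k ⟩
    applyUpTo (λ i → conj s (alt t s (suc (i + i)))) k           ≡⟨ applyUpTo-cong k (conj-alt s t) ⟩
    applyUpTo (λ i → alt s t (suc (suc i + suc i))) k            ∎)
    where
    open ≡-Reasoning
    applyUpTo-cong : ∀ k {f g : ℕ → Word} → (∀ i → f i ≡ g i) → applyUpTo f k ≡ applyUpTo g k
    applyUpTo-cong zero e = refl
    applyUpTo-cong (suc k) e = cong₂ _∷_ (e 0) (applyUpTo-cong k (e ∘ suc))

  pointwise-upTo-downFrom : ∀ k {f g : ℕ → Word} → (∀ i j → suc (i + j) ≡ k → f i ≈ g j) →
    Pointwise _≈_ (applyUpTo f k) (applyDownFrom g k)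
  pointwise-upTo-downFrom zero e = []
  pointwise-upTo-downFrom (suc k) e = e 0 k refl ∷ pointwise-upTo-downFrom k (λ i j h → e (suc i) j (cong suc h))

  -- Both lists consist of alternating words of odd length, and one list is equivalent, entry by
  -- entry, to the reversal of the other.
  reflections-braid : ∀ s t → m s t ≢ 0 → reflections (alt s t (m s t)) ∼ reflections (alt t s (m s t))
  reflections-braid s t m≢0 =
    subst₂ _∼_ (sym (reflections-alt s t (m s t))) (trans (List.reverse-applyDownFrom _ (m s t)) (sym (reflections-alt t s (m s t))))
      (∼-trans (∼-pointwise (pointwise-upTo-downFrom (m s t) complement)) (∼-reverse _))
    where
    complement : ∀ i j → suc (i + j) ≡ m s t → alt s t (suc (i + i)) ≈ alt t s (suc (j + j))
    complement i j e = alt-complement s t m≢0 (suc (i + i)) (suc (j + j)) (begin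
      suc (i + i) + suc (j + j)    ≡⟨ cong suc (ℕ.+-suc (i + i) (j + j)) ⟩
      suc (suc (i + i + (j + j)))  ≡⟨ cong (suc ∘ suc) (interchange i j) ⟩
      suc (suc (i + j + (i + j)))  ≡⟨ cong suc (ℕ.+-suc (i + j) (i + j)) ⟨
      suc (i + j) + suc (i + j)    ≡⟨ cong₂ _+_ e e ⟩
      m s t + m s t                ∎)
      where
      open ≡-Reasoning
      interchange : ∀ i j → i + i + (j + j) ≡ i + j + (i + j)
      interchange i j = begin
        i + i + (j + j)    ≡⟨ ℕ.+-assoc i i (j + j) ⟩
        i + (i + (j + j))  ≡⟨ cong (i +_) (ℕ.+-assoc i j j) ⟨
        i + (i + j + j)    ≡⟨ cong (i +_) (ℕ.+-comm (i + j) j) ⟩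
        i + (j + (i + j))  ≡⟨ ℕ.+-assoc i j (i + j) ⟨
        i + j + (i + j)    ∎

  reflections-prefix : ∀ u {x y} → reflections x ∼ reflections y → reflections (u ++ x) ∼ reflections (u ++ y)
  reflections-prefix [] e = e
  reflections-prefix (s ∷ u) e = ∼-++ {(s ∷ []) ∷ []} ∼-refl (∼-map-conj s (reflections-prefix u e))

  conj-self : ∀ s → s ∷ [] ≈ conj s (s ∷ [])
  conj-self s = ≈-sym (∷-cong s (ss≈[] s))

  map-conj-involutive : ∀ s l → Pointwise _≈_ (map (conj s) (map (conj s) l)) l
  map-conj-involutive s [] = []
  map-conj-involutive s (r ∷ l) = conj-involutive s r ∷ map-conj-involutive s l

  map-conj-involutive′ : ∀ s l → Pointwise _≈_ l (map (conj s) (map (conj s) l))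
  map-conj-involutive′ s [] = []
  map-conj-involutive′ s (r ∷ l) = ≈-sym (conj-involutive s r) ∷ map-conj-involutive′ s l

  reflections-alt-++ : ∀ s t v → m s t ≢ 0 →
    reflections (alt s t (m s t) ++ v) ∼ reflections (alt t s (m s t) ++ v)
  reflections-alt-++ s t v m≢0 =
    subst₂ _∼_ (sym (reflections-++ (alt s t (m s t)) v)) (sym (reflections-++ (alt t s (m s t)) v))
      (∼-++ (reflections-braid s t m≢0)
            (∼-pointwise (pointwise-map (conjugate-cong (alt-braid s t m≢0)) (reflections v))))

  reflections-step : ∀ {x y} → SymClosure Step x y → reflections x ∼ reflections y
  reflections-step (fwd (step u v (involution s))) =
    reflections-prefix u (∼-cancel (conj-self s) (∼-pointwise (map-conj-involutive s (reflections v))))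
  reflections-step (fwd (step u v (braid s t m≢0))) = reflections-prefix u (reflections-alt-++ s t v m≢0)
  reflections-step (bwd (step u v (involution s))) =
    reflections-prefix u (∼-insert (conj-self s) (∼-pointwise (map-conj-involutive′ s (reflections v))))
  reflections-step (bwd (step u v (braid s t m≢0))) = reflections-prefix u
    (subst (λ k → reflections (alt t s k ++ v) ∼ reflections (alt s t k ++ v)) (m-sym t s)
      (reflections-alt-++ t s v (m≢0 ∘ trans (m-sym s t))))

  reflections-≈ : ∀ {x y} → x ≈ y → reflections x ∼ reflections y
  reflections-≈ ε = ∼-refl
  reflections-≈ (e ◅ es) = ∼-trans (reflections-step e) (reflections-≈ es)

  Distinct : List Word → Set
  Distinct = AllPairs (λ a b → ¬ a ≈ b)

  parity-absent : ∀ {r l} → All (λ a → ¬ r ≈ a) l → Parity r l false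
  parity-absent [] = none
  parity-absent (p ∷ ps) = miss p (parity-absent ps)

  parity-distinct : ∀ {l} → Distinct l → All (λ r → Parity r l true) l
  parity-distinct [] = []
  parity-distinct (p ∷ ps) = hit ≈-refl (parity-absent p) ∷
    All.map (λ { (¬p , h) → miss (¬p ∘ ≈-sym) h }) (All.zip (p , parity-distinct ps))

  parity-present : ∀ {r l b} → b ≡ true → Parity r l b → Any (r ≈_) l
  parity-present () none
  parity-present e (hit p h) = here p
  parity-present e (miss p h) = there (parity-present e h)

  delete : ∀ {r} l → Any (r ≈_) l →
    ∃[ l′ ] (length l ≡ suc (length l′) × (∀ {q} → ¬ r ≈ q → Any (q ≈_) l → Any (q ≈_) l′))
  delete (a ∷ l) (here p) = l , refl , λ { ¬p (here q) → contradiction (≈-trans p (≈-sym q)) ¬p ; ¬p (there h) → h }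
  delete (a ∷ l) (there h) with delete l h
  ... | l′ , e , f = a ∷ l′ , cong suc e , λ { ¬p (here q) → here q ; ¬p (there h′) → there (f ¬p h′) }

  pigeonhole : ∀ {l} l′ → Distinct l → All (λ r → ¬ ¬ Any (r ≈_) l′) l → ¬ ¬ (length l ≤ length l′)
  pigeonhole l′ [] [] k = k z≤n
  pigeonhole l′ (p ∷ ps) (h ∷ hs) k = h λ h′ → case delete l′ h′ of λ
    { (l″ , e , f) → pigeonhole l″ ps (All.map (λ { (¬p , g) → ¬¬-map (f ¬p) g }) (All.zip (p , hs)))
        (λ le → k (subst (_ ≤_) (sym e) (s≤s le))) }

  -- Each of the distinct reflections is counted an odd number of times, so it occurs in the list of
  -- every equivalent word, which by the pigeonhole principle is at least as long.
  distinct⇒reduced : ∀ x → Distinct (reflections x) → Reduced x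
  distinct⇒reduced x d y e with length x ≤? length y
  ... | yes p = p
  ... | no ¬p = ⊥-elim (pigeonhole (reflections y) d
      (All.map (λ h k → reflections-≈ (≈-sym e) h (k ∘ parity-present refl)) (parity-distinct d))
      (¬p ∘ subst₂ _≤_ (reflections-length x) (reflections-length y)))

  data Deletion : Word → Word → Set where
    this : ∀ {a x} → Deletion (a ∷ x) x
    keep : ∀ {a x y} → Deletion x y → Deletion (a ∷ x) (a ∷ y)

  deletion-length : ∀ {x y} → Deletion x y → length x ≡ suc (length y)
  deletion-length this = refl
  deletion-length (keep d) = cong suc (deletion-length d)

  deletion-++ : ∀ x {z y} → Deletion (x ++ z) y →
    (∃[ x′ ] (Deletion x x′ × y ≡ x′ ++ z)) ⊎ (∃[ z′ ] (Deletion z z′ × y ≡ x ++ z′))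
  deletion-++ [] d = inj₂ (_ , d , refl)
  deletion-++ (a ∷ x) this = inj₁ (x , this , refl)
  deletion-++ (a ∷ x) (keep d) with deletion-++ x d
  ... | inj₁ (x′ , d′ , refl) = inj₁ (a ∷ x′ , keep d′ , refl)
  ... | inj₂ (z′ , d′ , refl) = inj₂ (z′ , d′ , refl)

  reflection-deletes : ∀ {r} x → Any (r ≈_) (reflections x) → ∃[ y ] (Deletion x y × r ++ x ≈ y)
  reflection-deletes (a ∷ x) (here p) = x , this , ≈-trans (++-congʳ (a ∷ x) p) (ss-cancel a x)
  reflection-deletes {r} (a ∷ x) (there h) with reflection-deletes {conj a r} x
    (Any.map (≈-sym ∘ conj-adjoint a ∘ ≈-sym) (AnyP.map⁻ h))
  ... | y , d , e = a ∷ y , keep d , ∷-transpose a (≈-trans (≡⇒≈ (cong (a ∷_) (sym (List.++-assoc r (a ∷ []) x)))) e)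

  reduced-suffix : ∀ p {x} → Reduced (p ++ x) → Reduced x
  reduced-suffix [] red = red
  reduced-suffix (a ∷ p) red = reduced-suffix p (λ y e → ℕ.≤-pred (red (a ∷ y) (∷-cong a e)))

  -- A repeated reflection would allow two letters to be deleted.
  reduced⇒distinct : ∀ x → Reduced x → Distinct (reflections x)
  reduced⇒distinct [] red = []
  reduced⇒distinct (a ∷ x) red =
    AllP.map⁺ (AllP.¬Any⇒All¬ _ fresh) ∷
    AllPairsP.map⁺ (AllPairs.map (_∘ conj-injective a) (reduced⇒distinct x (reduced-suffix (a ∷ []) red)))
    where
    fresh : ¬ Any (λ q → a ∷ [] ≈ conj a q) (reflections x)
    fresh h with reflection-deletes {a ∷ []} x (Any.map (λ e → ≈-trans (conj-self a) (≈-sym (conj-adjoint a (≈-sym e)))) h)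
    ... | y , d , e = ℕ.<-irrefl refl (ℕ.≤-trans (ℕ.n<1+n _)
      (ℕ.≤-trans (s≤s (ℕ.≤-reflexive (sym (deletion-length d)))) (ℕ.≤-trans (red y (≈-sym e)) (ℕ.n≤1+n _))))

  -- Were `s ∷ []` not equivalent to a reflection of `x`, all reflections of `s ∷ x` would be
  -- distinct and the word reduced. Multiplying by a reflection of `x` deletes one letter.
  exchange : ∀ s {x} → Reduced x → ¬ Reduced (s ∷ x) → ¬ ¬ (∃[ y ] (Deletion x y × s ∷ x ≈ y))
  exchange s {x} red ¬red k = ¬red (distinct⇒reduced (s ∷ x)
    (AllP.map⁺ (AllP.¬Any⇒All¬ _ fresh) ∷ AllPairsP.map⁺ (AllPairs.map (_∘ conj-injective s) (reduced⇒distinct x red))))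
    where
    fresh : ¬ Any (λ q → s ∷ [] ≈ conj s q) (reflections x)
    fresh h = k (reflection-deletes {s ∷ []} x (Any.map (λ e → ≈-trans (conj-self s) (≈-sym (conj-adjoint s (≈-sym e)))) h))

  alt-cancel : ∀ s t p q → alt s t p ≈ alt s t (p + q) → alt s t q ≈ [] ⊎ alt t s q ≈ []
  alt-cancel s t zero q e = inj₁ (≈-sym e)
  alt-cancel s t (suc p) q e = Sum.swap (alt-cancel t s p q (∷-cancel s e))

  -- The reflections are alternating words of odd length. If two of them were equal, cancelling
  -- would leave a trivial alternating word of even length below 2 m, against the exact order of
  -- `s t`.
  alt-reduced : ∀ {s t} → s ≢ t → ∀ k → (m s t ≡ 0 ⊎ k ≤ m s t) → Reduced (alt s t k)
  alt-reduced {s} {t} s≢t k bound = distinct⇒reduced (alt s t k)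
    (subst Distinct (sym (reflections-alt s t k)) (AllPairsP.applyUpTo⁺₁ _ k distinct))
    where
    open NumbersGame M using (alt-even-nontrivial)
    distinct : ∀ {i j} → i < j → j < k → ¬ (alt s t (suc (i + i)) ≈ alt s t (suc (j + j)))
    distinct {i} i<j j<k e with ℕ.m≤n⇒∃[o]m+o≡n i<j
    ... | d , refl = Sum.[ alt-even-nontrivial s≢t d bound′
                         , alt-even-nontrivial (≢-sym s≢t) d (subst (λ c → c ≡ 0 ⊎ suc d < c) (m-sym s t) bound′) ]
                     (alt-cancel s t (suc (i + i)) (suc d + suc d) (subst (λ c → alt s t (suc (i + i)) ≈ alt s t c) double e))
      where
      open ≡-Reasoning
      double : suc (suc (i + d) + suc (i + d)) ≡ suc (i + i) + (suc d + suc d)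
      double = cong suc (begin
        suc (i + d) + suc (i + d)  ≡⟨ cong₂ _+_ (ℕ.+-suc i d) (ℕ.+-suc i d) ⟨
        i + suc d + (i + suc d)    ≡⟨ ℕ.+-assoc i (suc d) (i + suc d) ⟩
        i + (suc d + (i + suc d))  ≡⟨ cong (i +_) (ℕ.+-assoc (suc d) i (suc d)) ⟨
        i + (suc d + i + suc d)    ≡⟨ cong (λ c → i + (c + suc d)) (ℕ.+-comm (suc d) i) ⟩
        i + (i + suc d + suc d)    ≡⟨ cong (i +_) (ℕ.+-assoc i (suc d) (suc d)) ⟩
        i + (i + (suc d + suc d))  ≡⟨ ℕ.+-assoc i i (suc d + suc d) ⟨
        i + i + (suc d + suc d)    ∎)
      bound′ : m s t ≡ 0 ⊎ suc d < m s t
      bound′ = Sum.map₂ (ℕ.≤-trans (ℕ.≤-trans (s≤s (s≤s (ℕ.m≤n+m d i))) j<k)) bound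

-- Decidable descents, normal forms, Matsumoto's theorem, length.

module ReducedWords {n : ℕ} (M : CoxeterMatrix n) where
  open CoxeterMatrix M
  open Coxeter M renaming (_≈_ to infix 4 _≈_)
  open WordGroup M
  open Reflections M

  reduced-resp : ∀ {x y} → Reduced x → x ≈ y → length y ≡ length x → Reduced y
  reduced-resp red e eq w f = subst (_≤ length w) (sym eq) (red w (≈-trans f (≈-sym e)))

  reduced-length : ∀ {x y} → Reduced x → Reduced y → x ≈ y → length x ≡ length y
  reduced-length rx ry e = ℕ.≤-antisym (rx _ (≈-sym e)) (ry _ e)

  ++-cancelʳ : ∀ z {x y} → x ++ z ≈ y ++ z → x ≈ y
  ++-cancelʳ z {x} {y} e = begin
    x                     ≈⟨ undo x ⟨
    (x ++ z) ++ reverse z ≈⟨ ++-congʳ (reverse z) e ⟩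
    (y ++ z) ++ reverse z ≈⟨ undo y ⟩
    y                     ∎
    where
    open ≈-Reasoning
    undo : ∀ x → (x ++ z) ++ reverse z ≈ x
    undo x = ≈-trans (≡⇒≈ (List.++-assoc x z (reverse z)))
      (≈-trans (++-congˡ x (reverse-inverseʳ z)) (≡⇒≈ (List.++-identityʳ x)))

  -- For reduced `y` this is the left-prefix (weak) order; for a one-letter `p` it says that the
  -- letter is a left descent.
  Peel : Word → Word → Set
  Peel p y = ∃[ z ] (y ≈ p ++ z × length y ≡ length p + length z)

  peel-resp : ∀ {p x y} → x ≈ y → length x ≡ length y → Peel p x → Peel p y
  peel-resp e eq (z , f , g) = z , ≈-trans (≈-sym e) f , trans (sym eq) g

  not-peel⇒reduced : ∀ {s y} → Reduced y → ¬ Peel (s ∷ []) y → Reduced (s ∷ y)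
  not-peel⇒reduced {s} {y} red ¬p w e with length (s ∷ y) ≤? length w
  ... | yes p = p
  ... | no ¬le = contradiction (w , y≈sw , ℕ.≤-antisym (red (s ∷ w) (≈-sym y≈sw)) w<y) ¬p
    where
    y≈sw : y ≈ s ∷ w
    y≈sw = ∷-transpose s (≈-sym e)
    -- Equal lengths are impossible because equivalent words have lengths of the same parity.
    w<y : length w < length y
    w<y = ℕ.≤∧≢⇒< (ℕ.≤-pred (ℕ.≰⇒> ¬le)) (λ eq → ≈-length≢suc (≈-sym e) (cong suc (sym eq)))

  peel⇒not-reduced : ∀ {s y} → Peel (s ∷ []) y → ¬ Reduced (s ∷ y)
  peel⇒not-reduced {s} {y} (z , e , eq) red =
    ℕ.<-irrefl refl (ℕ.<-≤-trans (ℕ.n<1+n _) (ℕ.≤-trans (ℕ.≤-reflexive (sym (cong suc eq))) (ℕ.≤-trans (red z z≈sy) (ℕ.n≤1+n _))))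
    where
    z≈sy : z ≈ s ∷ y
    z≈sy = ∷-transpose s (≈-sym e)

  peel-reduced : ∀ p {y} → Reduced y → (h : Peel p y) → Reduced (p ++ proj₁ h)
  peel-reduced p red (z , e , eq) = reduced-resp red e (trans (List.length-++ p) (sym eq))

  Order≥ : Fin n → Fin n → ℕ → Set
  Order≥ s t k = m s t ≡ 0 ⊎ k ≤ m s t

  -- With a prefix of length k starting in `t` split off, the descent `s` permits an exchange. The
  -- deleted letter cannot lie in the prefix, since the alternating word of length k + 1 is reduced;
  -- so it lies in the rest, and the prefix grows.
  peel-alt : ∀ {s t y} → s ≢ t → Reduced y → Peel (s ∷ []) y → Peel (t ∷ []) y →
    ∀ k → Order≥ s t k → ¬ ¬ Peel (alt s t k) y
  peel-alt {y = y} s≢t red ps pt zero _ c = c (y , ≈-refl , refl)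
  peel-alt {s} {t} {y} s≢t red ps pt (suc k) bound c =
    peel-alt (≢-sym s≢t) red pt ps k (subst (λ q → q ≡ 0 ⊎ k ≤ q) (m-sym s t) (Sum.map₂ (ℕ.≤-trans (ℕ.n≤1+n k)) bound))
      λ { h@(z , e , eq) → exchange s (peel-reduced (alt t s k) red h)
            (peel⇒not-reduced (peel-resp e (trans eq (sym (List.length-++ (alt t s k)))) ps))
            λ { (w , d , f) → extend z e eq w f (deletion-++ (alt t s k) d) } }
    where
    extend : ∀ z → y ≈ alt t s k ++ z → length y ≡ length (alt t s k) + length z → ∀ w → s ∷ alt t s k ++ z ≈ w →
      (∃[ x′ ] (Deletion (alt t s k) x′ × w ≡ x′ ++ z)) ⊎ (∃[ z′ ] (Deletion z z′ × w ≡ alt t s k ++ z′)) → ⊥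
    extend z e eq w f (inj₁ (x′ , d , refl)) = ℕ.<-irrefl refl (ℕ.≤-trans
      (ℕ.≤-trans (ℕ.n≤1+n _) (ℕ.≤-reflexive (sym (cong suc (deletion-length d)))))
      (alt-reduced s≢t (suc k) bound x′ (≈-sym (++-cancelʳ z f))))
    extend z e eq w f (inj₂ (z′ , d , refl)) = c (z′ , ≈-trans e (∷-transpose s f) ,
      trans eq (trans (cong (length (alt t s k) +_) (deletion-length d)) (ℕ.+-suc _ _)))

  finite-order : ∀ {s t y} → s ≢ t → Reduced y → Peel (s ∷ []) y → Peel (t ∷ []) y → m s t ≢ 0
  finite-order {s} {t} {y} s≢t red ps pt m≡0 = peel-alt s≢t red ps pt (suc (length y)) (inj₁ m≡0)
    λ { (z , _ , eq) → ℕ.<-irrefl refl (ℕ.≤-trans (s≤s (ℕ.m≤m+n (length y) (length z)))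
        (ℕ.≤-reflexive (sym (trans eq (cong (_+ length z) (alt-length s t (suc (length y)))))))) }

  -- The letters are tracked so that `normalise` introduces no new ones; this keeps normal forms
  -- inside parabolic subgroups.
  Peel⊆ : Word → Word → Set
  Peel⊆ p y = Σ (Peel p y) λ h → p ++ proj₁ h ⊆ y

  alt-letters : ∀ s t k {q} → q ∈L alt s t k → q ≡ s ⊎ q ≡ t
  alt-letters s t (suc k) (here refl) = inj₁ refl
  alt-letters s t (suc k) (there h) = Sum.swap (alt-letters t s k h)

  -- If `y` begins with t ≠ s, then `s` is a descent exactly when the alternating word of length
  -- `m s t` from `t` is a prefix, that is, when the rest after the first letter begins with the
  -- alternating word from `s` that is one letter shorter. Infinite order excludes a second descent.
  -- The recursion is on `N` and, inside `peel?`, on `k`.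
  descent? : ∀ N s y → length y ≤ N → Reduced y → Peel⊆ (s ∷ []) y ⊎ ¬ Peel (s ∷ []) y
  peel? : ∀ N k s t y → length y ≤ N → Reduced y → Peel⊆ (alt s t k) y ⊎ ¬ Peel (alt s t k) y

  descent? N s [] le red = inj₂ λ { (_ , _ , ()) }
  descent? (suc N) s (t ∷ y) (s≤s le) red with s Fin.≟ t | m s t in eqₘ
  ... | yes refl | _ = inj₁ ((y , ≈-refl , refl) , id)
  ... | no s≢t | zero = inj₂ λ p → finite-order s≢t red p (y , ≈-refl , refl) eqₘ
  ... | no s≢t | suc zero = contradiction eqₘ (m-off s t s≢t)
  ... | no s≢t | suc k@(suc j) with peel? N k s t y le (reduced-suffix (t ∷ []) red)
  ... | inj₁ ((z , e , eq) , sub) = inj₁ ((alt t s k ++ z , braided , cong suc (begin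
          length y                        ≡⟨ eq ⟩
          length (alt s t k) + length z   ≡⟨ cong (_+ length z) (trans (alt-length s t k) (sym (alt-length t s k))) ⟩
          length (alt t s k) + length z   ≡⟨ List.length-++ (alt t s k) ⟨
          length (alt t s k ++ z)         ∎)) , letters)
    where
    open ≡-Reasoning
    braided : t ∷ y ≈ s ∷ alt t s k ++ z
    braided = ≈-trans (∷-cong t e) (++-congʳ z
      (subst (λ q → alt t s q ≈ alt s t q) eqₘ (≈-sym (alt-braid s t (λ h → ℕ.1+n≢0 (trans (sym eqₘ) h))))))
    letters : s ∷ alt t s k ++ z ⊆ t ∷ y
    letters (here refl) = there (sub (here refl))
    letters (there h) with ∈-++⁻ (alt t s k) h
    ... | inj₂ h′ = there (sub (∈-++⁺ʳ (alt s t k) h′))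
    ... | inj₁ h′ with alt-letters t s k h′
    ... | inj₁ refl = here refl
    ... | inj₂ refl = there (sub (here refl))
  ... | inj₂ ¬p = inj₂ λ p → peel-alt (≢-sym s≢t) red (y , ≈-refl , refl) p (suc k)
                    (inj₂ (ℕ.≤-reflexive (sym (trans (m-sym t s) eqₘ))))
                    λ { (z , e , eq) → ¬p (z , ∷-cancel t e , ℕ.suc-injective eq) }

  peel? N zero s t y le red = inj₁ ((y , ≈-refl , refl) , id)
  peel? N (suc k) s t y le red with descent? N s y le red
  ... | inj₂ ¬p = inj₂ λ { (z , e , eq) → ¬p (alt t s k ++ z , e , trans eq (cong suc (sym (List.length-++ (alt t s k))))) }
  ... | inj₁ ((z , e , eq) , sub) with peel? N k t s z (ℕ.≤-trans (ℕ.n≤1+n _) (subst (_≤ N) eq le))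
                                        (reduced-suffix (s ∷ []) (reduced-resp red e (sym eq)))
  ... | inj₁ ((z′ , e′ , eq′) , sub′) =
          inj₁ ((z′ , ≈-trans e (∷-cong s e′) , trans eq (cong suc eq′)) , sub ∘ ∷⁺ʳ s sub′)
  ... | inj₂ ¬p = inj₂ λ { (z′ , e′ , eq′) →
          ¬p (z′ , ∷-cancel s (≈-trans (≈-sym e) e′) , ℕ.suc-injective (trans (sym eq) eq′)) }

  normalise : ∀ x → ∃[ y ] (y ≈ x × Reduced y × y ⊆ x)
  normalise [] = [] , ≈-refl , (λ _ _ → z≤n) , id
  normalise (s ∷ x) with normalise x
  ... | y , e , red , sub with descent? (length y) s y ℕ.≤-refl red
  ... | inj₁ ((z , f , eq) , sub′) = z
      , ≈-trans (∷-transpose s (≈-sym f)) (∷-cong s e)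
      , reduced-suffix (s ∷ []) (reduced-resp red f (sym eq))
      , there ∘ sub ∘ sub′ ∘ there
  ... | inj₂ ¬p = s ∷ y , ∷-cong s e , not-peel⇒reduced red ¬p , ∷⁺ʳ s sub

  abstract
    nf : Word → Word
    nf x = proj₁ (normalise x)

    nf-≈ : ∀ x → nf x ≈ x
    nf-≈ x = proj₁ (proj₂ (normalise x))

    nf-reduced : ∀ x → Reduced (nf x)
    nf-reduced x = proj₁ (proj₂ (proj₂ (normalise x)))

    nf-⊆ : ∀ x → nf x ⊆ x
    nf-⊆ x = proj₂ (proj₂ (proj₂ (normalise x)))

  BraidInvariant : (Word → Set) → Set
  BraidInvariant P = ∀ u s t v → m s t ≢ 0 → P (u ++ alt s t (m s t) ++ v) → P (u ++ alt t s (m s t) ++ v)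

  -- Equal first letters are absorbed into `P`. For different first letters `s` and `t` both are
  -- descents, so the element has reduced words beginning with the two sides of the braid relation.
  -- One shares its first letter with `x`, the other with `y`, and one braid move joins them.
  matsumoto : ∀ (P : Word → Set) → BraidInvariant P → ∀ {x y} → Reduced x → Reduced y → x ≈ y → P x → P y
  matsumoto P inv {x} {y} = go (length x) P inv x y ℕ.≤-refl
    where
    go : ∀ N (P : Word → Set) → BraidInvariant P → ∀ x y → length x ≤ N → Reduced x → Reduced y → x ≈ y → P x → P y
    go N P inv [] [] le rx ry e px = px
    go N P inv [] (t ∷ y) le rx ry e px = case reduced-length rx ry e of λ ()
    go N P inv (s ∷ x) [] le rx ry e px = case reduced-length rx ry e of λ ()
    go (suc N) P inv (s ∷ x) (t ∷ y) (s≤s le) rx ry e px with s Fin.≟ t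
    ... | yes refl = go N (P ∘ (s ∷_)) (λ u → inv (s ∷ u)) x y le (reduced-suffix (s ∷ []) rx) (reduced-suffix (s ∷ []) ry) (∷-cancel s e) px
    ... | no s≢t with m s t in eqₘ
    ... | zero = contradiction eqₘ (finite-order s≢t rx (x , ≈-refl , refl) (y , e , reduced-length rx ry e))
    ... | suc k with peel? (suc (length x)) (suc k) s t (s ∷ x) ℕ.≤-refl rx
    ... | inj₂ ¬p = ⊥-elim (peel-alt s≢t rx (x , ≈-refl , refl) (y , e , reduced-length rx ry e) (suc k)
                      (inj₂ (ℕ.≤-reflexive (sym eqₘ))) ¬p)
    ... | inj₁ ((z , f , eq) , _) =
          go N (P ∘ (t ∷_)) (λ u → inv (t ∷ u)) (alt s t k ++ z) y le₂ (reduced-suffix (t ∷ []) red₂) (reduced-suffix (t ∷ []) ry)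
            (∷-cancel t (≈-trans (≈-sym f₂) e))
            (subst (λ q → P (alt t s q ++ z)) eqₘ (inv [] s t z m≢0 (subst (λ q → P (alt s t q ++ z)) (sym eqₘ)
              (go N (P ∘ (s ∷_)) (λ u → inv (s ∷ u)) x (alt t s k ++ z) le (reduced-suffix (s ∷ []) rx)
                (reduced-suffix (s ∷ []) red₁) (∷-cancel s f) px))))
      where
      m≢0 : m s t ≢ 0
      m≢0 h = ℕ.1+n≢0 (trans (sym eqₘ) h)
      red₁ : Reduced (alt s t (suc k) ++ z)
      red₁ = peel-reduced (alt s t (suc k)) rx (z , f , eq)
      f₂ : s ∷ x ≈ alt t s (suc k) ++ z
      f₂ = ≈-trans f (++-congʳ z (subst (λ q → alt s t q ≈ alt t s q) eqₘ (alt-braid s t m≢0)))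
      len₂ : length (alt t s (suc k) ++ z) ≡ length (s ∷ x)
      len₂ = trans (List.length-++ (alt t s (suc k))) (sym (trans eq
        (cong (_+ length z) (trans (alt-length s t (suc k)) (sym (alt-length t s (suc k)))))))
      red₂ : Reduced (alt t s (suc k) ++ z)
      red₂ = reduced-resp rx f₂ len₂
      le₂ : length (alt s t k ++ z) ≤ N
      le₂ = subst (_≤ N) (sym (ℕ.suc-injective len₂)) le

  ∈-braidInvariant : ∀ q → BraidInvariant (q ∈L_)
  ∈-braidInvariant q u s t v m≢0 h with ∈-++⁻ u h
  ... | inj₁ h′ = ∈-++⁺ˡ h′
  ... | inj₂ h′ with ∈-++⁻ (alt s t (m s t)) h′
  ... | inj₂ h″ = ∈-++⁺ʳ u (∈-++⁺ʳ (alt t s (m s t)) h″)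
  ... | inj₁ h″ = ∈-++⁺ʳ u (∈-++⁺ˡ (swapped (m s t) refl h″))
    where
    swapped : ∀ k → m s t ≡ k → q ∈L alt s t k → q ∈L alt t s k
    swapped (suc zero) e (here refl) with s Fin.≟ t
    ... | yes refl = here refl
    ... | no s≢t = contradiction e (m-off s t s≢t)
    swapped (suc (suc k)) e i with alt-letters s t (suc (suc k)) i
    ... | inj₁ refl = there (here refl)
    ... | inj₂ refl = here refl

  letters-invariant : ∀ {x y} → Reduced x → Reduced y → x ≈ y → x ⊆ y
  letters-invariant rx ry e {q} = matsumoto (q ∈L_) (∈-braidInvariant q) rx ry e

  ℓ : Word → ℕ
  ℓ x = length (nf x)

  ℓ-minimal : ∀ {x y} → x ≈ y → ℓ x ≤ length y
  ℓ-minimal {x} {y} e = nf-reduced x y (≈-trans (≈-sym e) (≈-sym (nf-≈ x)))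

  ℓ-cong : ∀ {x y} → x ≈ y → ℓ x ≡ ℓ y
  ℓ-cong {x} {y} e = reduced-length (nf-reduced x) (nf-reduced y) (≈-trans (nf-≈ x) (≈-trans e (≈-sym (nf-≈ y))))

  ℓ-reduced : ∀ {x} → Reduced x → ℓ x ≡ length x
  ℓ-reduced {x} red = reduced-length (nf-reduced x) red (nf-≈ x)

  reduced-ℓ : ∀ {x} → length x ≤ ℓ x → Reduced x
  reduced-ℓ le y e = ℕ.≤-trans le (ℓ-minimal (≈-sym e))

  ℓ-++ : ∀ x y → ℓ (x ++ y) ≤ ℓ x + ℓ y
  ℓ-++ x y = ℕ.≤-trans (ℓ-minimal (++-cong (≈-sym (nf-≈ x)) (≈-sym (nf-≈ y)))) (ℕ.≤-reflexive (List.length-++ (nf x)))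

  ℓ-∷-≢ : ∀ s x → ℓ (s ∷ x) ≢ ℓ x
  ℓ-∷-≢ s x eq = ≈-length≢suc {s ∷ nf x} {nf (s ∷ x)}
    (≈-trans (∷-cong s (nf-≈ x)) (≈-sym (nf-≈ (s ∷ x)))) (cong suc (sym eq))

  ℓ-reverse : ∀ x → ℓ (reverse x) ≡ ℓ x
  ℓ-reverse x = ℕ.≤-antisym (half x) (subst (_≤ ℓ (reverse x)) (cong ℓ (List.reverse-involutive x)) (half (reverse x)))
    where
    half : ∀ x → ℓ (reverse x) ≤ ℓ x
    half x = ℕ.≤-trans (ℓ-minimal (reverse-cong (≈-sym (nf-≈ x)))) (ℕ.≤-reflexive (List.length-reverse (nf x)))

  ℓ-zero : ∀ {x} → ℓ x ≡ 0 → x ≈ []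
  ℓ-zero {x} e with nf x | nf-≈ x
  ... | [] | f = ≈-sym f

-- Parabolic subgroups, minimal coset representatives, longest elements.

module Parabolics {n : ℕ} (M : CoxeterMatrix n) where
  open Coxeter M renaming (_≈_ to infix 4 _≈_)
  open WordGroup M
  open Reflections M
  open ReducedWords M

  LenLe⇒ℓ≤ : ∀ {a b} → LenLe a b → ℓ a ≤ ℓ b
  LenLe⇒ℓ≤ {a} {b} h with h (nf b) (nf-≈ b)
  ... | x , e , le = ℕ.≤-trans (ℓ-minimal (≈-sym e)) le

  ℓ≤⇒LenLe : ∀ {a b} → ℓ a ≤ ℓ b → LenLe a b
  ℓ≤⇒LenLe {a} {b} le y e = nf a , nf-≈ a , ℕ.≤-trans le (ℓ-minimal (≈-sym e))

  LenLt⇒ℓ< : ∀ {a b} → LenLt a b → ℓ a < ℓ b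
  LenLt⇒ℓ< {a} {b} (x , e , f) = ℕ.≤-<-trans (ℓ-minimal (≈-sym e)) (f (nf b) (nf-≈ b))

  ℓ<⇒LenLt : ∀ {a b} → ℓ a < ℓ b → LenLt a b
  ℓ<⇒LenLt {a} lt = nf a , nf-≈ a , λ y e → ℕ.<-≤-trans lt (ℓ-minimal (≈-sym e))

  Supp⇒∈ : ∀ {w s} → Supp w s → s ∈L nf w
  Supp⇒∈ {w} (x , e , red , h) = letters-invariant red (nf-reduced w) (≈-trans e (≈-sym (nf-≈ w))) h

  ∈⇒Supp : ∀ {w s} → s ∈L nf w → Supp w s
  ∈⇒Supp {w} h = nf w , nf-≈ w , nf-reduced w , h

  Supp-reduced : ∀ {x s} → Reduced x → Supp x s → s ∈L x
  Supp-reduced rx (y , e , ry , h) = letters-invariant ry rx e h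

  Supp-resp : ∀ {w w′ s} → w ≈ w′ → Supp w s → Supp w′ s
  Supp-resp e (x , f , h) = x , ≈-trans f e , h

  open import Data.List.Membership.DecPropositional (Fin._≟_ {n}) using () renaming (_∈?_ to _∈L?_)

  Supp? : ∀ w s → Dec (Supp w s)
  Supp? w s with s ∈L? nf w
  ... | yes h = yes (∈⇒Supp h)
  ... | no h = no (h ∘ Supp⇒∈)

  parabolic-nf : ∀ {J : SSet n} {u} → InParabolic J u → All J (nf u)
  parabolic-nf {J} {u} (x , e , h) = All.tabulate λ {q} q∈ → All.lookup h
    (nf-⊆ x (letters-invariant (nf-reduced u) (nf-reduced x) (≈-trans (nf-≈ u) (≈-trans (≈-sym e) (≈-sym (nf-≈ x)))) q∈))

  parabolic-++ : ∀ {J : SSet n} {u v} → InParabolic J u → InParabolic J v → InParabolic J (u ++ v)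
  parabolic-++ (x , e , h) (y , f , k) = x ++ y , ++-cong e f , AllP.++⁺ h k

  All-reverse : ∀ {J : SSet n} {x} → All J x → All J (reverse x)
  All-reverse h = All.tabulate (All.lookup h ∘ AnyP.reverse⁻)

  parabolic-reverse : ∀ {J : SSet n} {u} → InParabolic J u → InParabolic J (reverse u)
  parabolic-reverse (x , e , h) = reverse x , reverse-cong e , All-reverse h

  parabolic-resp : ∀ {J : SSet n} {u v} → u ≈ v → InParabolic J u → InParabolic J v
  parabolic-resp e (x , f , h) = x , ≈-trans f e , h

  parabolic-generator : ∀ {J : SSet n} {r} → J r → InParabolic J (r ∷ [])
  parabolic-generator {r = r} h = r ∷ [] , ≈-refl , h ∷ []

  parabolic-⊆ : ∀ {J : SSet n} {u} → (∀ {q} → q ∈L nf u → J q) → InParabolic J u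
  parabolic-⊆ {u = u} h = nf u , nf-≈ u , All.tabulate h

  parabolic-Supp : ∀ {J : SSet n} {u s} → InParabolic J u → Supp u s → J s
  parabolic-Supp h k = All.lookup (parabolic-nf h) (Supp⇒∈ k)

  LeftMinimal RightMinimal : SSet n → Word → Set
  LeftMinimal J v = ∀ r → J r → ℓ v < ℓ (r ∷ v)
  RightMinimal J v = ∀ r → J r → ℓ v < ℓ (v ++ r ∷ [])

  ℓ-∷-≮ : ∀ r v → ¬ ℓ (r ∷ v) < ℓ v → ℓ v < ℓ (r ∷ v)
  ℓ-∷-≮ r v h = ℕ.≤∧≢⇒< (ℕ.≮⇒≥ h) (≢-sym (ℓ-∷-≢ r v))

  reverse-snoc : ∀ r (v : Word) → reverse (v ++ r ∷ []) ≡ r ∷ reverse v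
  reverse-snoc r v = List.reverse-++ v (r ∷ [])

  ℓ-snoc-reverse : ∀ r v → ℓ (r ∷ reverse v) ≡ ℓ (v ++ r ∷ [])
  ℓ-snoc-reverse r v = trans (cong ℓ (sym (reverse-snoc r v))) (ℓ-reverse (v ++ r ∷ []))

  ℓ-snoc-≮ : ∀ r v → ¬ ℓ (v ++ r ∷ []) < ℓ v → ℓ v < ℓ (v ++ r ∷ [])
  ℓ-snoc-≮ r v h = subst₂ _<_ (ℓ-reverse v) (ℓ-snoc-reverse r v)
    (ℓ-∷-≮ r (reverse v) (h ∘ subst₂ _<_ (ℓ-snoc-reverse r v) (ℓ-reverse v)))

  reduced-++ : ∀ x y → length x + length y ≤ ℓ (x ++ y) → Reduced (x ++ y)
  reduced-++ x y h = reduced-ℓ (subst (_≤ ℓ (x ++ y)) (sym (List.length-++ x)) h)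

  module _ {J : SSet n} (J? : ∀ r → Dec (J r)) where

    strip : ∀ N v → ℓ v ≤ N → ∃[ z ] ∃[ y ] (v ≈ z ++ y × All J z × LeftMinimal J y × ℓ y ≤ ℓ v)
    strip N v le with Fin.any? (λ r → J? r ×-dec (ℓ (r ∷ v) <? ℓ v))
    ... | no h = [] , v , ≈-refl , [] , (λ r j → ℓ-∷-≮ r v (λ lt → h (r , j , lt))) , ℕ.≤-refl
    strip zero v le | yes (r , j , lt) = contradiction (ℕ.<-≤-trans lt le) (λ ())
    strip (suc N) v le | yes (r , j , lt) with strip N (r ∷ v) (ℕ.≤-pred (ℕ.<-≤-trans lt le))
    ... | z , y , e , jz , min , le′ = r ∷ z , y , ∷-transpose r e , j ∷ jz , min , ℕ.≤-trans le′ (ℕ.<⇒≤ lt)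

    -- If additivity fails, exchange deletes a letter of `v`, as `a ∷ u` is reduced. Stripping J
    -- from what is left writes v = c y₀ with c in the parabolic subgroup and y₀ minimal and shorter
    -- than `v`. By induction c y₀ is additive, so the first letter of c is a left descent of `v`,
    -- against its minimality.
    leftMinimal-additive′ : ∀ N v → ℓ v ≤ N → LeftMinimal J v → ∀ u → All J u → Reduced u → ℓ (u ++ v) ≡ length u + ℓ v
    leftMinimal-additive′ N v le min [] ju ru = refl
    leftMinimal-additive′ N v le min (a ∷ u) (ja ∷ ju) ru = decidable-stable (_ ℕ.≟ _) λ ≢ →
      exchange a red-x (λ red-ax → ≢ (trans (ℓ-cong (∷-cong a (++-congˡ u (≈-sym (nf-≈ v)))))
                          (trans (ℓ-reduced red-ax) (cong suc (List.length-++ u)))))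
        λ { (y , d , e) → absurd y e (deletion-++ u d) }
      where
      red-x : Reduced (u ++ nf v)
      red-x = reduced-++ u (nf v) (ℕ.≤-reflexive (trans (sym (leftMinimal-additive′ N v le min u ju (reduced-suffix (a ∷ []) ru)))
                (ℓ-cong (++-congˡ u (≈-sym (nf-≈ v))))))
      absurd : ∀ y → a ∷ u ++ nf v ≈ y →
        (∃[ u′ ] (Deletion u u′ × y ≡ u′ ++ nf v)) ⊎ (∃[ v′ ] (Deletion (nf v) v′ × y ≡ u ++ v′)) → ⊥
      absurd y e (inj₁ (u′ , d , refl)) = ℕ.<-irrefl refl (ℕ.≤-trans
        (ℕ.≤-trans (ℕ.n≤1+n _) (ℕ.≤-reflexive (sym (cong suc (deletion-length d)))))
        (ru u′ (≈-sym (++-cancelʳ (nf v) e))))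
      absurd y e (inj₂ (v′ , d , refl)) with strip (ℓ v′) v′ ℕ.≤-refl
      ... | z , y₀ , f , jz , min₀ , le₀ = shorten (nf c) refl
        where
        c : Word
        c = (reverse (a ∷ u) ++ u) ++ z
        v≈ : v ≈ nf c ++ y₀
        v≈ = begin
          v                                    ≈⟨ nf-≈ v ⟨
          nf v                                 ≈⟨ ++-transposeˡ (a ∷ u) e ⟩
          reverse (a ∷ u) ++ u ++ v′           ≈⟨ ++-congˡ (reverse (a ∷ u)) (++-congˡ u f) ⟩
          reverse (a ∷ u) ++ u ++ z ++ y₀      ≡⟨ List.++-assoc (reverse (a ∷ u)) u (z ++ y₀) ⟨
          (reverse (a ∷ u) ++ u) ++ z ++ y₀    ≡⟨ List.++-assoc (reverse (a ∷ u) ++ u) z y₀ ⟨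
          c ++ y₀                              ≈⟨ ++-congʳ y₀ (nf-≈ c) ⟨
          nf c ++ y₀                           ∎
          where open ≈-Reasoning
        jc : All J (nf c)
        jc = All.tabulate λ q∈ → All.lookup (AllP.++⁺ (AllP.++⁺ (All-reverse (ja ∷ ju)) ju) jz) (nf-⊆ c q∈)
        y₀<v : ℓ y₀ < ℓ v
        y₀<v = ℕ.≤-<-trans le₀ (ℕ.≤-<-trans (ℓ-minimal ≈-refl) (ℕ.≤-reflexive (sym (deletion-length d))))
        shorten : ∀ c′ → nf c ≡ c′ → ⊥
        shorten [] eq = ℕ.<-irrefl (ℓ-cong (≈-trans (≡⇒≈ (cong (_++ y₀) (sym eq))) (≈-sym v≈))) y₀<v
        shorten (r ∷ c′) eq = ℕ.<-irrefl refl (ℕ.<-trans (min r (All.head (subst (All J) eq jc))) (ℕ.≤-<-trans upper (ℕ.≤-reflexive total)))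
          where
          upper : ℓ (r ∷ v) ≤ length c′ + ℓ y₀
          upper = ℕ.≤-trans (ℕ.≤-reflexive (ℓ-cong (≈-trans (∷-cong r (≈-trans v≈ (≡⇒≈ (cong (_++ y₀) eq)))) (ss-cancel r _))))
                    (ℕ.≤-trans (ℓ-++ c′ y₀) (ℕ.+-monoˡ-≤ (ℓ y₀) (ℓ-minimal ≈-refl)))
          total : suc (length c′ + ℓ y₀) ≡ ℓ v
          total = trans (cong (λ w → length w + ℓ y₀) (sym eq)) (trans
            (sym (recurse N le)) (sym (ℓ-cong v≈)))
            where
            recurse : ∀ N → ℓ v ≤ N → ℓ (nf c ++ y₀) ≡ length (nf c) + ℓ y₀
            recurse zero le = contradiction (ℕ.<-≤-trans y₀<v le) (λ ())
            recurse (suc N) le = leftMinimal-additive′ N y₀ (ℕ.≤-pred (ℕ.<-≤-trans y₀<v le)) min₀ (nf c) jc (nf-reduced c)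

    leftMinimal-additive : ∀ {v} → LeftMinimal J v → ∀ {u} → InParabolic J u → ℓ (u ++ v) ≡ ℓ u + ℓ v
    leftMinimal-additive {v} min {u} h = trans (ℓ-cong (++-congʳ v (≈-sym (nf-≈ u))))
      (leftMinimal-additive′ (ℓ v) v ℕ.≤-refl min (nf u) (parabolic-nf h) (nf-reduced u))

    rightMinimal-additive : ∀ {v} → RightMinimal J v → ∀ {u} → InParabolic J u → ℓ (v ++ u) ≡ ℓ v + ℓ u
    rightMinimal-additive {v} min {u} h = begin
      ℓ (v ++ u)                     ≡⟨ ℓ-reverse (v ++ u) ⟨
      ℓ (reverse (v ++ u))           ≡⟨ cong ℓ (List.reverse-++ v u) ⟩
      ℓ (reverse u ++ reverse v)     ≡⟨ leftMinimal-additive leftMin (parabolic-reverse h) ⟩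
      ℓ (reverse u) + ℓ (reverse v)  ≡⟨ cong₂ _+_ (ℓ-reverse u) (ℓ-reverse v) ⟩
      ℓ u + ℓ v                      ≡⟨ ℕ.+-comm (ℓ u) (ℓ v) ⟩
      ℓ v + ℓ u                      ∎
      where
      open ≡-Reasoning
      leftMin : LeftMinimal J (reverse v)
      leftMin r j = subst₂ _<_ (sym (ℓ-reverse v)) (sym (ℓ-snoc-reverse r v)) (min r j)

    rightMinimal⇒minCosetRep : ∀ {v} → RightMinimal J v → MinCosetRep J v
    rightMinimal⇒minCosetRep {v} min u h =
      ℓ≤⇒LenLe (subst (ℓ v ≤_) (sym (rightMinimal-additive min h)) (ℕ.m≤m+n (ℓ v) (ℓ u)))

    minCosetRep-decomposition : ∀ w → ∃[ v ] ∃[ u ] (v ++ u ≈ w × RightMinimal J v × InParabolic J u)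
    minCosetRep-decomposition w with strip (ℓ (reverse w)) (reverse w) ℕ.≤-refl
    ... | z , y , e , jz , min , _ = reverse y , reverse z
        , ≈-trans (≡⇒≈ (sym (List.reverse-++ z y))) (≈-trans (reverse-cong (≈-sym e)) (≡⇒≈ (List.reverse-involutive w)))
        , (λ r j → subst₂ _<_ (sym (ℓ-reverse y)) (trans (cong ℓ (sym (reverse-snoc-reverse r y))) (ℓ-reverse (reverse y ++ r ∷ []))) (min r j))
        , parabolic-reverse (z , ≈-refl , jz)
      where
      reverse-snoc-reverse : ∀ r y → reverse (reverse y ++ r ∷ []) ≡ r ∷ y
      reverse-snoc-reverse r y = trans (reverse-snoc r (reverse y)) (cong (r ∷_) (List.reverse-involutive y))

    -- For z = u′ u⁻¹ one has v = v′ z and v′ = v z⁻¹. Both products are additive in length, which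
    -- forces z to be trivial.
    rightMinimal-unique : ∀ {v v′ u u′} → RightMinimal J v → RightMinimal J v′ → InParabolic J u → InParabolic J u′ →
      v ++ u ≈ v′ ++ u′ → v ≈ v′
    rightMinimal-unique {v} {v′} {u} {u′} min min′ h h′ e =
      ≈-trans v≈ (≈-trans (++-congˡ v′ (ℓ-zero z≡0)) (≡⇒≈ (List.++-identityʳ v′)))
      where
      z : Word
      z = u′ ++ reverse u
      hz : InParabolic J z
      hz = parabolic-++ h′ (parabolic-reverse h)
      v≈ : v ≈ v′ ++ z
      v≈ = begin
        v                            ≡⟨ List.++-identityʳ v ⟨
        v ++ []                      ≈⟨ ++-congˡ v (reverse-inverseʳ u) ⟨
        v ++ u ++ reverse u          ≡⟨ List.++-assoc v u (reverse u) ⟨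
        (v ++ u) ++ reverse u        ≈⟨ ++-congʳ (reverse u) e ⟩
        (v′ ++ u′) ++ reverse u      ≡⟨ List.++-assoc v′ u′ (reverse u) ⟩
        v′ ++ z                      ∎
        where open ≈-Reasoning
      v′≈ : v′ ≈ v ++ reverse z
      v′≈ = begin
        v′                           ≡⟨ List.++-identityʳ v′ ⟨
        v′ ++ []                     ≈⟨ ++-congˡ v′ (reverse-inverseʳ z) ⟨
        v′ ++ z ++ reverse z         ≡⟨ List.++-assoc v′ z (reverse z) ⟨
        (v′ ++ z) ++ reverse z       ≈⟨ ++-congʳ (reverse z) v≈ ⟨
        v ++ reverse z               ∎
        where open ≈-Reasoning
      z≡0 : ℓ z ≡ 0
      z≡0 = ℕ.m+n≡0⇒n≡0 (ℓ (reverse z)) (ℕ.+-cancelˡ-≡ (ℓ v) _ 0 (begin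
        ℓ v + (ℓ (reverse z) + ℓ z)  ≡⟨ ℕ.+-assoc (ℓ v) (ℓ (reverse z)) (ℓ z) ⟨
        ℓ v + ℓ (reverse z) + ℓ z    ≡⟨ cong (_+ ℓ z) (rightMinimal-additive min (parabolic-reverse hz)) ⟨
        ℓ (v ++ reverse z) + ℓ z     ≡⟨ cong (_+ ℓ z) (ℓ-cong v′≈) ⟨
        ℓ v′ + ℓ z                   ≡⟨ rightMinimal-additive min′ hz ⟨
        ℓ (v′ ++ z)                  ≡⟨ ℓ-cong v≈ ⟨
        ℓ v                          ≡⟨ ℕ.+-identityʳ (ℓ v) ⟨
        ℓ v + 0                      ∎))
        where open ≡-Reasoning

  minCosetRep⇒rightMinimal : ∀ {J : SSet n} {v} → MinCosetRep J v → RightMinimal J v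
  minCosetRep⇒rightMinimal {v = v} h r j = ℓ-snoc-≮ r v (ℕ.≤⇒≯ (LenLe⇒ℓ≤ (h (r ∷ []) (parabolic-generator j))))

  module _ {J : SSet n} {x} (desc : ∀ r → J r → ℓ (r ∷ x) < ℓ x) where

    -- Every reduced word over J is a prefix of `x`. For one more letter `r`, a descent of `x`,
    -- exchange deletes a letter of x = b x₁; it cannot lie in `b` because `r ∷ b` is reduced, so it
    -- lies in x₁.
    descents-divide′ : ∀ b → All J b → Reduced b → ℓ (reverse b ++ x) + length b ≤ ℓ x
    descents-divide′ [] _ _ = ℕ.≤-reflexive (ℕ.+-identityʳ (ℓ x))
    descents-divide′ (r ∷ b) (jr ∷ jb) rb = decidable-stable (_ ℕ.≤? _) λ ≰ →
      exchange r red-X not-red λ { (y , d , e) → absurd ≰ y e (deletion-++ b d) }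
      where
      x₁ : Word
      x₁ = reverse b ++ x
      X : Word
      X = b ++ nf x₁
      IH : ℓ x₁ + length b ≤ ℓ x
      IH = descents-divide′ b jb (reduced-suffix (r ∷ []) rb)
      X≈x : X ≈ x
      X≈x = ≈-trans (++-congˡ b (nf-≈ x₁)) (reverse-cancelʳ b x)
      red-X : Reduced X
      red-X = reduced-++ b (nf x₁) (ℕ.≤-trans (ℕ.≤-reflexive (ℕ.+-comm (length b) (ℓ x₁)))
                (ℕ.≤-trans IH (ℕ.≤-reflexive (ℓ-cong (≈-sym X≈x)))))
      not-red : ¬ Reduced (r ∷ X)
      not-red red = ℕ.<-asym (desc r jr) (ℕ.≤-reflexive (begin
        suc (ℓ x)      ≡⟨ cong suc (ℓ-cong X≈x) ⟨
        suc (ℓ X)      ≡⟨ cong suc (ℓ-reduced red-X) ⟩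
        length (r ∷ X) ≡⟨ ℓ-reduced red ⟨
        ℓ (r ∷ X)      ≡⟨ ℓ-cong (∷-cong r X≈x) ⟩
        ℓ (r ∷ x)      ∎))
        where open ≡-Reasoning
      absurd : ¬ (ℓ (reverse (r ∷ b) ++ x) + suc (length b) ≤ ℓ x) → ∀ y → r ∷ X ≈ y →
        (∃[ b′ ] (Deletion b b′ × y ≡ b′ ++ nf x₁)) ⊎ (∃[ z ] (Deletion (nf x₁) z × y ≡ b ++ z)) → ⊥
      absurd ≰ y e (inj₁ (b′ , d , refl)) = ℕ.<-irrefl refl (ℕ.≤-trans
        (ℕ.≤-trans (ℕ.n≤1+n _) (ℕ.≤-reflexive (sym (cong suc (deletion-length d)))))
        (rb b′ (≈-sym (++-cancelʳ (nf x₁) e))))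
      absurd ≰ y e (inj₂ (z , d , refl)) = ≰ (begin
        ℓ (reverse (r ∷ b) ++ x) + suc (length b)  ≤⟨ ℕ.+-monoˡ-≤ (suc (length b)) (ℓ-minimal short) ⟩
        length z + suc (length b)                  ≡⟨ ℕ.+-suc (length z) (length b) ⟩
        suc (length z) + length b                  ≡⟨ cong (_+ length b) (deletion-length d) ⟨
        ℓ x₁ + length b                            ≤⟨ IH ⟩
        ℓ x                                        ∎)
        where
        open ℕ.≤-Reasoning
        short : reverse (r ∷ b) ++ x ≈ z
        short = ≈-trans (++-congˡ (reverse (r ∷ b)) (≈-trans (≈-sym X≈x) (∷-transpose r e))) (reverse-cancelˡ (r ∷ b) z)

    descents-divide : ∀ {b} → InParabolic J b → ℓ (reverse b ++ x) + ℓ b ≤ ℓ x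
    descents-divide {b} h = subst (λ k → k + ℓ b ≤ ℓ x)
      (ℓ-cong (++-congʳ x (reverse-cong (nf-≈ b)))) (descents-divide′ (nf b) (parabolic-nf h) (nf-reduced b))

  module _ {J : SSet n} {u} (longest : IsLongest J u) where

    longest-maximal : ∀ {x} → InParabolic J x → ℓ x ≤ ℓ u
    longest-maximal h = LenLe⇒ℓ≤ (proj₂ longest _ h)

    longest-left : ∀ r → J r → ℓ (r ∷ u) < ℓ u
    longest-left r j = ℕ.≤∧≢⇒< (longest-maximal (parabolic-++ (parabolic-generator j) (proj₁ longest))) (ℓ-∷-≢ r u)

    longest-right : ∀ r → J r → ℓ (u ++ r ∷ []) < ℓ u
    longest-right r j = ℕ.≤∧≢⇒< (longest-maximal (parabolic-++ (proj₁ longest) (parabolic-generator j)))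
      (λ e → ℓ-∷-≢ r (reverse u) (trans (ℓ-snoc-reverse r u) (trans e (sym (ℓ-reverse u)))))

    -- All letters of J are left descents of u⁻¹, so `u` divides u⁻¹ from the left; the quotient u⁻¹
    -- u⁻¹ has length zero.
    longest-involutive : u ++ u ≈ []
    longest-involutive = ≈-trans (≡⇒≈ (sym (List.reverse-involutive (u ++ u)))) (reverse-cong
      (≈-trans (≡⇒≈ (List.reverse-++ u u)) (ℓ-zero (ℕ.n≤0⇒n≡0 (ℕ.+-cancelʳ-≤ (ℓ u) _ 0
        (ℕ.≤-trans (descents-divide desc (proj₁ longest)) (ℕ.≤-reflexive (ℓ-reverse u))))))))
      where
      desc : ∀ r → J r → ℓ (r ∷ reverse u) < ℓ (reverse u)
      desc r j = subst₂ _<_ (sym (ℓ-snoc-reverse r u)) (sym (ℓ-reverse u)) (longest-right r j)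

    longest-dividesˡ : ∀ {x} → (∀ r → J r → ℓ (r ∷ x) < ℓ x) → ℓ (u ++ x) + ℓ u ≤ ℓ x
    longest-dividesˡ {x} desc = subst₂ (λ a b → a + b ≤ ℓ x)
      (cong (λ w → ℓ (w ++ x)) (List.reverse-involutive u)) (ℓ-reverse u)
      (descents-divide desc (parabolic-reverse (proj₁ longest)))

    module _ {x} (desc : ∀ r → J r → ℓ (x ++ r ∷ []) < ℓ x) where

      longest-dividesʳ : ℓ (x ++ u) + ℓ u ≤ ℓ x
      longest-dividesʳ = subst₂ (λ a b → a + ℓ u ≤ b)
        (trans (cong ℓ (sym (List.reverse-++ x u))) (ℓ-reverse (x ++ u))) (ℓ-reverse x)
        (descents-divide (λ r j → subst₂ _<_ (sym (ℓ-snoc-reverse r x)) (sym (ℓ-reverse x)) (desc r j)) (proj₁ longest))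

      -- If `r` shortened x u, then x = (x u r) (r u) would be shorter than the sum of the lengths
      -- of x u and `u`, which is at most that of `x`.
      longest-quotient-minimal : RightMinimal J (x ++ u)
      longest-quotient-minimal r j = ℓ-snoc-≮ r (x ++ u) λ lt → ℕ.<-irrefl refl (begin-strict
        ℓ x                                    ≡⟨ ℓ-cong x≈ ⟩
        ℓ (((x ++ u) ++ r ∷ []) ++ r ∷ u)      ≤⟨ ℓ-++ ((x ++ u) ++ r ∷ []) (r ∷ u) ⟩
        ℓ ((x ++ u) ++ r ∷ []) + ℓ (r ∷ u)     <⟨ ℕ.+-mono-<-≤ lt (ℕ.<⇒≤ (longest-left r j)) ⟩
        ℓ (x ++ u) + ℓ u                       ≤⟨ longest-dividesʳ ⟩
        ℓ x                                    ∎)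
        where
        open ℕ.≤-Reasoning
        x≈ : x ≈ ((x ++ u) ++ r ∷ []) ++ r ∷ u
        x≈ = ≈-sym (≈-trans (≡⇒≈ (List.++-assoc (x ++ u) (r ∷ []) (r ∷ u)))
          (≈-trans (++-congˡ (x ++ u) (ss-cancel r u)) (≈-trans (≡⇒≈ (List.++-assoc x u u))
          (≈-trans (++-congˡ x longest-involutive) (≡⇒≈ (List.++-identityʳ x))))))

-- Letters reached from a given letter, and their invariance under braid moves.

module ReachedLetters {n : ℕ} (M : CoxeterMatrix n) where
  open CoxeterMatrix M
  open Coxeter M renaming (_≈_ to infix 4 _≈_)
  open WordGroup M
  open Reflections M
  open ReducedWords M
  open Parabolics M

  adjacent-sym : ∀ {s t} → Adjacent s t → Adjacent t s
  adjacent-sym {s} {t} = subst (λ k → 3 ≤ k ⊎ k ≡ 0) (m-sym s t)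

  adjacent? : ∀ s t → Dec (Adjacent s t)
  adjacent? s t with m s t
  ... | zero = yes (inj₂ refl)
  ... | suc zero = no λ { (inj₁ (s≤s ())) ; (inj₂ ()) }
  ... | suc (suc zero) = no λ { (inj₁ (s≤s (s≤s ()))) ; (inj₂ ()) }
  ... | suc (suc (suc k)) = yes (inj₁ (s≤s (s≤s (s≤s z≤n))))

  adjacent-irreflexive : ∀ s → ¬ Adjacent s s
  adjacent-irreflexive s h with m s s | m-diag s
  adjacent-irreflexive s (inj₁ (s≤s ())) | _ | refl
  adjacent-irreflexive s (inj₂ ()) | _ | refl

  not-adjacent⇒2 : ∀ {s t} → s ≢ t → ¬ Adjacent s t → m s t ≡ 2
  not-adjacent⇒2 {s} {t} s≢t ¬adj with m s t in eq
  ... | zero = contradiction (inj₂ refl) ¬adj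
  ... | suc zero = contradiction eq (m-off s t s≢t)
  ... | suc (suc zero) = refl
  ... | suc (suc (suc k)) = contradiction (inj₁ (s≤s (s≤s (s≤s z≤n)))) ¬adj

  not-adjacent-commute : ∀ {s t} → ¬ Adjacent s t → s ∷ t ∷ [] ≈ t ∷ s ∷ []
  not-adjacent-commute {s} {t} ¬adj with s Fin.≟ t
  ... | yes refl = ≈-refl
  ... | no s≢t = subst (λ k → alt s t k ≈ alt t s k) (not-adjacent⇒2 s≢t ¬adj)
                   (alt-braid s t (λ e → ¬adj (inj₂ e)))

  not-adjacent-commute-word : ∀ {s} x → All (λ t → ¬ Adjacent s t) x → s ∷ x ≈ x ++ s ∷ []
  not-adjacent-commute-word [] [] = ≈-refl
  not-adjacent-commute-word {s} (t ∷ x) (h ∷ hs) =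
    ≈-trans (++-congʳ x (not-adjacent-commute h)) (∷-cong t (not-adjacent-commute-word x hs))

  -- Only the letter is recorded, not the occurrence that is reached, since occurrences do not
  -- survive braid moves.
  data Reach (s : Fin n) : Word → Fin n → Set where
    source : ∀ {x} → Reach s (s ∷ x) s
    skip   : ∀ {q x r} → Reach s x r → Reach s (q ∷ x) r
    extend : ∀ {q x r} → Reach s x r → Adjacent q r → Reach s (q ∷ x) q

  reach-∈ : ∀ {s x r} → Reach s x r → r ∈L x
  reach-∈ source = here refl
  reach-∈ (skip h) = there (reach-∈ h)
  reach-∈ (extend h _) = here refl

  reach-source∈ : ∀ {s x r} → Reach s x r → s ∈L x
  reach-source∈ source = here refl
  reach-source∈ (skip h) = there (reach-source∈ h)
  reach-source∈ (extend h _) = there (reach-source∈ h)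

  reach-self : ∀ {s x} → s ∈L x → Reach s x s
  reach-self (here refl) = source
  reach-self (there h) = skip (reach-self h)

  reach-++ʳ : ∀ {s y r} x → Reach s y r → Reach s (x ++ y) r
  reach-++ʳ [] h = h
  reach-++ʳ (a ∷ x) h = skip (reach-++ʳ x h)

  reach-++ˡ : ∀ {s x r} y → Reach s x r → Reach s (x ++ y) r
  reach-++ˡ y source = source
  reach-++ˡ y (skip h) = skip (reach-++ˡ y h)
  reach-++ˡ y (extend h a) = extend (reach-++ˡ y h) a

  reach-++⁻ : ∀ {s y r} x → ¬ s ∈L y → Reach s (x ++ y) r → Reach s x r
  reach-++⁻ [] s∉y h = contradiction (reach-source∈ h) s∉y
  reach-++⁻ (a ∷ x) s∉y source = source
  reach-++⁻ (a ∷ x) s∉y (skip h) = skip (reach-++⁻ x s∉y h)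
  reach-++⁻ (a ∷ x) s∉y (extend h adj) = extend (reach-++⁻ x s∉y h) adj

  -- Transitivity across a common prefix: `s` takes over from `t` wherever the chain from `t` may
  -- begin.
  reach-transfer : ∀ {s t y z r} x →
    (∀ x′ → Reach s (t ∷ x′ ++ z) t) → (∀ {q} → Reach t y q → Reach s z q) →
    Reach t (x ++ y) r → Reach s (x ++ z) r
  reach-transfer [] start sub h = sub h
  reach-transfer (t ∷ x) start sub source = start x
  reach-transfer (a ∷ x) start sub (skip h) = skip (reach-transfer x start sub h)
  reach-transfer (a ∷ x) start sub (extend h adj) = extend (reach-transfer x start sub h) adj

  -- The condition obtained is symmetric in `a` and `b`. For adjacent letters and at least three
  -- factors it is also sufficient, by `reach-alt⁺`, which gives the braid invariance.
  reach-alt⁻ : ∀ {s r} a b k v → Reach s (alt a b k ++ v) r →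
    Reach s v r ⊎ ((r ≡ a ⊎ r ≡ b) × ((s ≡ a ⊎ s ≡ b) ⊎ ∃[ q ] (Reach s v q × (Adjacent a q ⊎ Adjacent b q))))
  reach-alt⁻ a b zero v h = inj₁ h
  reach-alt⁻ a b (suc k) v source = inj₂ (inj₁ refl , inj₁ (inj₁ refl))
  reach-alt⁻ a b (suc k) v (skip h) = Sum.map₂
    (λ (e , f) → Sum.swap e , Sum.map Sum.swap (λ (q , g , adj) → q , g , Sum.swap adj) f) (reach-alt⁻ b a k v h)
  reach-alt⁻ a b (suc k) v (extend {r = q} h adj) with reach-alt⁻ b a k v h
  ... | inj₁ g = inj₂ (inj₁ refl , inj₂ (q , g , inj₁ adj))
  ... | inj₂ (_ , f) = inj₂ (inj₁ refl , Sum.map Sum.swap (λ (q , g , adj) → q , g , Sum.swap adj) f)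

  reach-alt⁺ : ∀ {s r} a b k v → Adjacent a b → r ≡ a ⊎ r ≡ b →
    (s ≡ a ⊎ s ≡ b) ⊎ ∃[ q ] (Reach s v q × (Adjacent a q ⊎ Adjacent b q)) →
    Reach s (alt a b (suc (suc (suc k))) ++ v) r
  reach-alt⁺ {s} a b zero v ab e f = Sum.[ (λ { refl → proj₁ (both f) }) , (λ { refl → proj₂ (both f) }) ] e
    where
    -- The last letter a may or may not be enabled; the block b, a in front of it suffices in either case.
    both : (s ≡ a ⊎ s ≡ b) ⊎ ∃[ q ] (Reach s v q × (Adjacent a q ⊎ Adjacent b q)) →
      Reach s (a ∷ b ∷ a ∷ v) a × Reach s (a ∷ b ∷ a ∷ v) b
    both (inj₁ (inj₁ refl)) = source , skip (extend source (adjacent-sym ab))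
    both (inj₁ (inj₂ refl)) = extend source ab , skip source
    both (inj₂ (q , g , inj₁ aq)) = skip (skip (extend g aq)) , skip (extend (extend g aq) (adjacent-sym ab))
    both (inj₂ (q , g , inj₂ bq)) = extend (extend (skip g) bq) ab , skip (extend (skip g) bq)
  reach-alt⁺ a b (suc k) v ab e f = skip (reach-alt⁺ b a k v (adjacent-sym ab) (Sum.swap e)
    (Sum.map Sum.swap (λ (q , g , adj) → q , g , Sum.swap adj) f))

  reach-braid : ∀ {s r} a b v → m a b ≢ 0 → Reach s (alt a b (m a b) ++ v) r → Reach s (alt b a (m a b) ++ v) r
  reach-braid {s} {r} a b v m≢0 h with a Fin.≟ b | m a b in eq
  ... | yes refl | _ = h
  ... | no _ | zero = contradiction refl m≢0
  ... | no a≢b | suc zero = contradiction eq (m-off a b a≢b)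
  ... | no a≢b | suc (suc (suc k)) with reach-alt⁻ a b (suc (suc (suc k))) v h
  ... | inj₁ g = reach-++ʳ (alt b a (suc (suc (suc k)))) g
  ... | inj₂ (e , f) = reach-alt⁺ b a k v (adjacent-sym ab) (Sum.swap e)
                         (Sum.map Sum.swap (λ (q , g , adj) → q , g , Sum.swap adj) f)
    where
    ab : Adjacent a b
    ab = inj₁ (subst (3 ≤_) (sym eq) (s≤s (s≤s (s≤s z≤n))))
  reach-braid {s} {r} a b v m≢0 h | no a≢b | suc (suc zero) = commute h
    where
    ¬ab : ¬ Adjacent a b
    ¬ab (inj₁ le) with subst (3 ≤_) eq le
    ... | s≤s (s≤s ())
    ¬ab (inj₂ e) = ℕ.1+n≢0 (trans (sym eq) e)
    commute : Reach s (a ∷ b ∷ v) r → Reach s (b ∷ a ∷ v) r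
    commute source = skip source
    commute (skip source) = source
    commute (skip (skip g)) = skip (skip g)
    commute (skip (extend g adj)) = extend (skip g) adj
    commute (extend source adj) = contradiction adj ¬ab
    commute (extend (skip g) adj) = skip (extend g adj)
    commute (extend (extend g _) adj) = contradiction adj ¬ab

  reach-braidInvariant : ∀ s r → BraidInvariant (λ x → Reach s x r)
  reach-braidInvariant s r u a b v m≢0 = go u
    where
    go : ∀ {r} u → Reach s (u ++ alt a b (m a b) ++ v) r → Reach s (u ++ alt b a (m a b) ++ v) r
    go [] h = reach-braid a b v m≢0 h
    go (c ∷ u) source = source
    go (c ∷ u) (skip h) = skip (go u h)
    go (c ∷ u) (extend h adj) = extend (go u h) adj

  reach-resp : ∀ {s x y r} → Reduced x → Reduced y → x ≈ y → Reach s x r → Reach s y r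
  reach-resp {s} {r = r} = matsumoto (λ x → Reach s x r) (reach-braidInvariant s r)

  descent-first : ∀ {q y} → Reduced y → ℓ (q ∷ y) < ℓ y → ∃[ z ] (Reduced (q ∷ z) × y ≈ q ∷ z)
  descent-first {q} {y} red lt = nf (q ∷ y) , red′ , y≈
    where
    y≈ : y ≈ q ∷ nf (q ∷ y)
    y≈ = ∷-transpose q (≈-sym (nf-≈ (q ∷ y)))
    red′ : Reduced (q ∷ nf (q ∷ y))
    red′ = reduced-ℓ (ℕ.≤-trans lt (ℕ.≤-reflexive (ℓ-cong y≈)))

  -- In a reduced word that begins with the descent `q`, the letter `p` is reached to the right of
  -- it.
  reach-descent : ∀ {s q p y} → Reduced y → ℓ (q ∷ y) < ℓ y → Adjacent q p → Reach s y p → Reach s y q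
  reach-descent {s} {q} {p} red lt adj h with descent-first red lt
  ... | z , rz , e = reach-resp rz red (≈-sym e) (add (reach-resp red rz e h))
    where
    add : Reach s (q ∷ z) p → Reach s (q ∷ z) q
    add source = contradiction adj (adjacent-irreflexive q)
    add (skip g) = extend g adj
    add (extend g _) = contradiction adj (adjacent-irreflexive q)

  descent-∈ : ∀ {q y} → Reduced y → ℓ (q ∷ y) < ℓ y → q ∈L y
  descent-∈ red lt with descent-first red lt
  ... | z , rz , e = letters-invariant rz red (≈-sym e) (here refl)

  reach-connected : ∀ {s r} {K : SSet n} {y} → Reduced y → (∀ q → K q → ℓ (q ∷ y) < ℓ y) →
    PathIn K r s → Reach s y r
  reach-connected red desc (here k) = reach-self (descent-∈ red (desc _ k))
  reach-connected red desc (there k adj path) = reach-descent red (desc _ k) adj (reach-connected red desc path)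

  -- A letter other than `s` with no neighbour to its right commutes to the end of `v` and is a
  -- right descent, which minimality forbids.
  reach-coset : ∀ {s v} {J : SSet n} → Reduced v → RightMinimal J v → (∀ {r} → r ∈L v → r ≢ s → J r) →
    ∀ {r} → r ∈L v → Reach s v r
  reach-coset {s} {v} {J} red min J∋ = All.lookup (go [] v refl)
    where
    go : ∀ p x → p ++ x ≡ v → All (Reach s x) x
    go p [] e = []
    go p (a ∷ x) e = case reached? of λ { (inj₁ h) → h ∷ All.map skip rest ; (inj₂ h) → ⊥-elim (not-reached h) }
      where
      rest : All (Reach s x) x
      rest = go (p ++ a ∷ []) x (trans (List.++-assoc p (a ∷ []) x) e)
      reached? : Reach s (a ∷ x) a ⊎ (a ≢ s × All (λ t → ¬ Adjacent a t) x)
      reached? with a Fin.≟ s | Any.any? (adjacent? a) x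
      ... | yes refl | _ = inj₁ source
      ... | no _ | yes h = case find h of λ
              { (t , t∈ , adj) → inj₁ (extend (All.lookup rest t∈) adj) }
      ... | no a≢s | no ¬h = inj₂ (a≢s , AllP.¬Any⇒All¬ x ¬h)
      not-reached : ¬ (a ≢ s × All (λ t → ¬ Adjacent a t) x)
      not-reached (a≢s , h) = ℕ.<-irrefl refl (begin-strict
        length v                     ≡⟨ ℓ-reduced red ⟨
        ℓ v                          <⟨ min a (J∋ (subst (a ∈L_) e (∈-++⁺ʳ p (here refl))) a≢s) ⟩
        ℓ (v ++ a ∷ [])              ≤⟨ ℓ-minimal cancelled ⟩
        length (p ++ x)              ≤⟨ ℕ.n≤1+n _ ⟩
        suc (length (p ++ x))        ≡⟨ trans (cong suc (List.length-++ p)) (trans (sym (ℕ.+-suc (length p) (length x))) (sym (List.length-++ p))) ⟩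
        length (p ++ a ∷ x)          ≡⟨ cong length e ⟩
        length v                     ∎)
        where
        open ℕ.≤-Reasoning
        cancelled : v ++ a ∷ [] ≈ p ++ x
        cancelled = ≈-trans (≡⇒≈ (trans (cong (_++ a ∷ []) (sym e)) (List.++-assoc p (a ∷ x) (a ∷ []))))
          (++-congˡ p (≈-trans (∷-cong a (≈-sym (not-adjacent-commute-word x h))) (ss-cancel a x)))

  -- A BP decomposition v u with respect to s reaches, from any letter of v, every letter of v: descents of u
  -- lead to a neighbour of s, and v ends in s.
  reach-BP : ∀ {s v u} → Reduced u → ¬ s ∈L u → (∀ {r} → r ∈L v → Reach s v r) →
    (∀ {r} → r ∈L v → r ≢ s → ℓ (r ∷ u) < ℓ u) →
    ∀ {t r} → t ∈L v → r ∈L v → Reach t (v ++ u) r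
  reach-BP {s} {v} {u} red s∉u all desc {t} {r} t∈ r∈ with t Fin.≟ s
  ... | yes refl = reach-++ˡ u (all r∈)
  ... | no t≢s = walk v (all t∈) id (reach-self (descent-∈ red (desc t∈ t≢s)))
    where
    walk : ∀ x {q} → Reach s x q → (∀ {p} → p ∈L x → p ∈L v) → Reach t u q → Reach t (v ++ u) r
    walk (s ∷ x) source sub h = contradiction (reach-∈ h) s∉u
    walk (_ ∷ x) (skip g) sub h = walk x g (sub ∘ there) h
    walk (q ∷ x) (extend {r = p} g adj) sub h with p Fin.≟ s
    ... | no p≢s = walk x g (sub ∘ there) (reach-descent red (desc (sub (there (reach-∈ g))) p≢s) (adjacent-sym adj) h)
    ... | yes refl = reach-transfer v (λ x′ → extend (reach-++ʳ x′ h) (adjacent-sym adj))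
                       (λ g′ → contradiction (reach-source∈ g′) s∉u)
                       (reach-++ˡ u (all r∈))

-- Supports of additive products and consequences of a BP decomposition.

module BPDecompositions {n : ℕ} (M : CoxeterMatrix n) where
  open Coxeter M renaming (_≈_ to infix 4 _≈_)
  open WordGroup M
  open ReducedWords M
  open Parabolics M
  open ReachedLetters M

  nf-++-reduced : ∀ x y → ℓ x + ℓ y ≤ ℓ (x ++ y) → Reduced (nf x ++ nf y)
  nf-++-reduced x y le = reduced-++ (nf x) (nf y)
    (ℕ.≤-trans le (ℕ.≤-reflexive (ℓ-cong (++-cong (≈-sym (nf-≈ x)) (≈-sym (nf-≈ y))))))

  nf-++-≈ : ∀ x y → nf x ++ nf y ≈ x ++ y
  nf-++-≈ x y = ++-cong (nf-≈ x) (nf-≈ y)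

  Supp-++ˡ : ∀ {x y r} → ℓ x + ℓ y ≤ ℓ (x ++ y) → Supp x r → Supp (x ++ y) r
  Supp-++ˡ {x} {y} le h = nf x ++ nf y , nf-++-≈ x y , nf-++-reduced x y le , ∈-++⁺ˡ (Supp⇒∈ h)

  Supp-++ʳ : ∀ {x y r} → ℓ x + ℓ y ≤ ℓ (x ++ y) → Supp y r → Supp (x ++ y) r
  Supp-++ʳ {x} {y} le h = nf x ++ nf y , nf-++-≈ x y , nf-++-reduced x y le , ∈-++⁺ʳ (nf x) (Supp⇒∈ h)

  SuppMinus? : ∀ w s r → Dec (SuppMinus w s r)
  SuppMinus? w s r with Supp? w r | r Fin.≟ s
  ... | yes h | no r≢s = yes (h , r≢s)
  ... | yes h | yes r≡s = no (λ (_ , r≢s) → r≢s r≡s)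
  ... | no ¬h | _ = no (¬h ∘ proj₁)

  rightMinimal-resp : ∀ {J : SSet n} {v v′} → v ≈ v′ → RightMinimal J v → RightMinimal J v′
  rightMinimal-resp e min r j = subst₂ _<_ (ℓ-cong e) (ℓ-cong (++-congʳ (r ∷ []) e)) (min r j)

  leftDescent-Supp : ∀ {r x} → ℓ (r ∷ x) < ℓ x → Supp x r
  leftDescent-Supp {r} {x} lt = ∈⇒Supp (descent-∈ (nf-reduced x)
    (subst₂ _<_ (ℓ-cong (∷-cong r (≈-sym (nf-≈ x)))) (ℓ-cong (≈-sym (nf-≈ x))) lt))

  Supp-reverse : ∀ {r x} → Supp (reverse x) r → Supp x r
  Supp-reverse {r} {x} h = parabolic-Supp {J = Supp x}
    (parabolic-resp (reverse-cong (nf-≈ x)) (parabolic-reverse (nf x , ≈-refl , All.tabulate ∈⇒Supp))) h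

  rightDescent-Supp : ∀ {r x} → ℓ (x ++ r ∷ []) < ℓ x → Supp x r
  rightDescent-Supp {r} {x} lt = Supp-reverse (leftDescent-Supp
    (subst₂ _<_ (sym (ℓ-snoc-reverse r x)) (sym (ℓ-reverse x)) lt))

  descent-++ : ∀ {r x y} → ℓ x + ℓ y ≤ ℓ (x ++ y) → ℓ (r ∷ x) < ℓ x → ℓ (r ∷ x ++ y) < ℓ (x ++ y)
  descent-++ {r} {x} {y} le lt = ℕ.≤-<-trans (ℓ-++ (r ∷ x) y) (ℕ.<-≤-trans (ℕ.+-monoˡ-< (ℓ y) lt) le)

  commute-words : ∀ x y → (∀ {a b} → a ∈L x → b ∈L y → ¬ Adjacent a b) → x ++ y ≈ y ++ x
  commute-words [] y h = ≡⇒≈ (sym (List.++-identityʳ y))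
  commute-words (a ∷ x) y h = ≈-trans (∷-cong a (commute-words x y (h ∘ there)))
    (≈-trans (++-congʳ x (not-adjacent-commute-word y (All.tabulate (h (here refl)))))
             (≡⇒≈ (List.++-assoc y (a ∷ []) x)))

  module BP {w v u : Word} {s : Fin n} (bp : BPDecomp (SuppMinus w s) w v u) where

    private
      product : v ++ u ≈ w
      product = proj₁ bp

      parabolic : InParabolic (SuppMinus w s) u
      parabolic = proj₁ (proj₂ (proj₂ bp))

    minimal : RightMinimal (SuppMinus w s) v
    minimal = minCosetRep⇒rightMinimal (proj₁ (proj₂ bp))

    additive : ℓ (v ++ u) ≡ ℓ v + ℓ u
    additive = rightMinimal-additive (SuppMinus? w s) minimal parabolic

    reduced : Reduced (nf v ++ nf u)
    reduced = nf-++-reduced v u (ℕ.≤-reflexive (sym additive))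

    nf≈ : nf v ++ nf u ≈ w
    nf≈ = ≈-trans (nf-++-≈ v u) product

    Supp-v : ∀ {r} → Supp v r → Supp w r
    Supp-v = Supp-resp product ∘ Supp-++ˡ (ℕ.≤-reflexive (sym additive))

    s∉u : ¬ s ∈L nf u
    s∉u h = proj₂ (All.lookup (parabolic-nf parabolic) h) refl

    reach : ∀ {t r} → t ∈L nf v → r ∈L nf v → Reach t (nf v ++ nf u) r
    reach = reach-BP {s = s} (nf-reduced u) s∉u
      (reach-coset (nf-reduced v) (rightMinimal-resp (≈-sym (nf-≈ v)) minimal) (λ h r≢s → Supp-v (∈⇒Supp h) , r≢s))
      (λ {r} h r≢s → subst₂ _<_ (ℓ-cong (∷-cong r (≈-sym (nf-≈ u)))) (ℓ-cong (≈-sym (nf-≈ u)))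
        (LenLt⇒ℓ< (proj₂ (proj₂ (proj₂ bp)) r (Supp-v (∈⇒Supp h) , r≢s) (∈⇒Supp h))))

  crossing : ∀ {A B : SSet n} {a b} → PathIn (λ q → A q ⊎ B q) a b → A a → B b →
    ∃[ p ] ∃[ t ] (A p × B t × (p ≡ t ⊎ Adjacent t p))
  crossing (here _) Aa Bb = _ , _ , Aa , Bb , inj₁ refl
  crossing {A} {B} (there {t = t} _ adj path) Aa Bb with head path
    where
    head : ∀ {q r} → PathIn (λ q → A q ⊎ B q) q r → A q ⊎ B q
    head (here h) = h
    head (there h _ _) = h
  ... | inj₁ At = crossing path At Bb
  ... | inj₂ Bt = _ , t , Aa , Bt , inj₂ (adjacent-sym adj)

-- Factorisations of the product over a labelled staircase diagram.

module Staircase {n : ℕ} (M : CoxeterMatrix n) (D : Coxeter.StaircaseDiagram M) (L : Coxeter.Labelling M D) where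
  open Coxeter M renaming (_≈_ to infix 4 _≈_)
  open StaircaseDiagram D
  open Labelling L
  open WordGroup M
  open ReducedWords M
  open Parabolics M
  open ReachedLetters M
  open BPDecompositions M
  open IsPartialOrder ≼-po using (antisym) renaming (refl to ≼-refl)

  Block : Fin k → SSet n
  Block i s = s ∈S block i

  -- The order comes without a decision procedure, but blocks with a common letter form a chain, and
  -- antisymmetry does the rest.
  ≼? : ∀ {i j s} → Block i s → Block j s → Dec (i ≼ j)
  ≼? {i} {j} {s} si sj with chain s i j si sj | i Fin.≟ j
  ... | inj₁ i≼j | _ = yes i≼j
  ... | inj₂ j≼i | yes refl = yes j≼i
  ... | inj₂ j≼i | no i≢j = no (λ i≼j → i≢j (antisym i≼j j≼i))

  -- A finite search, possible because only blocks that contain `s` are compared, turns the negated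
  -- minimality into a witness.
  lower-block : ∀ {i s} → JR D i s → ∃[ j ] (Block j s × ¬ i ≼ j)
  lower-block {i} {s} (si , ¬min) with Fin.any? lower?
    where
    lower? : ∀ j → Dec (Block j s × ¬ i ≼ j)
    lower? j with s ∈? block j
    ... | no ¬sj = no (¬sj ∘ proj₁)
    ... | yes sj with ≼? si sj
    ... | yes i≼j = no (λ (_ , ¬i≼j) → ¬i≼j i≼j)
    ... | no ¬i≼j = yes (sj , ¬i≼j)
  ... | yes h = h
  ... | no ¬h = contradiction (λ j sj → decidable-stable (≼? si sj) (λ ¬i≼j → ¬h (j , sj , ¬i≼j))) ¬min

  JR-intro : ∀ {i j s} → Block i s → Block j s → ¬ i ≼ j → JR D i s
  JR-intro {j = j} si sj ¬i≼j = si , λ min → ¬i≼j (min j sj)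

  JR? : ∀ i s → Dec (JR D i s)
  JR? i s with s ∈? block i | Fin.any? lower?
    where
    lower? : ∀ j → Dec (∃[ si ] Σ (Block j s) λ sj → ¬ i ≼ j)
    lower? j with s ∈? block i | s ∈? block j
    ... | no ¬si | _ = no (¬si ∘ proj₁)
    ... | yes _ | no ¬sj = no (¬sj ∘ proj₁ ∘ proj₂)
    ... | yes si | yes sj with ≼? si sj
    ... | yes i≼j = no (λ (_ , _ , ¬i≼j) → ¬i≼j i≼j)
    ... | no ¬i≼j = yes (si , sj , ¬i≼j)
  ... | no ¬si | _ = no (¬si ∘ proj₁)
  ... | yes si | yes (j , _ , sj , ¬i≼j) = yes (JR-intro si sj ¬i≼j)
  ... | yes si | no ¬h = no λ jr → case lower-block jr of λ (j , sj , ¬i≼j) → ¬h (j , si , sj , ¬i≼j)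

  lab-rightDescent : ∀ {i} r → JR D i r → ℓ (lab i ++ r ∷ []) < ℓ (lab i)
  lab-rightDescent r jr = LenLt⇒ℓ< (descR _ r jr)

  λbar-minimal : ∀ i → RightMinimal (JR D i) (λbar i)
  λbar-minimal i = longest-quotient-minimal (uR-long i) lab-rightDescent

  λbar-length : ∀ i → ℓ (λbar i) + ℓ (uR i) ≤ ℓ (lab i)
  λbar-length i = longest-dividesʳ (uR-long i) lab-rightDescent

  lab≈ : ∀ i → λbar i ++ uR i ≈ lab i
  lab≈ i = ≈-trans (≡⇒≈ (List.++-assoc (lab i) (uR i) (uR i)))
    (≈-trans (++-congˡ (lab i) (longest-involutive (uR-long i))) (≡⇒≈ (List.++-identityʳ (lab i))))

  λbar-additive : ∀ i → ℓ (λbar i) + ℓ (uR i) ≤ ℓ (λbar i ++ uR i)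
  λbar-additive i = ℕ.≤-trans (λbar-length i) (ℕ.≤-reflexive (ℓ-cong (≈-sym (lab≈ i))))

  λbarWord labWord : Fin k → Word
  λbarWord i = nf (λbar i)
  labWord i = λbarWord i ++ nf (uR i)

  λbarWord-letters : ∀ {i r} → r ∈L λbarWord i → Block i r
  λbarWord-letters {i} {r} h = proj₁ (suppR i r) (∈⇒Supp h)

  λbarWord-letters′ : ∀ {i r} → Block i r → r ∈L λbarWord i
  λbarWord-letters′ {i} {r} h = Supp⇒∈ (proj₂ (suppR i r) h)

  uR-letters : ∀ {i r} → r ∈L nf (uR i) → JR D i r
  uR-letters {i} h = All.lookup (parabolic-nf (proj₁ (uR-long i))) h

  labWord-reduced : ∀ i → Reduced (labWord i)
  labWord-reduced i = nf-++-reduced (λbar i) (uR i) (λbar-additive i)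

  labWord≈ : ∀ i → labWord i ≈ lab i
  labWord≈ i = ≈-trans (nf-++-≈ (λbar i) (uR i)) (lab≈ i)

  labWord-letters : ∀ {i r} → r ∈L labWord i → Block i r
  labWord-letters {i} h with ∈-++⁻ (λbarWord i) h
  ... | inj₁ h′ = λbarWord-letters h′
  ... | inj₂ h′ = proj₁ (uR-letters h′)

  Supp-lab : ∀ {i r} → Supp (lab i) r → Block i r
  Supp-lab {i} h = labWord-letters (Supp-reduced (labWord-reduced i) (Supp-resp (≈-sym (labWord≈ i)) h))

  Supp-lab′ : ∀ {i r} → Block i r → Supp (lab i) r
  Supp-lab′ {i} h = labWord i , labWord≈ i , labWord-reduced i , ∈-++⁺ˡ (λbarWord-letters′ h)

  In : List (Fin k) → SSet n
  In ls s = Any (λ i → Block i s) ls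

  In? : ∀ ls s → Dec (In ls s)
  In? ls s = Any.any? (λ i → s ∈? block i) ls

  In-intro : ∀ {ls i s} → i ∈L ls → Block i s → In ls s
  In-intro (here refl) h = here h
  In-intro (there h) h′ = there (In-intro h h′)

  In-elim : ∀ {ls s} → In ls s → ∃[ i ] (i ∈L ls × Block i s)
  In-elim (here h) = _ , here refl , h
  In-elim (there h) with In-elim h
  ... | i , h′ , h″ = i , there h′ , h″

  -- Blocks are listed from the top, as the factors of Λ.
  record Stack (ls : List (Fin k)) : Set where
    constructor stack
    field
      sorted : AllPairs (λ i j → ¬ i ≼ j) ls
      lower  : ∀ {i j} → j ∈L ls → i ≼ j → i ∈L ls
  open Stack

  tail-stack : ∀ {i ls} → Stack (i ∷ ls) → Stack ls
  tail-stack {i} {ls} (stack (i⋠ ∷ sorted) lower) = stack sorted λ {i′} {j} j∈ i′≼j → case lower (there j∈) i′≼j of λ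
    { (here refl) → contradiction i′≼j (All.lookup i⋠ j∈)
    ; (there h) → h }

  suffix-stack : ∀ ps {ls} → Stack (ps ++ ls) → Stack ls
  suffix-stack [] S = S
  suffix-stack (p ∷ ps) S = suffix-stack ps (tail-stack S)

  head-⋠ : ∀ {i j ls} → Stack (i ∷ ls) → j ∈L ls → ¬ i ≼ j
  head-⋠ (stack (i⋠ ∷ _) _) j∈ = All.lookup i⋠ j∈

  prefix-⋠ : ∀ ps {ls i j} → Stack (ps ++ ls) → i ∈L ps → j ∈L ls → ¬ i ≼ j
  prefix-⋠ (p ∷ ps) S (here refl) j∈ = head-⋠ S (∈-++⁺ʳ ps j∈)
  prefix-⋠ (p ∷ ps) S (there h) j∈ = prefix-⋠ ps (tail-stack S) h j∈

  In-JR : ∀ {i ls s} → Stack (i ∷ ls) → Block i s → In ls s → JR D i s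
  In-JR S si h with In-elim h
  ... | j , j∈ , sj = JR-intro si sj (head-⋠ S j∈)

  JR-In : ∀ {i ls s} → Stack (i ∷ ls) → JR D i s → In ls s
  JR-In {i} {s = s} S jr@(si , _) with lower-block jr
  ... | j , sj , ¬i≼j with chain s i j si sj
  ... | inj₁ i≼j = contradiction i≼j ¬i≼j
  ... | inj₂ j≼i with lower S (here refl) j≼i
  ... | here refl = contradiction j≼i ¬i≼j
  ... | there j∈ = In-intro j∈ sj

  stackWord : List (Fin k) → Word
  stackWord [] = []
  stackWord (i ∷ ls) = λbarWord i ++ stackWord ls

  stackWord-++ : ∀ ps ls → stackWord (ps ++ ls) ≡ stackWord ps ++ stackWord ls
  stackWord-++ [] ls = refl
  stackWord-++ (p ∷ ps) ls = trans (cong (λbarWord p ++_) (stackWord-++ ps ls))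
    (sym (List.++-assoc (λbarWord p) (stackWord ps) (stackWord ls)))

  stackWord-letters : ∀ {ls r} → r ∈L stackWord ls → In ls r
  stackWord-letters {i ∷ ls} h with ∈-++⁻ (λbarWord i) h
  ... | inj₁ h′ = here (λbarWord-letters h′)
  ... | inj₂ h′ = there (stackWord-letters {ls} h′)

  stackWord-parabolic : ∀ ls → InParabolic (In ls) (stackWord ls)
  stackWord-parabolic ls = stackWord ls , ≈-refl , All.tabulate (stackWord-letters {ls})

  head-minimal : ∀ {i ls} → Stack (i ∷ ls) → RightMinimal (In ls) (λbar i)
  head-minimal {i} S r h = ℓ-snoc-≮ r (λbar i) λ lt →
    ℕ.<-asym lt (λbar-minimal i r (In-JR S (proj₁ (suppR i r) (rightDescent-Supp lt)) h))

  head-additive : ∀ {i ls} → Stack (i ∷ ls) → ∀ {x} → InParabolic (In ls) x → ℓ (λbarWord i ++ x) ≡ ℓ (λbar i) + ℓ x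
  head-additive {i} {ls} S {x} h = trans (ℓ-cong (++-congʳ x (nf-≈ (λbar i)))) (rightMinimal-additive (In? ls) (head-minimal S) h)

  stackWord-reduced : ∀ {ls} → Stack ls → Reduced (stackWord ls)
  stackWord-reduced {[]} S y e = z≤n
  stackWord-reduced {i ∷ ls} S = reduced-++ (λbarWord i) (stackWord ls) (ℕ.≤-reflexive (sym (trans
    (head-additive S (stackWord-parabolic ls)) (cong (ℓ (λbar i) +_) (ℓ-reduced (stackWord-reduced (tail-stack S)))))))

  -- As `uR i` is an involution, this is the stack below with its left factor `uR i` removed; that
  -- factor completes `λbar i` to `lab i`.
  lower-quotient : Fin k → List (Fin k) → Word
  lower-quotient i ls = uR i ++ stackWord ls

  lower-quotient-≈ : ∀ i ls → stackWord (i ∷ ls) ≈ lab i ++ lower-quotient i ls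
  lower-quotient-≈ i ls = ≈-trans (++-congʳ (stackWord ls) (nf-≈ (λbar i))) (≡⇒≈ (List.++-assoc (lab i) (uR i) (stackWord ls)))

  lower-quotient-parabolic : ∀ {i ls} → Stack (i ∷ ls) → InParabolic (In ls) (lower-quotient i ls)
  lower-quotient-parabolic {i} {ls} S =
    parabolic-++ (parabolic-⊆ (λ h → JR-In S (uR-letters {i} h))) (stackWord-parabolic ls)

  module _ {i ls} (S : Stack (i ∷ ls)) (desc : ∀ r → JR D i r → ℓ (r ∷ stackWord ls) < ℓ (stackWord ls)) where

    -- The descents are a hypothesis because `shared-descent` establishes them by a recursion that
    -- passes through this estimate.
    lower-quotient-additive′ : ℓ (lab i) + ℓ (lower-quotient i ls) ≤ ℓ (stackWord (i ∷ ls))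
    lower-quotient-additive′ = begin
      ℓ (lab i) + ℓ q                    ≤⟨ ℕ.+-monoˡ-≤ (ℓ q) (ℕ.≤-trans (ℕ.≤-reflexive (ℓ-cong (≈-sym (lab≈ i)))) (ℓ-++ (λbar i) (uR i))) ⟩
      ℓ (λbar i) + ℓ (uR i) + ℓ q        ≡⟨ ℕ.+-assoc (ℓ (λbar i)) (ℓ (uR i)) (ℓ q) ⟩
      ℓ (λbar i) + (ℓ (uR i) + ℓ q)      ≤⟨ ℕ.+-monoʳ-≤ (ℓ (λbar i)) (ℕ.≤-trans (ℕ.≤-reflexive (ℕ.+-comm (ℓ (uR i)) (ℓ q))) (longest-dividesˡ (uR-long i) desc)) ⟩
      ℓ (λbar i) + ℓ (stackWord ls)      ≡⟨ head-additive S (stackWord-parabolic ls) ⟨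
      ℓ (stackWord (i ∷ ls))             ∎
      where
      open ℕ.≤-Reasoning
      q = lower-quotient i ls

  -- A letter shared with a block i above the stack is a left descent: the topmost block j of the stack containing it
  -- has it in J_L, and by saturation all blocks in front of j commute with it.
  shared-descent : ∀ {ls i s} → Stack ls → (∀ {l} → l ∈L ls → ¬ i ≼ l) → Block i s → In ls s →
    ℓ (s ∷ stackWord ls) < ℓ (stackWord ls)
  shared-descent {l ∷ ls} {i} {s} S above si h with s ∈? block l
  ... | yes sl = subst₂ _<_ (ℓ-cong (∷-cong s (≈-sym (lower-quotient-≈ l ls)))) (ℓ-cong (≈-sym (lower-quotient-≈ l ls)))
          (descent-++ (ℕ.≤-trans (lower-quotient-additive′ S (λ r jr → shared-descent (tail-stack S) (head-⋠ S) (proj₁ jr) (JR-In S jr)))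
                        (ℕ.≤-reflexive (ℓ-cong (lower-quotient-≈ l ls))))
            (LenLt⇒ℓ< (descL l s (sl , λ max → above (here refl) (max i si)))))
  ... | no ¬sl with h
  ... | here sl = contradiction sl ¬sl
  ... | there h′ = begin-strict
      ℓ (s ∷ λbarWord l ++ stackWord ls)                  ≡⟨ ℓ-cong (≈-trans (++-congʳ (stackWord ls) (not-adjacent-commute-word (λbarWord l) (All.tabulate commutes)))
                                                               (≡⇒≈ (List.++-assoc (λbarWord l) (s ∷ []) (stackWord ls)))) ⟩
      ℓ (λbarWord l ++ s ∷ stackWord ls)                  ≤⟨ ℓ-++ (λbarWord l) (s ∷ stackWord ls) ⟩
      ℓ (λbarWord l) + ℓ (s ∷ stackWord ls)               <⟨ ℕ.+-monoʳ-< (ℓ (λbarWord l)) (shared-descent (tail-stack S) (above ∘ there) si h′) ⟩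
      ℓ (λbarWord l) + ℓ (stackWord ls)                   ≡⟨ cong (_+ ℓ (stackWord ls)) (ℓ-cong (nf-≈ (λbar l))) ⟩
      ℓ (λbar l) + ℓ (stackWord ls)                       ≡⟨ head-additive S (stackWord-parabolic ls) ⟨
      ℓ (stackWord (l ∷ ls))                              ∎
    where
    open ℕ.≤-Reasoning
    commutes : ∀ {t} → t ∈L λbarWord l → ¬ Adjacent s t
    commutes {t} t∈ adj with In-elim h′
    ... | j , j∈ , sj with adj-chain s t adj l i (inj₂ (λbarWord-letters t∈)) (inj₁ si)
                         | adj-chain s t adj l j (inj₂ (λbarWord-letters t∈)) (inj₁ sj)
    ... | inj₂ i≼l | _ = above (here refl) i≼l
    ... | _ | inj₁ l≼j = head-⋠ S j∈ l≼j
    ... | inj₁ l≼i | inj₂ j≼l = ¬sl (adj-saturated s t adj j l i sj si (inj₂ (λbarWord-letters t∈)) j≼l l≼i)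

  JR-descent : ∀ {i ls} → Stack (i ∷ ls) → ∀ r → JR D i r → ℓ (r ∷ stackWord ls) < ℓ (stackWord ls)
  JR-descent S r jr = shared-descent (tail-stack S) (head-⋠ S) (proj₁ jr) (JR-In S jr)

  lower-quotient-additive : ∀ {i ls} → Stack (i ∷ ls) → ℓ (lab i) + ℓ (lower-quotient i ls) ≤ ℓ (stackWord (i ∷ ls))
  lower-quotient-additive S = lower-quotient-additive′ S (JR-descent S)

  module MaximalBlock {ps i ls} (S : Stack (ps ++ i ∷ ls)) (max : IsMaxBlock D i) where

    private
      T : Stack (i ∷ ls)
      T = suffix-stack ps S

      incomparable : ∀ {l} → l ∈L ps → ¬ (l ≼ i ⊎ i ≼ l)
      incomparable l∈ (inj₁ l≼i) = prefix-⋠ ps S l∈ (here refl) l≼i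
      incomparable {l} l∈ (inj₂ i≼l) with max l i≼l
      ... | refl = prefix-⋠ ps S l∈ (here refl) ≼-refl

      commutes : ∀ {a b} → a ∈L stackWord ps → b ∈L labWord i → ¬ Adjacent a b
      commutes {a} {b} a∈ b∈ adj with In-elim (stackWord-letters {ps} a∈)
      ... | l , l∈ , al = incomparable l∈ (adj-chain a b adj l i (inj₁ al) (inj₂ (labWord-letters b∈)))

    cofactor : Word
    cofactor = stackWord ps ++ lower-quotient i ls

    factorisation : stackWord (ps ++ i ∷ ls) ≈ lab i ++ cofactor
    factorisation = begin
      stackWord (ps ++ i ∷ ls)                              ≡⟨ stackWord-++ ps (i ∷ ls) ⟩
      stackWord ps ++ stackWord (i ∷ ls)                    ≈⟨ ++-congˡ (stackWord ps) (lower-quotient-≈ i ls) ⟩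
      stackWord ps ++ lab i ++ lower-quotient i ls          ≈⟨ ++-congˡ (stackWord ps) (++-congʳ (lower-quotient i ls) (labWord≈ i)) ⟨
      stackWord ps ++ labWord i ++ lower-quotient i ls      ≡⟨ List.++-assoc (stackWord ps) (labWord i) (lower-quotient i ls) ⟨
      (stackWord ps ++ labWord i) ++ lower-quotient i ls    ≈⟨ ++-congʳ (lower-quotient i ls) (commute-words (stackWord ps) (labWord i) commutes) ⟩
      (labWord i ++ stackWord ps) ++ lower-quotient i ls    ≈⟨ ++-congʳ (lower-quotient i ls) (++-congʳ (stackWord ps) (labWord≈ i)) ⟩
      (lab i ++ stackWord ps) ++ lower-quotient i ls        ≡⟨ List.++-assoc (lab i) (stackWord ps) (lower-quotient i ls) ⟩
      lab i ++ cofactor                                     ∎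
      where open ≈-Reasoning

    factorisation-additive : ℓ (lab i) + ℓ cofactor ≤ ℓ (lab i ++ cofactor)
    factorisation-additive = begin
      ℓ (lab i) + ℓ cofactor                                ≤⟨ ℕ.+-monoʳ-≤ (ℓ (lab i)) (ℕ.≤-trans (ℓ-++ (stackWord ps) q) (ℕ.+-monoˡ-≤ (ℓ q) (ℓ-minimal ≈-refl))) ⟩
      ℓ (lab i) + (length (stackWord ps) + ℓ q)             ≡⟨ ℕ.+-assoc (ℓ (lab i)) (length (stackWord ps)) (ℓ q) ⟨
      ℓ (lab i) + length (stackWord ps) + ℓ q               ≡⟨ cong (_+ ℓ q) (ℕ.+-comm (ℓ (lab i)) (length (stackWord ps))) ⟩
      length (stackWord ps) + ℓ (lab i) + ℓ q               ≡⟨ ℕ.+-assoc (length (stackWord ps)) (ℓ (lab i)) (ℓ q) ⟩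
      length (stackWord ps) + (ℓ (lab i) + ℓ q)             ≤⟨ ℕ.+-monoʳ-≤ (length (stackWord ps)) (ℕ.≤-trans (lower-quotient-additive T) (ℓ-minimal ≈-refl)) ⟩
      length (stackWord ps) + length (stackWord (i ∷ ls))   ≡⟨ trans (sym (List.length-++ (stackWord ps))) (cong length (sym (stackWord-++ ps (i ∷ ls)))) ⟩
      length (stackWord (ps ++ i ∷ ls))                     ≡⟨ ℓ-reduced (stackWord-reduced S) ⟨
      ℓ (stackWord (ps ++ i ∷ ls))                          ≡⟨ ℓ-cong factorisation ⟩
      ℓ (lab i ++ cofactor)                                 ∎
      where
      open ℕ.≤-Reasoning
      q = lower-quotient i ls

    -- Blocks listed before `i` are incomparable to it and share no letter with it; a letter shared
    -- with a block listed after `i` is in J_R.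
    cofactor-JR : ∀ {r} → Block i r → Supp cofactor r → JR D i r
    cofactor-JR {r} ri h with parabolic-Supp {J = λ r → In ps r ⊎ In ls r} (parabolic-++
        (parabolic-map inj₁ (stackWord-parabolic ps)) (parabolic-map inj₂ (lower-quotient-parabolic T))) h
      where
      parabolic-map : ∀ {J K : SSet n} {u} → (∀ {r} → J r → K r) → InParabolic J u → InParabolic K u
      parabolic-map f (x , e , h) = x , e , All.map f h
    ... | inj₂ h′ = In-JR T ri h′
    ... | inj₁ h′ with In-elim h′
    ... | l , l∈ , rl = contradiction (chain r l i rl ri) (incomparable l∈)

    -- A left descent of the cofactor in the block lies in J_R, so it is also a right descent of
    -- `lab i`. Inserting it twice between the factors would shorten an additive product.
    cofactor-leftMinimal : LeftMinimal (Block i) cofactor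
    cofactor-leftMinimal r ri = ℓ-∷-≮ r cofactor λ lt → ℕ.<-irrefl refl (begin-strict
      ℓ (lab i ++ cofactor)                     ≡⟨ ℓ-cong (≈-sym (≈-trans (≡⇒≈ (List.++-assoc (lab i) (r ∷ []) (r ∷ cofactor))) (++-congˡ (lab i) (ss-cancel r cofactor)))) ⟩
      ℓ ((lab i ++ r ∷ []) ++ r ∷ cofactor)     ≤⟨ ℓ-++ (lab i ++ r ∷ []) (r ∷ cofactor) ⟩
      ℓ (lab i ++ r ∷ []) + ℓ (r ∷ cofactor)    <⟨ ℕ.+-mono-<-≤ (lab-rightDescent r (cofactor-JR ri (leftDescent-Supp lt))) (ℕ.<⇒≤ lt) ⟩
      ℓ (lab i) + ℓ cofactor                    ≤⟨ factorisation-additive ⟩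
      ℓ (lab i ++ cofactor)                     ∎)
      where open ℕ.≤-Reasoning

    module _ {w} (w≈ : w ≈ stackWord (ps ++ i ∷ ls)) {s} (si : Block i s) (s∉JR : ¬ JR D i s) where

      private
        w≈′ : w ≈ lab i ++ cofactor
        w≈′ = ≈-trans w≈ factorisation

        lab-w : ∀ {r} → Supp (lab i) r → Supp w r
        lab-w = Supp-resp (≈-sym w≈′) ∘ Supp-++ˡ factorisation-additive

        cofactor-w : ∀ {r} → Supp cofactor r → SuppMinus w s r
        cofactor-w h = Supp-resp (≈-sym w≈′) (Supp-++ʳ factorisation-additive h) , λ { refl → s∉JR (cofactor-JR si h) }

      module _ {a b} (e : a ++ b ≈ lab i) (min : RightMinimal (SuppMinus (lab i) s) a)
        (pb : InParabolic (SuppMinus (lab i) s) b) where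

        private
          additive : ℓ (a ++ b) ≡ ℓ a + ℓ b
          additive = rightMinimal-additive (SuppMinus? (lab i) s) min pb

        Supp-left : ∀ {r} → Supp a r → Supp (lab i) r
        Supp-left = Supp-resp e ∘ Supp-++ˡ (ℕ.≤-reflexive (sym additive))

        -- The parabolic decomposition of `lab i` at `s` becomes that of `w` when the cofactor is
        -- absorbed on the right, since `s` is no letter of the cofactor.
        extended-product : a ++ b ++ cofactor ≈ w
        extended-product = ≈-trans (≡⇒≈ (sym (List.++-assoc a b cofactor))) (≈-trans (++-congʳ cofactor e) (≈-sym w≈′))

        extended-minimal : RightMinimal (SuppMinus w s) a
        extended-minimal r (_ , r≢s) = ℓ-snoc-≮ r a λ lt →
          ℕ.<-asym lt (min r (Supp-left (rightDescent-Supp lt) , r≢s))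

        extended-parabolic : InParabolic (SuppMinus w s) (b ++ cofactor)
        extended-parabolic = parabolic-++
          (parabolic-⊆ (λ h → case All.lookup (parabolic-nf pb) h of λ (h′ , r≢s) → lab-w h′ , r≢s))
          (parabolic-⊆ (cofactor-w ∘ ∈⇒Supp))

        extended-additive : ℓ b + ℓ cofactor ≤ ℓ (b ++ cofactor)
        extended-additive = ℕ.+-cancelˡ-≤ (ℓ a) _ _ (begin
          ℓ a + (ℓ b + ℓ cofactor)     ≡⟨ ℕ.+-assoc (ℓ a) (ℓ b) (ℓ cofactor) ⟨
          ℓ a + ℓ b + ℓ cofactor       ≡⟨ cong (_+ ℓ cofactor) (trans (sym additive) (ℓ-cong e)) ⟩
          ℓ (lab i) + ℓ cofactor       ≤⟨ factorisation-additive ⟩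
          ℓ (lab i ++ cofactor)        ≡⟨ ℓ-cong (≈-trans (≈-sym w≈′) (≈-sym extended-product)) ⟩
          ℓ (a ++ b ++ cofactor)       ≤⟨ ℓ-++ a (b ++ cofactor) ⟩
          ℓ a + ℓ (b ++ cofactor)      ∎)
          where open ℕ.≤-Reasoning

      -- The left factor is unchanged, and left descents of `u` remain descents of the additive
      -- product of `u` and the cofactor.
      lift-bp : bp (lab i) s → bp w s
      lift-bp (h , v , u , bpd@(e , min , pu , desc)) = lab-w h , v , u ++ cofactor
        , extended-product e min′ pu
        , rightMinimal⇒minCosetRep (SuppMinus? w s) (extended-minimal e min′ pu)
        , extended-parabolic e min′ pu
        , λ r (_ , r≢s) rv → ℓ<⇒LenLt (descent-++ (extended-additive e min′ pu)
            (LenLt⇒ℓ< (desc r (BP.Supp-v bpd rv , r≢s) rv)))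
        where
        min′ : RightMinimal (SuppMinus (lab i) s) v
        min′ = BP.minimal bpd

      -- Uniqueness of the parabolic decomposition gives v = a and u = b · cofactor. Since the
      -- cofactor is left minimal for the block, multiplying `b` by a letter of the block changes
      -- the length of `b` and of b · cofactor by the same amount, so the descents required of `b`
      -- are those of `u`.
      restrict-bp : bp w s → bp (lab i) s
      restrict-bp (_ , v , u , bpd@(e , min , pu , desc)) with minCosetRep-decomposition (SuppMinus? (lab i) s) (lab i)
      ... | a , b , f , amin , pb = Supp-lab′ si , a , b , f
        , rightMinimal⇒minCosetRep (SuppMinus? (lab i) s) amin , pb
        , λ r (rl , r≢s) ra → ℓ<⇒LenLt (decidable-stable (_ <? _) λ ≮ → ℕ.<-irrefl refl (begin-strict
            ℓ (b ++ cofactor)         ≤⟨ ℓ-++ b cofactor ⟩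
            ℓ b + ℓ cofactor          <⟨ ℕ.+-monoˡ-< (ℓ cofactor) (ℓ-∷-≮ r b ≮) ⟩
            ℓ (r ∷ b) + ℓ cofactor    ≡⟨ leftMinimal-additive (λ q → q ∈? block i) cofactor-leftMinimal
                                          (parabolic-++ (parabolic-generator (Supp-lab rl)) (parabolic-⊆ (λ h → Supp-lab (proj₁ (All.lookup (parabolic-nf pb) h))))) ⟨
            ℓ (r ∷ b ++ cofactor)     ≡⟨ ℓ-cong (∷-cong r u≈) ⟨
            ℓ (r ∷ u)                 <⟨ LenLt⇒ℓ< (desc r (lab-w rl , r≢s) (Supp-resp (≈-sym v≈) ra)) ⟩
            ℓ u                       ≡⟨ ℓ-cong u≈ ⟩
            ℓ (b ++ cofactor)         ∎))
        where
        open ℕ.≤-Reasoning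
        same : v ++ u ≈ a ++ b ++ cofactor
        same = ≈-trans e (≈-sym (extended-product f amin pb))
        v≈ : v ≈ a
        v≈ = rightMinimal-unique (SuppMinus? w s) (BP.minimal bpd) (extended-minimal f amin pb) pu (extended-parabolic f amin pb) same
        u≈ : u ≈ b ++ cofactor
        u≈ = ++-cancelˡ v (≈-trans same (++-congʳ (b ++ cofactor) (≈-sym v≈)))

-- Reaching whole blocks under near-maximality, and the description of bp.

module NearlyMaximalStaircase {n : ℕ} (M : CoxeterMatrix n) (D : Coxeter.StaircaseDiagram M)
  (L : Coxeter.Labelling M D) (nm : Coxeter.Labelling.NearlyMaximalLabelling L) where
  open Coxeter M renaming (_≈_ to infix 4 _≈_)
  open StaircaseDiagram D
  open Labelling L
  open WordGroup M
  open ReducedWords M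
  open Parabolics M
  open ReachedLetters M
  open BPDecompositions M
  open Staircase M D L
  open IsPartialOrder ≼-po using () renaming (refl to ≼-refl)

  -- For a maximal label every letter of the connected block is a left descent. For a nearly maximal
  -- one S(u) ⊂ S(v) makes S(v) the whole block, and the letters of `v` reach one another.
  reach-block : ∀ i {t r} → Block i t → Block i r → Reach t (labWord i) r
  reach-block i {t} {r} ti ri with nm i
  ... | inj₁ (_ , longest) = reach-connected (labWord-reduced i) descents (connected i r t ri ti)
    where
    descents : ∀ q → Block i q → ℓ (q ∷ labWord i) < ℓ (labWord i)
    descents q qi = subst₂ _<_ (ℓ-cong (∷-cong q (≈-sym (labWord≈ i)))) (ℓ-cong (≈-sym (labWord≈ i)))
      (longest-left longest q (Supp-lab′ qi))
  ... | inj₂ (_ , s₀ , v , u , _ , bpd , (u⊆v , _)) =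
    reach-resp (BP.reduced bpd) (labWord-reduced i) (≈-trans (BP.nf≈ bpd) (≈-sym (labWord≈ i)))
      (BP.reach bpd (in-v ti) (in-v ri))
    where
    in-v : ∀ {q} → Block i q → q ∈L nf v
    in-v {q} qi with ∈-++⁻ (nf v) (letters-invariant (labWord-reduced i) (BP.reduced bpd)
                      (≈-trans (labWord≈ i) (≈-sym (BP.nf≈ bpd))) (∈-++⁺ˡ (λbarWord-letters′ qi)))
    ... | inj₁ h = h
    ... | inj₂ h = Supp⇒∈ (u⊆v q (∈⇒Supp h))

  -- The stack has a reduced word that begins with `labWord i`, where the block is already reached.
  reach-bottom : ∀ {i ls t r} → Stack (i ∷ ls) → Block i t → Block i r → Reach t (stackWord (i ∷ ls)) r
  reach-bottom {i} {ls} S ti ri = reach-resp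
    (reduced-++ (labWord i) (nf q) (ℕ.≤-trans (ℕ.≤-reflexive (cong (_+ ℓ q)
        (trans (sym (ℓ-reduced (labWord-reduced i))) (ℓ-cong (labWord≈ i)))))
      (ℕ.≤-trans (lower-quotient-additive S) (ℕ.≤-reflexive (ℓ-cong (≈-sym e))))))
    (stackWord-reduced S) e (reach-++ˡ (nf q) (reach-block i ti ri))
    where
    q : Word
    q = lower-quotient i ls
    e : labWord i ++ nf q ≈ stackWord (i ∷ ls)
    e = ≈-trans (++-cong (labWord≈ i) (nf-≈ q)) (≈-sym (lower-quotient-≈ i ls))

  -- If `t` is in J_R, it is a left descent of the stack below, so `s` reaches `t` there; the other
  -- letters of `uR i` are such descents too, so chains through `uR i` can be replaced by chains in
  -- that stack. If `t` is not in J_R, every chain from `t` in `labWord i` starts inside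
  -- `λbarWord i`, and there `t` extends `p`.
  reach-next : ∀ {i ls s p t} → Stack (i ∷ ls) → Reach s (stackWord ls) p → Block i t → p ≡ t ⊎ Adjacent t p →
    ∀ {r} → Block i r → Reach s (stackWord (i ∷ ls)) r
  reach-next {i} {ls} {s} {p} {t} S h ti pt ri with JR? i t
  ... | yes jr = reach-transfer (λbarWord i) (λ x → reach-++ʳ (t ∷ x) t-reached) (closed (nf (uR i)) uR-letters) (reach-block i ti ri)
    where
    descend : ∀ {q q′} → JR D i q′ → Adjacent q′ q → Reach s (stackWord ls) q → Reach s (stackWord ls) q′
    descend {q′ = q′} jr′ = reach-descent (stackWord-reduced (tail-stack S)) (JR-descent S q′ jr′)
    t-reached : Reach s (stackWord ls) t
    t-reached = Sum.[ (λ { refl → h }) , (λ adj → descend jr adj h) ] pt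
    closed : ∀ x → (∀ {q} → q ∈L x → JR D i q) → ∀ {q} → Reach t x q → Reach s (stackWord ls) q
    closed (_ ∷ x) J source = t-reached
    closed (_ ∷ x) J (skip g) = closed x (J ∘ there) g
    closed (_ ∷ x) J (extend g adj) = descend (J (here refl)) adj (closed x (J ∘ there) g)
  ... | no ¬jr with pt
  ... | inj₁ refl = contradiction (In-JR S ti (stackWord-letters {ls} (reach-∈ h))) ¬jr
  ... | inj₂ adj = reach-transfer (λbarWord i) (λ x → extend (reach-++ʳ x h) adj)
                     (λ g → contradiction (uR-letters (reach-source∈ g)) ¬jr) (reach-block i ti ri)

  module _ {w v u s} (bpd : BPDecomp (SuppMinus w s) w v u) where

    -- The letters of v include C and its cover B, and reach each other; but a letter with lowest block B
    -- only reaches letters of blocks not listed below B.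
    no-cover : ∀ p₁ b p₂ c q → Stack (p₁ ++ b ∷ p₂ ++ c ∷ q) → w ≈ stackWord (p₁ ++ b ∷ p₂ ++ c ∷ q) →
      Block c s → Connected (λ r → Block c r ⊎ Block b r) → ⊥
    no-cover p₁ b p₂ c q S w≈ sc conn with is-min c | is-min b | is-max c
    ... | c₀ , c₀∈ , _ | b₀ , b₀∈ , b₀-min | r₀ , r₀∈ , r₀-max
      with crossing (conn c₀ b₀ (inj₁ c₀∈) (inj₂ b₀∈)) c₀∈ b₀∈
    ... | p , t , pc , tb , pt = separate (reach-++⁻ (stackWord p₁ ++ λbarWord b) b₀∉ (subst (λ x → Reach b₀ x r₀) split
            (reach-resp (BP.reduced bpd) (stackWord-reduced S) (≈-trans (BP.nf≈ bpd) w≈)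
              (BP.reach bpd (in-v (reach-next S′ (reach-c pc) tb pt b₀∈)) (in-v (reach-++ʳ (λbarWord b) (reach-c r₀∈)))))))
      where
      ls : List (Fin k)
      ls = p₂ ++ c ∷ q
      S′ : Stack (b ∷ ls)
      S′ = suffix-stack p₁ S
      split : stackWord (p₁ ++ b ∷ ls) ≡ (stackWord p₁ ++ λbarWord b) ++ stackWord ls
      split = trans (stackWord-++ p₁ (b ∷ ls)) (sym (List.++-assoc (stackWord p₁) (λbarWord b) (stackWord ls)))
      reach-c : ∀ {r} → Block c r → Reach s (stackWord ls) r
      reach-c {r} rc = subst (λ x → Reach s x r) (sym (stackWord-++ p₂ (c ∷ q)))
        (reach-++ʳ (stackWord p₂) (reach-bottom (suffix-stack p₂ (tail-stack S′)) sc rc))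
      in-v : ∀ {r} → Reach s (stackWord (b ∷ ls)) r → r ∈L nf v
      in-v {r} h = reach-∈ (reach-++⁻ (nf v) (BP.s∉u bpd) (reach-resp (stackWord-reduced S) (BP.reduced bpd)
        (≈-trans (≈-sym w≈) (≈-sym (BP.nf≈ bpd)))
        (subst (λ x → Reach s x r) (sym (stackWord-++ p₁ (b ∷ ls))) (reach-++ʳ (stackWord p₁) h))))
      b₀∉ : ¬ b₀ ∈L stackWord ls
      b₀∉ h with In-elim (stackWord-letters {ls} h)
      ... | j , j∈ , b₀j = head-⋠ S′ j∈ (b₀-min j b₀j)
      above : ∀ {l} → l ∈L p₁ ++ b ∷ [] → ¬ l ≼ c
      above l∈ = prefix-⋠ (p₁ ++ b ∷ []) (subst Stack (sym (List.++-assoc p₁ (b ∷ []) ls)) S) l∈ (∈-++⁺ʳ p₂ (here refl))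
      separate : ¬ Reach b₀ (stackWord p₁ ++ λbarWord b) r₀
      separate h with ∈-++⁻ (stackWord p₁) (reach-∈ h)
      ... | inj₂ r₀b = above (∈-++⁺ʳ p₁ (here refl)) (r₀-max b (λbarWord-letters r₀b))
      ... | inj₁ r₀∈′ with In-elim (stackWord-letters {p₁} r₀∈′)
      ... | l , l∈ , r₀l = above (∈-++⁺ˡ l∈) (r₀-max l r₀l)

    module _ {ps c q} (S : Stack (ps ++ c ∷ q)) (all : ∀ i → i ∈L ps ++ c ∷ q)
      (w≈ : w ≈ stackWord (ps ++ c ∷ q)) (sc : Block c s) where

      -- Going up the list from `c`, the first block above `c` would have no block strictly between,
      -- so it would cover `c`, which `no-cover` refutes. The recursion `none-above` replaces a
      -- search for that block, as the order is not decided.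
      lowest-maximal : IsMaxBlock D c
      lowest-maximal j c≼j with ∈-++⁻ ps (all j)
      ... | inj₂ (here refl) = refl
      ... | inj₂ (there j∈) = contradiction c≼j (head-⋠ (suffix-stack ps S) j∈)
      ... | inj₁ j∈ = contradiction c≼j (none-above [] ps refl j∈)
        where
        none-above : ∀ p₁ p₂ → p₁ ++ p₂ ≡ ps → ∀ {j} → j ∈L p₂ → ¬ c ≼ j
        none-above p₁ (b ∷ p₂) e (there j∈) c≼j = none-above (p₁ ++ b ∷ []) p₂ (trans (List.++-assoc p₁ (b ∷ []) p₂) e) j∈ c≼j
        none-above p₁ (b ∷ p₂) refl (here refl) c≼b = no-cover p₁ b p₂ c q S′
            (subst (λ ls → w ≈ stackWord ls) assoc w≈) sc
            (cover-connected c b (c≼b , c≢b) no-between)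
          where
          assoc : (p₁ ++ b ∷ p₂) ++ c ∷ q ≡ p₁ ++ b ∷ p₂ ++ c ∷ q
          assoc = List.++-assoc p₁ (b ∷ p₂) (c ∷ q)
          S′ : Stack (p₁ ++ b ∷ p₂ ++ c ∷ q)
          S′ = subst Stack assoc S
          c≢b : c ≢ b
          c≢b refl = prefix-⋠ (p₁ ++ b ∷ p₂) S (∈-++⁺ʳ p₁ (here refl)) (here refl) ≼-refl
          no-between : ∀ e → ¬ ((c ≼ e × c ≢ e) × (e ≼ b × e ≢ b))
          no-between e ((c≼e , c≢e) , (e≼b , e≢b)) with ∈-++⁻ p₁ (subst (e ∈L_) assoc (all e))
          ... | inj₁ e∈ = prefix-⋠ p₁ S′ e∈ (here refl) e≼b
          ... | inj₂ (here refl) = e≢b refl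
          ... | inj₂ (there h) with ∈-++⁻ p₂ h
          ... | inj₁ e∈ = none-above (p₁ ++ b ∷ []) p₂ (List.++-assoc p₁ (b ∷ []) p₂) e∈ c≼e
          ... | inj₂ (here refl) = c≢e refl
          ... | inj₂ (there e∈) = head-⋠ (suffix-stack ps S) e∈ c≼e

  module _ {ls} (S : Stack ls) (all : ∀ i → i ∈L ls) {w} (w≈ : w ≈ stackWord ls) {s : Fin n} where

    bp-stack⁻ : bp w s → ∃[ i ] (IsMaxBlock D i × bp (lab i) s × ¬ JR D i s)
    bp-stack⁻ h@(sw , v , u , bpd) with lowest-block (stackWord-letters {ls} (Supp-reduced (stackWord-reduced S) (Supp-resp w≈ sw)))
      where
      lowest-block : ∀ {ls s} → In ls s → ∃[ ps ] ∃[ c ] ∃[ q ] (ls ≡ ps ++ c ∷ q × Block c s × ¬ In q s)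
      lowest-block {i ∷ ls} {s} h with In? ls s
      ... | yes h′ with lowest-block h′
      ... | ps , c , q , e , sc , ¬sq = i ∷ ps , c , q , cong (i ∷_) e , sc , ¬sq
      lowest-block {i ∷ ls} (here si) | no ¬h = [] , i , ls , refl , si , ¬h
      lowest-block {i ∷ ls} (there h′) | no ¬h = contradiction h′ ¬h
    ... | ps , c , q , refl , sc , ¬sq = c , max , MaximalBlock.restrict-bp S max w≈ sc s∉JR h , s∉JR
      where
      max : IsMaxBlock D c
      max = lowest-maximal bpd S all w≈ sc
      s∉JR : ¬ JR D c s
      s∉JR jr = ¬sq (JR-In (suffix-stack ps S) jr)

    bp-stack⁺ : ∃[ i ] (IsMaxBlock D i × bp (lab i) s × ¬ JR D i s) → bp w s
    bp-stack⁺ (i , max , h , s∉JR) with ∈-∃++ (all i)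
    ... | ps , q , refl = MaximalBlock.lift-bp S max w≈ (Supp-lab (proj₁ h)) s∉JR h

  injective⇒surjective : ∀ {k} {σ : Fin k → Fin k} → (∀ a b → σ a ≡ σ b → a ≡ b) → ∀ i → ∃[ a ] (σ a ≡ i)
  injective⇒surjective {suc k} {σ} inj i with Fin.any? (λ a → σ a Fin.≟ i)
  ... | yes h = h
  ... | no ¬h = contradiction
    (Fin.injective⇒≤ {f = λ a → punchOut (miss a)} (λ {a} {b} e → inj a b (Fin.punchOut-injective (miss a) (miss b) e)))
    ℕ.1+n≰n
    where
    miss : ∀ a → i ≢ σ a
    miss a e = ¬h (a , sym e)

  AllPairs-reverse : ∀ {R : Fin k → Fin k → Set} {ls} → AllPairs (λ i j → R j i) ls → AllPairs R (reverse ls)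
  AllPairs-reverse [] = []
  AllPairs-reverse {R} {i ∷ ls} (h ∷ hs) = subst (AllPairs R) (sym (List.unfold-reverse i ls))
    (AllPairsP.++⁺ (AllPairs-reverse hs) ([] ∷ []) (All.tabulate λ j∈ → All.lookup h (AnyP.reverse⁻ j∈) ∷ []))

  module _ {σ : Fin k → Fin k} (ext : LinearExtension D σ) where

    blocks : List (Fin k)
    blocks = reverse (tabulate σ)

    blocks-all : ∀ i → i ∈L blocks
    blocks-all i with injective⇒surjective (proj₁ ext) i
    ... | a , refl = AnyP.reverse⁺ (∈-tabulate⁺ a)

    blocks-stack : Stack blocks
    blocks-stack = stack (AllPairs-reverse (AllPairsP.tabulate⁺-< (λ {a} {b} a<b b≼a → ℕ.<⇒≱ a<b (proj₂ ext b a b≼a))))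
      (λ _ _ → blocks-all _)

    blocks-Λ : Λ σ ≈ stackWord blocks
    blocks-Λ = ≈-trans (≡⇒≈ (cong concat reindex)) (go blocks)
      where
      open ≡-Reasoning
      reindex : reverse (tabulate (λ a → λbar (σ a))) ≡ map λbar blocks
      reindex = begin
        reverse (tabulate (λ a → λbar (σ a)))   ≡⟨ cong reverse (List.map-tabulate σ λbar) ⟨
        reverse (map λbar (tabulate σ))         ≡⟨ List.reverse-map λbar (tabulate σ) ⟨
        map λbar blocks                         ∎
      go : ∀ ls → concat (map λbar ls) ≈ stackWord ls
      go [] = ≈-refl
      go (i ∷ ls) = ++-cong (≈-sym (nf-≈ (λbar i))) (go ls)

theorem4p6 : ∀ {n : ℕ} (M : CoxeterMatrix n) (D : Coxeter.StaircaseDiagram M)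
    (L : Coxeter.Labelling M D) → Coxeter.Labelling.NearlyMaximalLabelling L →
    ∀ (σ : Fin (Coxeter.StaircaseDiagram.k D) → Fin (Coxeter.StaircaseDiagram.k D)) →
    Coxeter.LinearExtension M D σ →
    ∀ (s : Fin n) →
    (Coxeter.bp M (Coxeter.Labelling.Λ L σ) s →
    ∃[ i ] (Coxeter.IsMaxBlock M D i × Coxeter.bp M (Coxeter.Labelling.lab L i) s × ¬ Coxeter.JR M D i s))
    × (∃[ i ] (Coxeter.IsMaxBlock M D i × Coxeter.bp M (Coxeter.Labelling.lab L i) s × ¬ Coxeter.JR M D i s) →
    Coxeter.bp M (Coxeter.Labelling.Λ L σ) s)
theorem4p6 M D L nm σ ext s =
  bp-stack⁻ (blocks-stack ext) (blocks-all ext) (blocks-Λ ext)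
  , bp-stack⁺ (blocks-stack ext) (blocks-all ext) (blocks-Λ ext)
  where open NearlyMaximalStaircase M D L nm
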